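{- There is an algorithm that, given a tree metric $(V,\mathrm{d})$ with $|V|=n$, a set of terminals $\mathcal{X}\subseteq V$, a root $r\in\mathcal{X}$ and an integer $k\ge 1$, computes a minimum-cost $k$-hop Steiner tree exactly in time $n^{O(k)}$.
   Context: A graph $G=(V,E)$ with a positive edge-weight function induces the finite metric space $(V,\mathrm{d})$ if for all $u,v\in V$ the length of a shortest $u$-$v$ path in $G$ equals $\mathrm{d}(u,v)$. The metric $(V,\mathrm{d})$ is a tree metric if some weighted tree on vertex set $V$ induces it. The metric is assumed to be given by a graph inducing it. Given a finite metric space $(V,\mathrm{d})$ with $\mathrm{d}:V\times V\to\mathbb{Q}_+$, terminals $\mathcal{X}\subseteq V$, a root $r\in\mathcal{X}$ and an integer $k\ge1$, a $k$-hop Steiner tree is a tree $S=(V_S,E_S)$ rooted at $r$ with $\mathcal{X}\subseteq V_S\subseteq V$ whose edges are arbitrary pairs of points of $V_S$ (not necessarily edges of a graph inducing the metric), such that for every $v\in V_S$ the $r$-$v$ path in $S$ has at most $k$ edges. Its cost is $\sum_{\{u,v\}\in E_S}\mathrm{d}(u,v)$. A minimum-cost $k$-hop Steiner tree is a $k$-hop Steiner tree of minimum cost. -}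

module Defs where

open import Data.Bool.Base using (Bool; true; false; T; if_then_else_)
open import Data.Bool.Properties using (T?)
open import Data.Fin.Base using (Fin; toℕ)
open import Data.Fin.Properties using (_<?_)
open import Data.Fin.Subset using (Subset; _∈_; _⊆_)
open import Data.List.Base as List using (List; []; _∷_; allFin; cartesianProduct; filter; foldr)
import Data.List.Membership.Propositional as Mem
open import Data.List.Relation.Unary.All using (All; []; _∷_; lookup)
open import Data.List.Relation.Unary.Unique.Propositional using (Unique)
open import Data.Maybe.Base using (Maybe; just; nothing)
open import Data.Nat.Base as ℕ using (ℕ; zero; suc; _+_)
open import Data.Product.Base using (Σ-syntax; ∃-syntax; _×_; _,_; proj₁; uncurry)
open import Data.Rational.Base as ℚ using (ℚ; 0ℚ)
open import Data.Vec.Base using (toList)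
open import Function.Base using (_∘_)
open import Relation.Binary.Construct.Closure.ReflexiveTransitive using (Star; ε; _◅_)
open import Relation.Binary.Definitions using (Symmetric; Irreflexive)
open import Relation.Binary.PropositionalEquality.Core using (_≡_)
open import Relation.Nullary.Decidable using (_×-dec_)
open import Relation.Nullary.Negation using (¬_)

------------------------------------------------------------------------
-- Graphs and trees

-- A finite simple undirected graph whose vertices form a subset of the
-- n points Fin n.
record Graph (n : ℕ) : Set where
  field
    verts : Subset n
    edge? : Fin n → Fin n → Bool

  Edge : Fin n → Fin n → Set
  Edge u v = T (edge? u v)

  field
    edge-sym      : Symmetric Edge
    edge-irrefl   : Irreflexive _≡_ Edge
    edge-incident : ∀ {u v} → Edge u v → u ∈ verts

  Walk : Fin n → Fin n → Set
  Walk = Star Edge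

  visited : ∀ {u v} → Walk u v → List (Fin n)
  visited {u} ε       = u ∷ []
  visited {u} (_ ◅ w) = u ∷ visited w

  Path : Fin n → Fin n → Set
  Path u v = Σ[ w ∈ Walk u v ] Unique (visited w)

  walkHops : ∀ {u v} → Walk u v → ℕ
  walkHops ε       = 0
  walkHops (_ ◅ w) = suc (walkHops w)

  hops : ∀ {u v} → Path u v → ℕ
  hops = walkHops ∘ proj₁

  Connected : Set
  Connected = ∀ {u v} → u ∈ verts → v ∈ verts → Path u v

  -- An edge u v together with a path from v back to u of at least two
  -- edges is a simple cycle.
  Acyclic : Set
  Acyclic = ∀ {u v} → Edge u v → (p : Path v u) → ¬ (2 ℕ.≤ hops p)

  IsTree : Set
  IsTree = Connected × Acyclic

  -- Each unordered edge is listed once, with its smaller endpoint first.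
  edges : List (Fin n × Fin n)
  edges = filter (λ (u , v) → (u <? v) ×-dec T? (edge? u v))
                 (cartesianProduct (allFin n) (allFin n))

record WeightedGraph (n : ℕ) : Set where
  field
    graph : Graph n

  open Graph graph public

  field
    spanning   : ∀ v → v ∈ verts
    weight     : Fin n → Fin n → ℚ
    weight-sym : ∀ {u v} → Edge u v → weight u v ≡ weight v u
    weight-pos : ∀ {u v} → Edge u v → 0ℚ ℚ.< weight u v

  walkLength : ∀ {u v} → Walk u v → ℚ
  walkLength ε                       = 0ℚ
  walkLength (_◅_ {i = u} {j = v} _ w) = weight u v ℚ.+ walkLength w

  length : ∀ {u v} → Path u v → ℚ
  length = walkLength ∘ proj₁

  IsShortest : ∀ {u v} → Path u v → Set
  IsShortest {u} {v} p = (q : Path u v) → length p ℚ.≤ length q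

------------------------------------------------------------------------
-- Tree metrics and hop-constrained Steiner trees

Induces : ∀ {n} → WeightedGraph n → (Fin n → Fin n → ℚ) → Set
Induces {n} G d = (u v : Fin n) → Σ[ p ∈ Path u v ] IsShortest p × length p ≡ d u v
  where open WeightedGraph G

IsTreeMetric : ∀ {n} → (Fin n → Fin n → ℚ) → Set
IsTreeMetric {n} d =
  Σ[ G ∈ WeightedGraph n ] Graph.IsTree (WeightedGraph.graph G) × Induces G d

record IsHopSteinerTree {n : ℕ} (X : Subset n) (r : Fin n) (k : ℕ) (S : Graph n) : Set where
  open Graph S
  field
    isTree    : IsTree
    terminals : X ⊆ verts
    hop-bound : ∀ {v} → v ∈ verts → (p : Path r v) → hops p ℕ.≤ k

cost : ∀ {n} → (Fin n → Fin n → ℚ) → Graph n → ℚ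
cost d S = foldr ℚ._+_ 0ℚ (List.map (uncurry d) (Graph.edges S))

IsMinimumHopSteinerTree : ∀ {n} → (Fin n → Fin n → ℚ) → Subset n → Fin n → ℕ → Graph n → Set
IsMinimumHopSteinerTree d X r k S =
  IsHopSteinerTree X r k S × (∀ S′ → IsHopSteinerTree X r k S′ → cost d S ℚ.≤ cost d S′)

------------------------------------------------------------------------
-- The model of computation
--
-- Algorithms are closed programs of a call-by-value functional language
-- with general recursion.  Running time is the number of rules in the
-- evaluation derivation.  Since a program is fixed, a RAM with pointers
-- and environment-carrying closures performs each rule with O(1)
-- elementary operations.  Numbers have unit cost, but can only be
-- compared, and changed by successor and predecessor (on ℕ) or by
-- addition (on ℚ).  There is no multiplication, so the bit length of a
-- number is polynomial in the running time and the input's bit length,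
-- and unit cost does not hide superpolynomial work.

infixr 6 _⇒_
infixr 7 _⊗_

data Ty : Set where
  bool nat rat : Ty
  maybe list   : Ty → Ty
  _⊗_ _⇒_      : Ty → Ty → Ty

Ctx : Set
Ctx = List Ty

_∋_ : Ctx → Ty → Set
Γ ∋ A = A Mem.∈ Γ

data Tm (Γ : Ctx) : Ty → Set where
  var       : ∀ {A} → Γ ∋ A → Tm Γ A
  letin     : ∀ {A B} → Tm Γ A → Tm (A ∷ Γ) B → Tm Γ B
  -- A recursive function: its body sees the argument and the function itself.
  fun       : ∀ {A B} → Tm (A ∷ (A ⇒ B) ∷ Γ) B → Tm Γ (A ⇒ B)
  app       : ∀ {A B} → Tm Γ (A ⇒ B) → Tm Γ A → Tm Γ B
  true      : Tm Γ bool
  false     : Tm Γ bool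
  ifte      : ∀ {A} → Tm Γ bool → Tm Γ A → Tm Γ A → Tm Γ A
  zero      : Tm Γ nat
  suc       : Tm Γ nat → Tm Γ nat
  caseNat   : ∀ {A} → Tm Γ nat → Tm Γ A → Tm (nat ∷ Γ) A → Tm Γ A
  leqNat    : Tm Γ nat → Tm Γ nat → Tm Γ bool
  ratLit    : ℚ → Tm Γ rat
  addRat    : Tm Γ rat → Tm Γ rat → Tm Γ rat
  leqRat    : Tm Γ rat → Tm Γ rat → Tm Γ bool
  nothing   : ∀ {A} → Tm Γ (maybe A)
  just      : ∀ {A} → Tm Γ A → Tm Γ (maybe A)
  caseMaybe : ∀ {A B} → Tm Γ (maybe A) → Tm Γ B → Tm (A ∷ Γ) B → Tm Γ B
  pair      : ∀ {A B} → Tm Γ A → Tm Γ B → Tm Γ (A ⊗ B)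
  fst       : ∀ {A B} → Tm Γ (A ⊗ B) → Tm Γ A
  snd       : ∀ {A B} → Tm Γ (A ⊗ B) → Tm Γ B
  nil       : ∀ {A} → Tm Γ (list A)
  cons      : ∀ {A} → Tm Γ A → Tm Γ (list A) → Tm Γ (list A)
  caseList  : ∀ {A B} → Tm Γ (list A) → Tm Γ B → Tm (A ∷ list A ∷ Γ) B → Tm Γ B

-- Function values are closures: a function body with the values of its
-- free variables.
mutual
  ⟦_⟧ : Ty → Set
  ⟦ bool ⟧    = Bool
  ⟦ nat ⟧     = ℕ
  ⟦ rat ⟧     = ℚ
  ⟦ maybe A ⟧ = Maybe ⟦ A ⟧
  ⟦ list A ⟧  = List ⟦ A ⟧
  ⟦ A ⊗ B ⟧   = ⟦ A ⟧ × ⟦ B ⟧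
  ⟦ A ⇒ B ⟧   = Closure A B

  data Closure (A B : Ty) : Set where
    closure : ∀ {Γ} → Tm (A ∷ (A ⇒ B) ∷ Γ) B → All ⟦_⟧ Γ → Closure A B

Env : Ctx → Set
Env Γ = All ⟦_⟧ Γ

infix 3 _⊢_⇓_⟨_⟩

-- ρ ⊢ e ⇓ v ⟨ t ⟩: in the environment ρ, the program e evaluates to v in
-- t steps.
data _⊢_⇓_⟨_⟩ {Γ : Ctx} (ρ : Env Γ) : ∀ {A} → Tm Γ A → ⟦ A ⟧ → ℕ → Set where

  ⇓var : ∀ {A} {x : Γ ∋ A} → ρ ⊢ var x ⇓ lookup ρ x ⟨ 1 ⟩

  ⇓let : ∀ {A B} {e : Tm Γ A} {f : Tm (A ∷ Γ) B} {v w s t} →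
         ρ ⊢ e ⇓ v ⟨ s ⟩ → v ∷ ρ ⊢ f ⇓ w ⟨ t ⟩ →
         ρ ⊢ letin e f ⇓ w ⟨ suc (s + t) ⟩

  ⇓fun : ∀ {A B} {b : Tm (A ∷ (A ⇒ B) ∷ Γ) B} →
         ρ ⊢ fun b ⇓ closure b ρ ⟨ 1 ⟩

  ⇓app : ∀ {A B Δ} {f : Tm Γ (A ⇒ B)} {e : Tm Γ A}
           {b : Tm (A ∷ (A ⇒ B) ∷ Δ) B} {σ : Env Δ} {v w s t u} →
         ρ ⊢ f ⇓ closure b σ ⟨ s ⟩ → ρ ⊢ e ⇓ v ⟨ t ⟩ →
         v ∷ closure b σ ∷ σ ⊢ b ⇓ w ⟨ u ⟩ →
         ρ ⊢ app f e ⇓ w ⟨ suc (s + t + u) ⟩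

  ⇓true  : ρ ⊢ true  ⇓ true  ⟨ 1 ⟩
  ⇓false : ρ ⊢ false ⇓ false ⟨ 1 ⟩

  ⇓if-true : ∀ {A} {b} {e f : Tm Γ A} {v s t} →
             ρ ⊢ b ⇓ true ⟨ s ⟩ → ρ ⊢ e ⇓ v ⟨ t ⟩ →
             ρ ⊢ ifte b e f ⇓ v ⟨ suc (s + t) ⟩

  ⇓if-false : ∀ {A} {b} {e f : Tm Γ A} {v s t} →
              ρ ⊢ b ⇓ false ⟨ s ⟩ → ρ ⊢ f ⇓ v ⟨ t ⟩ →
              ρ ⊢ ifte b e f ⇓ v ⟨ suc (s + t) ⟩

  ⇓zero : ρ ⊢ zero ⇓ zero ⟨ 1 ⟩

  ⇓suc : ∀ {e m s} → ρ ⊢ e ⇓ m ⟨ s ⟩ → ρ ⊢ suc e ⇓ suc m ⟨ suc s ⟩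

  ⇓case-zero : ∀ {A e} {f : Tm Γ A} {g v s t} →
               ρ ⊢ e ⇓ zero ⟨ s ⟩ → ρ ⊢ f ⇓ v ⟨ t ⟩ →
               ρ ⊢ caseNat e f g ⇓ v ⟨ suc (s + t) ⟩

  ⇓case-suc : ∀ {A e} {f : Tm Γ A} {g m v s t} →
              ρ ⊢ e ⇓ suc m ⟨ s ⟩ → m ∷ ρ ⊢ g ⇓ v ⟨ t ⟩ →
              ρ ⊢ caseNat e f g ⇓ v ⟨ suc (s + t) ⟩

  ⇓leqNat : ∀ {e f l m s t} →
            ρ ⊢ e ⇓ l ⟨ s ⟩ → ρ ⊢ f ⇓ m ⟨ t ⟩ →
            ρ ⊢ leqNat e f ⇓ l ℕ.≤ᵇ m ⟨ suc (s + t) ⟩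

  ⇓ratLit : ∀ {q} → ρ ⊢ ratLit q ⇓ q ⟨ 1 ⟩

  ⇓addRat : ∀ {e f p q s t} →
            ρ ⊢ e ⇓ p ⟨ s ⟩ → ρ ⊢ f ⇓ q ⟨ t ⟩ →
            ρ ⊢ addRat e f ⇓ p ℚ.+ q ⟨ suc (s + t) ⟩

  ⇓leqRat : ∀ {e f p q s t} →
            ρ ⊢ e ⇓ p ⟨ s ⟩ → ρ ⊢ f ⇓ q ⟨ t ⟩ →
            ρ ⊢ leqRat e f ⇓ p ℚ.≤ᵇ q ⟨ suc (s + t) ⟩

  ⇓nothing : ∀ {A} → ρ ⊢ nothing {A = A} ⇓ nothing ⟨ 1 ⟩

  ⇓just : ∀ {A} {e : Tm Γ A} {v s} →
          ρ ⊢ e ⇓ v ⟨ s ⟩ → ρ ⊢ just e ⇓ just v ⟨ suc s ⟩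

  ⇓case-nothing : ∀ {A B} {e : Tm Γ (maybe A)} {f : Tm Γ B} {g v s t} →
                  ρ ⊢ e ⇓ nothing ⟨ s ⟩ → ρ ⊢ f ⇓ v ⟨ t ⟩ →
                  ρ ⊢ caseMaybe e f g ⇓ v ⟨ suc (s + t) ⟩

  ⇓case-just : ∀ {A B} {e : Tm Γ (maybe A)} {f : Tm Γ B} {g v w s t} →
               ρ ⊢ e ⇓ just v ⟨ s ⟩ → v ∷ ρ ⊢ g ⇓ w ⟨ t ⟩ →
               ρ ⊢ caseMaybe e f g ⇓ w ⟨ suc (s + t) ⟩

  ⇓pair : ∀ {A B} {e : Tm Γ A} {f : Tm Γ B} {v w s t} →
          ρ ⊢ e ⇓ v ⟨ s ⟩ → ρ ⊢ f ⇓ w ⟨ t ⟩ →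
          ρ ⊢ pair e f ⇓ (v , w) ⟨ suc (s + t) ⟩

  ⇓fst : ∀ {A B} {e : Tm Γ (A ⊗ B)} {v w s} →
         ρ ⊢ e ⇓ (v , w) ⟨ s ⟩ → ρ ⊢ fst e ⇓ v ⟨ suc s ⟩

  ⇓snd : ∀ {A B} {e : Tm Γ (A ⊗ B)} {v w s} →
         ρ ⊢ e ⇓ (v , w) ⟨ s ⟩ → ρ ⊢ snd e ⇓ w ⟨ suc s ⟩

  ⇓nil : ∀ {A} → ρ ⊢ nil {A = A} ⇓ [] ⟨ 1 ⟩

  ⇓cons : ∀ {A} {e : Tm Γ A} {f v vs s t} →
          ρ ⊢ e ⇓ v ⟨ s ⟩ → ρ ⊢ f ⇓ vs ⟨ t ⟩ →
          ρ ⊢ cons e f ⇓ v ∷ vs ⟨ suc (s + t) ⟩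

  ⇓case-nil : ∀ {A B} {e : Tm Γ (list A)} {f : Tm Γ B} {g v s t} →
              ρ ⊢ e ⇓ [] ⟨ s ⟩ → ρ ⊢ f ⇓ v ⟨ t ⟩ →
              ρ ⊢ caseList e f g ⇓ v ⟨ suc (s + t) ⟩

  ⇓case-cons : ∀ {A B} {e : Tm Γ (list A)} {f : Tm Γ B} {g v vs w s t} →
               ρ ⊢ e ⇓ v ∷ vs ⟨ s ⟩ → v ∷ vs ∷ ρ ⊢ g ⇓ w ⟨ t ⟩ →
               ρ ⊢ caseList e f g ⇓ w ⟨ suc (s + t) ⟩

-- A program has one free variable, which holds its input.
Program : Ty → Ty → Set
Program A B = Tm (A ∷ []) B

_on_computes_within_ : ∀ {A B} → Program A B → ⟦ A ⟧ → ⟦ B ⟧ → ℕ → Set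
P on x computes y within b = ∃[ t ] (x ∷ [] ⊢ P ⇓ y ⟨ t ⟩) × t ℕ.≤ b

------------------------------------------------------------------------
-- Input and output formats

matrix : ∀ {n} {A : Set} → (Fin n → Fin n → A) → List (List A)
matrix f = List.tabulate (λ u → List.tabulate (f u))

-- A weighted graph is given by its adjacency matrix, with nothing for
-- non-edges; then come the terminals, the root and the hop bound.
Input : Ty
Input = list (list (maybe rat)) ⊗ list bool ⊗ nat ⊗ nat

encodeInput : ∀ {n} → WeightedGraph n → Subset n → Fin n → ℕ → ⟦ Input ⟧
encodeInput G X r k = matrix entry , toList X , toℕ r , k
  where
  open WeightedGraph G
  entry : Fin _ → Fin _ → Maybe ℚ
  entry u v = if edge? u v then just (weight u v) else nothing

Output : Ty
Output = list bool ⊗ list (list bool)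

encodeGraph : ∀ {n} → Graph n → ⟦ Output ⟧
encodeGraph S = toList verts , matrix edge?
  where open Graph S

{-# OPTIONS --safe #-}

-- Call r the only vertex of level 0, and let κ = k - 1.  The profile of a
-- vertex v lists, for every level i ≤ κ, the vertex of level at most i that is
-- nearest to v.  The profiles determine a k-hop tree: v belongs to it if v is
-- a terminal or occurs in its own profile, and its parent is the entry
-- preceding its first occurrence (the last entry if there is none).  The cost
-- of the tree is the sum over v of the distance from v to its parent, so it
-- splits into contributions of the single profiles.
--
-- Which families of profiles arise is a local condition along the edges of
-- the metric tree: for an edge from p to its child c, the entries of p and c
-- at any level are equal, or the former lies outside and the latter inside
-- the subtree of c.  Conversely, under this condition every entry w of a
-- profile is passed on along the path to w, hence occurs in its own profile.
-- It remains to minimise a sum of vertex costs over a tree with n ^ κ states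
-- per vertex, where neighbouring states must be compatible.  The table
--   F v P = cost v P + Σ_c min { F c Q | Q compatible with P }
-- is the fixpoint reached after n rounds.  Summing this equation over all
-- vertices and exchanging the two sums shows that min F r is the optimum.
--
-- The distances come from n rounds of Bellman and Ford's relaxation, and the
-- edges of the metric tree are the covering pairs of the order
-- u ⊑ v ⇔ d r u + d u v ≤ d r v.  The only property of tree metrics needed is
-- that the path from a child c to any vertex outside of its subtree passes
-- through its parent.
--
-- The program is compiled from a first-order language in which all loops
-- range over arrays of length n, κ or n ^ κ.  With M = n ^ k these lengths are
-- at most M, so every expression is evaluated within c * M ^ c steps, where c
-- is computed from its syntax.

module Submission where

-- A first-order array language, its compilation and the cost of compiled code.

module Language where

  open import Defs
  open import Data.Bool.Base using (Bool; true; false; if_then_else_; T)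
  open import Data.Fin.Base using (Fin; zero; suc; toℕ)
  import Data.Fin.Properties as Fin
  open import Data.List.Base as List using (List; []; _∷_)
  open import Data.List.Membership.Propositional using (_∈_)
  open import Data.List.Relation.Unary.All using (All; []; _∷_; lookup)
  open import Data.List.Relation.Unary.Any using (here; there)
  open import Data.Maybe.Base as Maybe using (Maybe; just; nothing; maybe′)
  open import Data.Nat.Base
  open import Data.Nat.Properties
  open import Data.Nat.Solver using (module +-*-Solver)
  open import Data.Product.Base using (∃-syntax; _×_; _,_; proj₁; proj₂)
  open import Data.Rational.Base as ℚ using (ℚ; 0ℚ)
  open import Data.Vec.Functional as Vector using (Vector)
  open import Function.Base using (_∘_; id)
  open import Relation.Binary.PropositionalEquality
  open import Relation.Nullary.Negation using (contradiction)
  open import Relation.Nullary.Decidable.Core using (does; yes; no)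

  infixr 7 _⊠_

  -- Arrays are indexed by the vertices, the levels 1, …, κ, or the profiles,
  -- which are the n ^ κ functions from levels to vertices.
  data Dim : Set where
    V K P : Dim

  -- An `idx s` denotes a number below the length of an `arr s`, so every lookup is within bounds by
  -- typing.
  data MTy : Set where
    bool rat : MTy
    idx      : Dim → MTy
    maybe    : MTy → MTy
    _⊠_      : MTy → MTy → MTy
    arr      : Dim → MTy → MTy

  ⌊_⌋ᵗ : MTy → Ty
  ⌊ bool ⌋ᵗ    = bool
  ⌊ rat ⌋ᵗ     = rat
  ⌊ idx s ⌋ᵗ   = nat
  ⌊ maybe A ⌋ᵗ = maybe ⌊ A ⌋ᵗ
  ⌊ A ⊠ B ⌋ᵗ   = ⌊ A ⌋ᵗ ⊗ ⌊ B ⌋ᵗ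
  ⌊ arr s A ⌋ᵗ = list ⌊ A ⌋ᵗ

  MCtx : Set
  MCtx = List MTy

  data Exp (Γ : MCtx) : MTy → Set where
    var       : ∀ {A} → A ∈ Γ → Exp Γ A
    letin     : ∀ {A B} → Exp Γ A → Exp (A ∷ Γ) B → Exp Γ B
    true      : Exp Γ bool
    false     : Exp Γ bool
    ifte      : ∀ {A} → Exp Γ bool → Exp Γ A → Exp Γ A → Exp Γ A
    zeroRat   : Exp Γ rat
    addRat    : Exp Γ rat → Exp Γ rat → Exp Γ rat
    leqRat    : Exp Γ rat → Exp Γ rat → Exp Γ bool
    eqIdx     : ∀ {s} → Exp Γ (idx s) → Exp Γ (idx s) → Exp Γ bool
    nothing   : ∀ {A} → Exp Γ (maybe A)
    just      : ∀ {A} → Exp Γ A → Exp Γ (maybe A)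
    caseMaybe : ∀ {A B} → Exp Γ (maybe A) → Exp Γ B → Exp (A ∷ Γ) B → Exp Γ B
    pair      : ∀ {A B} → Exp Γ A → Exp Γ B → Exp Γ (A ⊠ B)
    fst       : ∀ {A B} → Exp Γ (A ⊠ B) → Exp Γ A
    snd       : ∀ {A B} → Exp Γ (A ⊠ B) → Exp Γ B
    mapArr    : ∀ {s A B} → Exp Γ (arr s A) → Exp (A ∷ Γ) B → Exp Γ (arr s B)
    foldArr   : ∀ {s A B} → Exp Γ (arr s A) → Exp Γ B → Exp (B ∷ A ∷ Γ) B → Exp Γ B
    lookupArr : ∀ {s A} → Exp Γ (arr s A) → Exp Γ (idx s) → Exp Γ A

  module _ {Δ : Ctx} {A B : Ty} where

    -- The step term sees, from the innermost variable on, the result for the tail, the head, the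
    -- tail, the whole list and the recursive function.
    foldBody : Tm (list A ∷ (list A ⇒ B) ∷ Δ) B →
               Tm (B ∷ A ∷ list A ∷ list A ∷ (list A ⇒ B) ∷ Δ) B →
               Tm (list A ∷ (list A ⇒ B) ∷ Δ) B
    foldBody z s = caseList (var (here refl)) z
      (letin (app (var (there (there (there (here refl))))) (var (there (here refl)))) s)

    foldTm : Tm Δ (list A) → Tm (list A ∷ (list A ⇒ B) ∷ Δ) B →
             Tm (B ∷ A ∷ list A ∷ list A ∷ (list A ⇒ B) ∷ Δ) B → Tm Δ B
    foldTm xs z s = app (fun (foldBody z s)) xs

  -- The out-of-bounds branch diverges; it is never reached.
  lookupBody : ∀ {A Δ} → Tm ((list A ⊗ nat) ∷ ((list A ⊗ nat) ⇒ A) ∷ Δ) A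
  lookupBody = caseList (fst (var (here refl)))
    (app (var (there (here refl))) (var (here refl)))
    (caseNat (snd (var (there (there (here refl)))))
      (var (here refl))
      (app (var (there (there (there (there (here refl))))))
           (pair (var (there (there (here refl)))) (var (here refl)))))

  -- Compiled loop bodies run under additional variables, such as the remaining list and the
  -- recursive function. Variables are therefore tracked by a renaming and not by position.
  Embedding : MCtx → Ctx → Set
  Embedding Γ Δ = ∀ {A} → A ∈ Γ → ⌊ A ⌋ᵗ ∈ Δ

  bind : ∀ {Γ Δ A} → Embedding Γ Δ → Embedding (A ∷ Γ) (⌊ A ⌋ᵗ ∷ Δ)
  bind σ (here refl) = here refl
  bind σ (there x)   = there (σ x)

  wk : ∀ {Γ Δ C} → Embedding Γ Δ → Embedding Γ (C ∷ Δ)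
  wk σ x = there (σ x)

  compile : ∀ {Γ Δ A} → Embedding Γ Δ → Exp Γ A → Tm Δ ⌊ A ⌋ᵗ
  compile σ (var x)           = var (σ x)
  compile σ (letin e f)       = letin (compile σ e) (compile (bind σ) f)
  compile σ true              = true
  compile σ false             = false
  compile σ (ifte b e f)      = ifte (compile σ b) (compile σ e) (compile σ f)
  compile σ zeroRat           = ratLit 0ℚ
  compile σ (addRat e f)      = addRat (compile σ e) (compile σ f)
  compile σ (leqRat e f)      = leqRat (compile σ e) (compile σ f)
  -- Numbers can only be compared by order, so equality is tested by two comparisons.
  compile σ (eqIdx e f)       =
    ifte (leqNat (compile σ e) (compile σ f)) (leqNat (compile σ f) (compile σ e)) false
  compile σ nothing           = nothing
  compile σ (just e)          = just (compile σ e)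
  compile σ (caseMaybe e f g) = caseMaybe (compile σ e) (compile σ f) (compile (bind σ) g)
  compile σ (pair e f)        = pair (compile σ e) (compile σ f)
  compile σ (fst e)           = fst (compile σ e)
  compile σ (snd e)           = snd (compile σ e)
  compile σ (mapArr e f)      = foldTm (compile σ e) nil
    (cons (compile (wk (bind (wk (wk (wk σ))))) f) (var (here refl)))
  compile σ (foldArr e z f)   = foldTm (compile σ e) (compile (wk (wk σ)) z)
    (compile (bind (bind (wk (wk (wk σ))))) f)
  compile σ (lookupArr e i)   = app (fun lookupBody) (pair (compile σ e) (compile σ i))

  -- A degree c stands for the bound c * M ^ c. In the folds, 7 is the overhead of 6 rules per round
  -- plus 1 for the factor M; in a lookup, 12 is likewise 11 + 1.
  degree : ∀ {Γ A} → Exp Γ A → ℕ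
  degree (var x)           = 1
  degree (letin e f)       = 1 + (degree e + degree f)
  degree true              = 1
  degree false             = 1
  degree (ifte b e f)      = 1 + (degree b + (degree e + degree f))
  degree zeroRat           = 1
  degree (addRat e f)      = 1 + (degree e + degree f)
  degree (leqRat e f)      = 1 + (degree e + degree f)
  degree (eqIdx e f)       =
    1 + ((1 + (degree e + degree f)) + ((1 + (degree f + degree e)) + 1))
  degree nothing           = 1
  degree (just e)          = 1 + degree e
  degree (caseMaybe e f g) = 1 + (degree e + (degree f + degree g))
  degree (pair e f)        = 1 + (degree e + degree f)
  degree (fst e)           = 1 + degree e
  degree (snd e)           = 1 + degree e
  degree (mapArr e f)      = 2 + (degree e + ((7 + (1 + (degree f + 1))) + (2 + 1)))
  degree (foldArr e z f)   = 2 + (degree e + ((7 + degree f) + (2 + degree z)))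
  degree (lookupArr e i)   = 2 + ((1 + (degree e + degree i)) + (12 + 7))

  module Semantics (n κ : ℕ) where

    size : Dim → ℕ
    size V = n
    size K = κ
    size P = n ^ κ

    ⟪_⟫ : MTy → Set
    ⟪ bool ⟫    = Bool
    ⟪ rat ⟫     = ℚ
    ⟪ idx s ⟫   = Fin (size s)
    ⟪ maybe A ⟫ = Maybe ⟪ A ⟫
    ⟪ A ⊠ B ⟫   = ⟪ A ⟫ × ⟪ B ⟫
    ⟪ arr s A ⟫ = Vector ⟪ A ⟫ (size s)

    enc : ∀ A → ⟪ A ⟫ → ⟦ ⌊ A ⌋ᵗ ⟧
    enc bool      b       = b
    enc rat       q       = q
    enc (idx s)   i       = toℕ i
    enc (maybe A) x       = Maybe.map (enc A) x
    enc (A ⊠ B)   (x , y) = enc A x , enc B y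
    enc (arr s A) f       = List.tabulate (λ i → enc A (f i))

    MEnv : MCtx → Set
    MEnv Γ = All ⟪_⟫ Γ

    eval : ∀ {Γ A} → Exp Γ A → MEnv Γ → ⟪ A ⟫
    eval (var x)           ρ = lookup ρ x
    eval (letin e f)       ρ = eval f (eval e ρ ∷ ρ)
    eval true              ρ = true
    eval false             ρ = false
    eval (ifte b e f)      ρ = if eval b ρ then eval e ρ else eval f ρ
    eval zeroRat           ρ = 0ℚ
    eval (addRat e f)      ρ = eval e ρ ℚ.+ eval f ρ
    eval (leqRat e f)      ρ = eval e ρ ℚ.≤ᵇ eval f ρ
    eval (eqIdx e f)       ρ = does (eval e ρ Fin.≟ eval f ρ)
    eval nothing           ρ = nothing
    eval (just e)          ρ = just (eval e ρ)
    eval (caseMaybe e f g) ρ = maybe′ (λ x → eval g (x ∷ ρ)) (eval f ρ) (eval e ρ)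
    eval (pair e f)        ρ = eval e ρ , eval f ρ
    eval (fst e)           ρ = proj₁ (eval e ρ)
    eval (snd e)           ρ = proj₂ (eval e ρ)
    eval (mapArr e f)      ρ = λ i → eval f (eval e ρ i ∷ ρ)
    eval (foldArr e z f)   ρ =
      Vector.foldr (λ x y → eval f (y ∷ x ∷ ρ)) (eval z ρ) (eval e ρ)
    eval (lookupArr e i)   ρ = eval e ρ (eval i ρ)

  module Cost (M : ℕ) (1≤M : 1 ≤ M) where

    instance
      M≢0 : NonZero M
      M≢0 = >-nonZero 1≤M

    abstract

      -- One number serves as factor and as exponent. Bounds then add up under sequencing, and a
      -- loop of at most M rounds raises the number by one.
      poly : ℕ → ℕ
      poly c = c * M ^ c

      poly-mono : ∀ {a b} → a ≤ b → poly a ≤ poly b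
      poly-mono a≤b = *-mono-≤ a≤b (^-monoʳ-≤ M a≤b)

      poly-const : ∀ c → c ≤ poly c
      poly-const c = m≤m*n c (M ^ c) {{m^n≢0 M c}}

      poly-+ : ∀ a b {s t} → s ≤ poly a → t ≤ poly b → s + t ≤ poly (a + b)
      poly-+ a b {s} {t} s≤ t≤ = begin
        s + t                                 ≤⟨ +-mono-≤ s≤ t≤ ⟩
        a * M ^ a + b * M ^ b                 ≤⟨ +-mono-≤ (*-monoʳ-≤ a (^-monoʳ-≤ M (m≤m+n a b))) (*-monoʳ-≤ b (^-monoʳ-≤ M (m≤n+m b a))) ⟩
        a * M ^ (a + b) + b * M ^ (a + b)     ≡⟨ *-distribʳ-+ (M ^ (a + b)) a b ⟨
        poly (a + b)                          ∎
        where open ≤-Reasoning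

      poly-* : ∀ a {m t} → m ≤ M → t ≤ poly a → m * t ≤ poly (suc a)
      poly-* a {m} {t} m≤M t≤ = begin
        m * t             ≤⟨ *-mono-≤ m≤M t≤ ⟩
        M * (a * M ^ a)   ≡⟨ solve 3 (λ m a p → m :* (a :* p) := a :* (m :* p)) refl M a (M ^ a) ⟩
        a * M ^ suc a     ≤⟨ *-monoˡ-≤ (M ^ suc a) (n≤1+n a) ⟩
        poly (suc a)      ∎
        where
        open ≤-Reasoning
        open +-*-Solver using (solve; _:*_; _:=_)

      poly≡ : ∀ c → poly c ≡ c * M ^ c
      poly≡ c = refl

    infix 3 _⊢_⇓_≲_

    record _⊢_⇓_≲_ {Γ A} (ρ : Env Γ) (e : Tm Γ A) (v : ⟦ A ⟧) (c : ℕ) : Set where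
      constructor within
      field
        steps      : ℕ
        derivation : ρ ⊢ e ⇓ v ⟨ steps ⟩
        bound      : steps ≤ poly c

    rule₀ : ∀ {Γ A} {ρ : Env Γ} {e : Tm Γ A} {v} → ρ ⊢ e ⇓ v ⟨ 1 ⟩ → ρ ⊢ e ⇓ v ≲ 1
    rule₀ d = within 1 d (poly-const 1)

    rule₁ : ∀ {Γ Γ′ A A′} {ρ : Env Γ} {ρ′ : Env Γ′} {e : Tm Γ A} {e′ : Tm Γ′ A′} {v v′} →
            (∀ {s} → ρ ⊢ e ⇓ v ⟨ s ⟩ → ρ′ ⊢ e′ ⇓ v′ ⟨ suc s ⟩) →
            ∀ {a} → ρ ⊢ e ⇓ v ≲ a → ρ′ ⊢ e′ ⇓ v′ ≲ 1 + a
    rule₁ r {a} (within s d p) = within (suc s) (r d) (poly-+ 1 a (poly-const 1) p)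

    rule₂ : ∀ {Γ₁ Γ₂ Γ A₁ A₂ A} {ρ₁ : Env Γ₁} {ρ₂ : Env Γ₂} {ρ : Env Γ}
            {e₁ : Tm Γ₁ A₁} {e₂ : Tm Γ₂ A₂} {e : Tm Γ A} {v₁ v₂ v} →
            (∀ {s t} → ρ₁ ⊢ e₁ ⇓ v₁ ⟨ s ⟩ → ρ₂ ⊢ e₂ ⇓ v₂ ⟨ t ⟩ → ρ ⊢ e ⇓ v ⟨ suc (s + t) ⟩) →
            ∀ {a b} → ρ₁ ⊢ e₁ ⇓ v₁ ≲ a → ρ₂ ⊢ e₂ ⇓ v₂ ≲ b → ρ ⊢ e ⇓ v ≲ 1 + (a + b)
    rule₂ r {a} {b} (within s d p) (within t d′ p′) =
      within (suc (s + t)) (r d d′) (poly-+ 1 (a + b) (poly-const 1) (poly-+ a b p p′))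

    weaken : ∀ {Γ A} {ρ : Env Γ} {e : Tm Γ A} {v a b} → a ≤ b → ρ ⊢ e ⇓ v ≲ a → ρ ⊢ e ⇓ v ≲ b
    weaken a≤b (within t d p) = within t d (≤-trans p (poly-mono a≤b))

    cast : ∀ {Γ A} {ρ : Env Γ} {e : Tm Γ A} {v w c} → v ≡ w → ρ ⊢ e ⇓ v ≲ c → ρ ⊢ e ⇓ w ≲ c
    cast refl e⇓ = e⇓

    ≲var : ∀ {Γ A} {ρ : Env Γ} (x : Γ ∋ A) {v} → lookup ρ x ≡ v → ρ ⊢ var x ⇓ v ≲ 1
    ≲var x refl = rule₀ ⇓var

    ≲app : ∀ {Γ Δ A B} {ρ : Env Γ} {f : Tm Γ (A ⇒ B)} {e : Tm Γ A}
           {b : Tm (A ∷ (A ⇒ B) ∷ Δ) B} {σ : Env Δ} {v w a c u} →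
           ρ ⊢ f ⇓ closure b σ ≲ a → ρ ⊢ e ⇓ v ≲ c → v ∷ closure b σ ∷ σ ⊢ b ⇓ w ≲ u →
           ρ ⊢ app f e ⇓ w ≲ 1 + (a + c + u)
    ≲app {a = a} {c} {u} (within s d p) (within t d′ p′) (within s″ d″ p″) =
      within (suc (s + t + s″)) (⇓app d d′ d″)
        (poly-+ 1 (a + c + u) (poly-const 1) (poly-+ (a + c) u (poly-+ a c p p′) p″))

    module Fold {Δ A B} {δ : Env Δ} {z : Tm (list A ∷ (list A ⇒ B) ∷ Δ) B}
      {s : Tm (B ∷ A ∷ list A ∷ list A ∷ (list A ⇒ B) ∷ Δ) B}
      {X Y : Set} (eX : X → ⟦ A ⟧) (eY : Y → ⟦ B ⟧) (g : X → Y → Y) (y₀ : Y)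
      {a b : ℕ}
      (z⇓ : [] ∷ closure (foldBody z s) δ ∷ δ ⊢ z ⇓ eY y₀ ≲ a)
      (s⇓ : ∀ x y l → eY y ∷ eX x ∷ l ∷ (eX x ∷ l) ∷ closure (foldBody z s) δ ∷ δ
                        ⊢ s ⇓ eY (g x y) ≲ b)
      where

      -- Induction on the length. Besides the step term, a round consists of 6 rules: the case
      -- distinction, the binding, the call and three variables.
      body⇓ : ∀ {m} (xs : Vector X m) → ∃[ t ]
              (List.tabulate (eX ∘ xs) ∷ closure (foldBody z s) δ ∷ δ
                 ⊢ foldBody z s ⇓ eY (Vector.foldr g y₀ xs) ⟨ t ⟩)
              × t ≤ m * (6 + poly b) + (2 + poly a)
      body⇓ {zero} xs = let (within t d p) = z⇓ in suc (1 + t) , ⇓case-nil ⇓var d , +-monoʳ-≤ 2 p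
      body⇓ {suc m} xs with body⇓ (xs ∘ suc) | s⇓ (xs zero) (Vector.foldr g y₀ (xs ∘ suc)) (List.tabulate (eX ∘ xs ∘ suc))
      ... | t , d , p | within t′ d′ p′ =
        suc (1 + suc (suc (1 + 1 + t) + t′)) ,
        ⇓case-cons ⇓var (⇓let (⇓app ⇓var ⇓var d) d′) ,
        (begin
          6 + (t + t′)                                          ≡⟨ cong (6 +_) (+-comm t t′) ⟩
          6 + (t′ + t)                                          ≤⟨ +-monoʳ-≤ 6 (+-mono-≤ p′ p) ⟩
          6 + (poly b + (m * (6 + poly b) + (2 + poly a)))      ≡⟨ cong (6 +_) (+-assoc (poly b) (m * (6 + poly b)) (2 + poly a)) ⟨
          suc m * (6 + poly b) + (2 + poly a)                   ∎)
        where open ≤-Reasoning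

      fold⇓ : ∀ {m} → m ≤ M → (xs : Vector X m) →
              ∀ {e c} → δ ⊢ e ⇓ List.tabulate (eX ∘ xs) ≲ c →
              δ ⊢ foldTm e z s ⇓ eY (Vector.foldr g y₀ xs) ≲ 2 + (c + ((7 + b) + (2 + a)))
      fold⇓ {m} m≤M xs {e} {c} (within t d p) with body⇓ xs
      ... | t′ , d′ , p′ = within (suc (1 + t + t′)) (⇓app ⇓fun d d′)
        (poly-+ 2 (c + ((7 + b) + (2 + a))) (poly-const 2) (poly-+ c ((7 + b) + (2 + a)) p (≤-trans p′
          (poly-+ (7 + b) (2 + a)
            (poly-* (6 + b) m≤M (poly-+ 6 b (poly-const 6) ≤-refl))
            (poly-+ 2 a (poly-const 2) ≤-refl)))))

    -- Skipping an element takes 11 rules, and returning the one at the head takes 7.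
    lookupBody⇓ : ∀ {A Δ} {δ : Env Δ} {m} (f : Vector ⟦ A ⟧ m) (i : Fin m) → ∃[ t ]
      ((List.tabulate f , toℕ i) ∷ closure lookupBody δ ∷ δ ⊢ lookupBody ⇓ f i ⟨ t ⟩)
      × t ≤ m * 11 + 7
    lookupBody⇓ {m = suc m} f zero =
      7 , ⇓case-cons (⇓fst ⇓var) (⇓case-zero (⇓snd ⇓var) ⇓var) , m≤n+m 7 (suc m * 11)
    lookupBody⇓ {m = suc m} f (suc i) with lookupBody⇓ (f ∘ suc) i
    ... | t , d , p = 11 + t ,
      ⇓case-cons (⇓fst ⇓var) (⇓case-suc (⇓snd ⇓var) (⇓app ⇓var (⇓pair ⇓var ⇓var) d)) ,
      +-monoʳ-≤ 11 p

  module Soundness (n κ : ℕ) (M : ℕ) (1≤M : 1 ≤ M) where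

    open Semantics n κ
    open Cost M 1≤M

    record Agree {Γ Δ} (σ : Embedding Γ Δ) (ρ : MEnv Γ) (δ : Env Δ) : Set where
      constructor agree
      field
        lookups : ∀ {A} (x : A ∈ Γ) → lookup δ (σ x) ≡ enc A (lookup ρ x)

    open Agree

    agree-bind : ∀ {Γ Δ A} {σ : Embedding Γ Δ} {ρ : MEnv Γ} {δ : Env Δ} {x : ⟪ A ⟫} →
                 Agree σ ρ δ → Agree (bind {A = A} σ) (x ∷ ρ) (enc A x ∷ δ)
    agree-bind ag = agree λ { (here refl) → refl ; (there x) → lookups ag x }

    agree-wk : ∀ {Γ Δ C} {σ : Embedding Γ Δ} {ρ : MEnv Γ} {δ : Env Δ} {v : ⟦ C ⟧} →
               Agree σ ρ δ → Agree (wk {C = C} σ) ρ (v ∷ δ)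
    agree-wk ag = agree (lookups ag)

    leqNat⇓ : ∀ {Γ} {ρ : Env Γ} {e f l m b a c} → (l ≤ᵇ m) ≡ b →
              ρ ⊢ e ⇓ l ≲ a → ρ ⊢ f ⇓ m ≲ c → ρ ⊢ leqNat e f ⇓ b ≲ 1 + (a + c)
    leqNat⇓ refl = rule₂ ⇓leqNat

    eqIdx⇓ : ∀ {m} (i j : Fin m) {Γ} {ρ : Env Γ} {e f} {a b} →
             ρ ⊢ e ⇓ toℕ i ≲ a → ρ ⊢ f ⇓ toℕ j ≲ b →
             ρ ⊢ ifte (leqNat e f) (leqNat f e) false ⇓ does (i Fin.≟ j)
               ≲ 1 + ((1 + (a + b)) + ((1 + (b + a)) + 1))
    eqIdx⇓ i j {a = a} {b} e⇓ f⇓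
      with toℕ i ≤ᵇ toℕ j in i≤j | toℕ j ≤ᵇ toℕ i in j≤i | i Fin.≟ j
    ... | false | _     | yes refl = contradiction (subst T i≤j (≤⇒≤ᵇ (≤-refl {toℕ i}))) λ ()
    ... | true  | false | yes refl = contradiction (subst T j≤i (≤⇒≤ᵇ (≤-refl {toℕ i}))) λ ()
    ... | true  | true  | no i≢j   = contradiction (Fin.toℕ-injective (≤-antisym
      (≤ᵇ⇒≤ _ _ (subst T (sym i≤j) _)) (≤ᵇ⇒≤ _ _ (subst T (sym j≤i) _)))) i≢j
    ... | true  | true  | yes refl =
      rule₂ ⇓if-true (leqNat⇓ i≤j e⇓ f⇓) (weaken (m≤m+n _ 1) (leqNat⇓ j≤i f⇓ e⇓))
    ... | true  | false | no _     =
      rule₂ ⇓if-true (leqNat⇓ i≤j e⇓ f⇓) (weaken (m≤m+n _ 1) (leqNat⇓ j≤i f⇓ e⇓))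
    ... | false | _     | no _     =
      rule₂ ⇓if-false (leqNat⇓ i≤j e⇓ f⇓) (weaken (m≤n+m 1 (1 + (b + a))) (rule₀ ⇓false))

    module _ (size≤M : ∀ s → size s ≤ M) where

      -- Value and running time are established by the same induction on the expression.
      -- Conditionals are charged for both branches, and a loop over `arr s` multiplies by `size s`,
      -- hence by at most M.
      sound : ∀ {Γ Δ A} (e : Exp Γ A) {σ : Embedding Γ Δ} {ρ : MEnv Γ} {δ : Env Δ} →
              Agree σ ρ δ → δ ⊢ compile σ e ⇓ enc A (eval e ρ) ≲ degree e
      sound (var x) ag = ≲var _ (lookups ag x)
      sound (letin e f) ag = rule₂ ⇓let (sound e ag) (sound f (agree-bind ag))
      sound true ag = rule₀ ⇓true
      sound false ag = rule₀ ⇓false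
      sound (ifte b e f) {ρ = ρ} ag with eval b ρ | sound b ag
      ... | true  | b⇓ = rule₂ ⇓if-true b⇓ (weaken (m≤m+n _ _) (sound e ag))
      ... | false | b⇓ = rule₂ ⇓if-false b⇓ (weaken (m≤n+m _ _) (sound f ag))
      sound zeroRat ag = rule₀ ⇓ratLit
      sound (addRat e f) ag = rule₂ ⇓addRat (sound e ag) (sound f ag)
      sound (leqRat e f) ag = rule₂ ⇓leqRat (sound e ag) (sound f ag)
      sound (eqIdx e f) {ρ = ρ} ag = eqIdx⇓ (eval e ρ) (eval f ρ) (sound e ag) (sound f ag)
      sound nothing ag = rule₀ ⇓nothing
      sound (just e) ag = rule₁ ⇓just (sound e ag)
      sound (caseMaybe e f g) {ρ = ρ} ag with eval e ρ | sound e ag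
      ... | nothing | e⇓ = rule₂ ⇓case-nothing e⇓ (weaken (m≤m+n _ _) (sound f ag))
      ... | just x  | e⇓ = rule₂ ⇓case-just e⇓ (weaken (m≤n+m _ _) (sound g (agree-bind ag)))
      sound (pair e f) ag = rule₂ ⇓pair (sound e ag) (sound f ag)
      sound (fst e) ag = rule₁ ⇓fst (sound e ag)
      sound (snd e) ag = rule₁ ⇓snd (sound e ag)
      sound {A = arr s B} (mapArr {A = A} e f) {σ} {ρ} ag =
        cast (foldr-cons (eval e ρ))
          (Fold.fold⇓ (enc A) id (λ x l → enc B (eval f (x ∷ ρ)) ∷ l) []
            (rule₀ ⇓nil)
            (λ x l t → rule₂ ⇓cons (sound f (agree-wk (agree-bind (agree-wk (agree-wk (agree-wk ag)))))) (≲var (here refl) refl))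
            (size≤M s) (eval e ρ) (sound e ag))
        where
        foldr-cons : ∀ {m} {X Y : Set} {h : X → Y} (xs : Vector X m) →
                     Vector.foldr (λ x l → h x ∷ l) [] xs ≡ List.tabulate (λ i → h (xs i))
        foldr-cons {zero}  xs = refl
        foldr-cons {suc m} xs = cong (_ ∷_) (foldr-cons (xs ∘ suc))
      sound {A = B} (foldArr {s} {A} e z f) {σ} {ρ} ag =
        Fold.fold⇓ (enc A) (enc B) (λ x y → eval f (y ∷ x ∷ ρ)) (eval z ρ)
          (sound z (agree-wk (agree-wk ag)))
          (λ x y t → sound f (agree-bind (agree-bind (agree-wk (agree-wk (agree-wk ag))))))
          (size≤M s) (eval e ρ) (sound e ag)
      sound (lookupArr {s} e i) {ρ = ρ} ag
        with lookupBody⇓ (λ j → enc _ (eval e ρ j)) (eval i ρ)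
      ... | t , d , p = ≲app (rule₀ ⇓fun) (rule₂ ⇓pair (sound e ag) (sound i ag))
        (within t d (≤-trans p (poly-+ 12 7 (poly-* 11 (size≤M s) (poly-const 11)) (poly-const 7))))

-- The algorithm, as an expression and as a function.

module SteinerAlgorithm where

  open import Defs
  open Language
  open import Data.Bool.Base using (Bool; true; false; if_then_else_)
  open import Data.Fin.Base using (Fin; finToFun)
  import Data.Fin.Properties as Fin
  open import Data.List.Base using ([]; _∷_)
  open import Data.List.Membership.Propositional using (_∈_)
  open import Data.List.Relation.Unary.All using ([]; _∷_)
  open import Data.List.Relation.Unary.Any using (here; there)
  open import Data.Maybe.Base using (Maybe; just; nothing; maybe′)
  open import Data.Nat.Base using (ℕ; _^_)
  open import Data.Product.Base using (_×_; _,_; proj₁; proj₂)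
  open import Data.Rational.Base as ℚ using (ℚ; 0ℚ)
  open import Data.Vec.Functional as Vector using (Vector)
  open import Function.Base using (id)
  open import Relation.Binary.PropositionalEquality
  open import Relation.Nullary.Decidable.Core using (does)

  module _ {X : Set} where

    v0 : ∀ {A : X} {Γ} → A ∈ A ∷ Γ
    v0 = here refl

    v1 : ∀ {A B : X} {Γ} → A ∈ B ∷ A ∷ Γ
    v1 = there v0

    v2 : ∀ {A B C : X} {Γ} → A ∈ B ∷ C ∷ A ∷ Γ
    v2 = there v1

    s1 : ∀ {A B : X} {Γ} → A ∈ Γ → A ∈ B ∷ Γ
    s1 = there

    s2 : ∀ {A B C : X} {Γ} → A ∈ Γ → A ∈ B ∷ C ∷ Γ
    s2 x = there (s1 x)

    s3 : ∀ {A B C D : X} {Γ} → A ∈ Γ → A ∈ B ∷ C ∷ D ∷ Γ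
    s3 x = there (s2 x)

    s4 : ∀ {A B C D E : X} {Γ} → A ∈ Γ → A ∈ B ∷ C ∷ D ∷ E ∷ Γ
    s4 x = there (s3 x)

  Vertex Profile : MTy
  Vertex  = idx V
  Profile = arr K Vertex

  bestE : ∀ {Γ s A} → Exp Γ (arr s (maybe (A ⊠ rat))) → Exp Γ (maybe (A ⊠ rat))
  bestE e = foldArr e nothing
    (caseMaybe (var v1) (var v0)
      (caseMaybe (var v1) (just (var v0))
        (just (ifte (leqRat (snd (var v1)) (snd (var v0))) (var v1) (var v0)))))

  lookup₂ : ∀ {Γ s t A} → arr s (arr t A) ∈ Γ → idx s ∈ Γ → idx t ∈ Γ → Exp Γ A
  lookup₂ m i j = lookupArr (lookupArr (var m) (var i)) (var j)

  module _ {Γ : MCtx} (vs : arr V Vertex ∈ Γ) where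

    distE : arr V (arr V (maybe rat)) ∈ Γ → Exp Γ (arr V (arr V rat))
    distE adj = mapArr
      (foldArr (var vs)
        (mapArr (var vs) (mapArr (var (s1 vs))
          (ifte (eqIdx (var v1) (var v0)) (just (pair (var v0) zeroRat)) nothing)))
        (mapArr (var (s2 vs)) (mapArr (var (s3 vs))
          (ifte (eqIdx (var v1) (var v0))
            (just (pair (var v0) zeroRat))
            (bestE (mapArr (var (s4 vs))
              (caseMaybe (lookup₂ (s1 (s4 adj)) v2 v0) nothing
                (caseMaybe (lookup₂ (s4 v0) v1 v2) nothing
                  (just (pair (var v2) (addRat (var v1) (snd (var v0)))))))))))))
      (mapArr (var v0) (caseMaybe (var v0) zeroRat (snd (var v0))))

    leqE : arr V (arr V rat) ∈ Γ → Vertex ∈ Γ → Exp Γ (arr V (arr V bool))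
    leqE dist r = mapArr (var vs) (mapArr (var (s1 vs))
      (leqRat (addRat (lookup₂ (s2 dist) (s2 r) v1) (lookup₂ (s2 dist) v1 v0))
              (lookup₂ (s2 dist) (s2 r) v0)))

    ltE : arr V (arr V bool) ∈ Γ → Exp Γ (arr V (arr V bool))
    ltE leq = mapArr (var vs) (mapArr (var (s1 vs))
      (ifte (eqIdx (var v1) (var v0)) false (lookup₂ (s2 leq) v1 v0)))

    covE : arr V (arr V bool) ∈ Γ → Exp Γ (arr V (arr V bool))
    covE lt = mapArr (var vs) (mapArr (var (s1 vs))
      (ifte (lookup₂ (s2 lt) v1 v0)
        (foldArr (var (s2 vs)) true
          (ifte (lookup₂ (s4 lt) (s2 v1) v1)
            (ifte (lookup₂ (s4 lt) v1 v2) false (var v0))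
            (var v0)))
        false))

  compatE : ∀ {Γ} → arr V (arr V bool) ∈ Γ → arr K (idx K) ∈ Γ →
            Vertex ∈ Γ → Profile ∈ Γ → Profile ∈ Γ → Exp Γ bool
  compatE leq ks c p q = foldArr (var ks) true
    (letin (lookupArr (var (s2 p)) (var v1))
      (letin (lookupArr (var (s3 q)) (var v2))
        (ifte (eqIdx (var v1) (var v0))
          (var v2)
          (ifte (lookup₂ (s4 leq) (s4 c) v1)
            false
            (ifte (lookup₂ (s4 leq) (s4 c) v0) (var v2) false)))))

  parentE : ∀ {Γ} → arr V bool ∈ Γ → Vertex ∈ Γ → Vertex ∈ Γ → Profile ∈ Γ → Exp Γ (maybe Vertex)
  parentE X r v p = ifte (eqIdx (var v) (var r)) nothing
    (caseMaybe
      (foldArr (var p)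
        (ifte (lookupArr (var X) (var v)) nothing (just nothing))
        (ifte (eqIdx (var v1) (var (s2 v))) nothing
          (caseMaybe (var v0) (just (just (var v1))) (just (var v0)))))
      (just (var r))
      (var v0))

  Row : MTy
  Row = arr P (Profile ⊠ rat)

  module _ {Γ : MCtx} (vs : arr V Vertex ∈ Γ) (ks : arr K (idx K) ∈ Γ)
    (leq cov : arr V (arr V bool) ∈ Γ) where

    tableE : arr P Profile ∈ Γ → arr V bool ∈ Γ → Vertex ∈ Γ → arr V (arr V rat) ∈ Γ →
             Exp Γ (arr V Row)
    tableE profs X r dist = foldArr (var vs)
      (mapArr (var vs) (mapArr (var (s1 profs)) (pair (var v0) zeroRat)))
      (mapArr (var (s2 vs)) (mapArr (var (s3 profs)) (pair (var v0)
        (addRat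
          (caseMaybe (parentE (s4 X) (s4 r) v1 v0) zeroRat (lookup₂ (s1 (s4 dist)) v2 v0))
          (foldArr
            (mapArr (var (s4 vs))
              (ifte (lookup₂ (s1 (s4 cov)) v2 v0)
                (caseMaybe
                  (bestE (mapArr (lookupArr (var (s3 v0)) (var v0))
                    (letin (fst (var v0))
                      (ifte (compatE (s3 (s4 leq)) (s3 (s4 ks)) v2 (s3 v0) v0)
                        (just (var v1))
                        nothing))))
                  zeroRat
                  (snd (var v0)))
                zeroRat))
            zeroRat
            (addRat (var v1) (var v0)))))))

    chosenE : arr V Row ∈ Γ → Exp Γ (arr V (maybe Profile))
    chosenE table = foldArr (var vs)
      (mapArr (var vs) nothing)
      (mapArr (var (s2 vs))
        (caseMaybe
          (bestE (mapArr (lookupArr (var (s3 table)) (var v0))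
            (letin (fst (var v0))
              (ifte
                (foldArr (var (s1 (s4 vs))) true
                  (ifte (lookup₂ (s3 (s4 cov)) v1 (s2 v2))
                    (caseMaybe (lookupArr (var (s3 v2)) (var v1)) (var v0)
                      (ifte (compatE (s4 (s4 leq)) (s4 (s4 ks)) (s3 v2) v0 (s2 v1))
                        (var v1)
                        false))
                    (var v0)))
                (just (var v1))
                nothing))))
          nothing
          (just (fst (var v0)))))

  outputE : ∀ {Γ} → arr V Vertex ∈ Γ → Vertex ∈ Γ → arr V (maybe Vertex) ∈ Γ →
            Exp Γ (arr V bool ⊠ arr V (arr V bool))
  outputE vs r par = pair
    (mapArr (var vs)
      (ifte (eqIdx (var v0) (var (s1 r)))
        true
        (caseMaybe (lookupArr (var (s1 par)) (var v0)) false true)))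
    (mapArr (var vs) (mapArr (var (s1 vs))
      (ifte (caseMaybe (lookupArr (var (s2 par)) (var v1)) false (eqIdx (var v0) (var v1)))
        true
        (caseMaybe (lookupArr (var (s2 par)) (var v0)) false (eqIdx (var v0) (var v2))))))

  Γ₀ : MCtx
  Γ₀ = arr P Profile ∷ arr K (idx K) ∷ arr V Vertex ∷ Vertex ∷ arr V bool
     ∷ arr V (arr V (maybe rat)) ∷ []

  mainE : Exp Γ₀ (arr V bool ⊠ arr V (arr V bool))
  mainE =
    letin (distE v2 (s3 v2))
    (letin (leqE (s3 v0) v0 (s4 v0))
    (letin (ltE (s4 v0) v0)
    (letin (covE (s3 v2) v0)
    (letin (tableE (s4 v2) (s4 v1) v2 v0 (s4 v0) (s4 (s4 v0)) (s4 (s3 v0)) (s3 v0))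
    (letin (chosenE (s4 (s3 v0)) (s4 v2) (s3 v0) v1 v0)
    (letin (mapArr (var (s4 (s4 v0)))
      (caseMaybe (lookupArr (var v1) (var v0)) nothing
        (parentE (s4 (s4 (s4 v0))) (s4 (s4 (s3 v0))) v1 v0)))
    (outputE (s4 (s4 v1)) (s4 (s4 v2)) v0)))))))

  -- Here `nothing` is a missing candidate, that is, one of infinite cost. Ties go to the earlier
  -- candidate.
  better : ∀ {A : Set} → Maybe (A × ℚ) → Maybe (A × ℚ) → Maybe (A × ℚ)
  better x y = maybe′ (λ a → maybe′ (λ b → just (if proj₂ a ℚ.≤ᵇ proj₂ b then a else b)) (just a) y) y x

  best : ∀ {A : Set} {m} → Vector (Maybe (A × ℚ)) m → Maybe (A × ℚ)
  best = Vector.foldr better nothing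

  -- A fold over the vertices that ignores the vertex: in a language whose loops range over arrays,
  -- this is how to repeat a step n times.
  iterate : ∀ {A : Set} (n : ℕ) → A → (A → A) → A
  iterate n x f = Vector.foldr (λ (_ : Fin n) y → f y) x id

  module Algorithm {n κ : ℕ} (adj : Fin n → Fin n → Maybe ℚ) (X : Fin n → Bool) (r : Fin n) where

    N : ℕ
    N = n ^ κ

    extend : (Fin n → Fin n → Maybe (Fin n × ℚ)) → Fin n → Fin n → Fin n → Maybe (Fin n × ℚ)
    extend D u v w = maybe′ (λ a → maybe′ (λ y → just (w , a ℚ.+ proj₂ y)) nothing (D w v)) nothing (adj u w)

    -- One round of relaxation: the first edge leads to some w, and the rest is an entry of the
    -- previous round. As long as no walk is known, the entry is `nothing`.
    walks : (Fin n → Fin n → Maybe (Fin n × ℚ)) → Fin n → Fin n → Maybe (Fin n × ℚ)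
    walks D u v =
      if does (u Fin.≟ v) then just (v , 0ℚ)
      else best (extend D u v)

    D₀ : Fin n → Fin n → Maybe (Fin n × ℚ)
    D₀ u v = if does (u Fin.≟ v) then just (v , 0ℚ) else nothing

    opaque
      dist : Fin n → Fin n → ℚ
      dist u v = maybe′ proj₂ 0ℚ (iterate n D₀ walks u v)

    opaque
      leq : Fin n → Fin n → Bool
      leq u v = (dist r u ℚ.+ dist u v) ℚ.≤ᵇ dist r v

    opaque
      lt : Fin n → Fin n → Bool
      lt u v = if does (u Fin.≟ v) then false else leq u v

    noneBetween : Fin n → Fin n → Fin n → Bool → Bool
    noneBetween p c z b = if lt p z then (if lt z c then false else b) else b

    opaque
      cov : Fin n → Fin n → Bool
      cov p c = if lt p c
                then Vector.foldr (noneBetween p c) true id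
                else false

    Prof : Set
    Prof = Fin κ → Fin n

    compatAt : Fin n → Fin n → Fin n → Bool → Bool
    compatAt c x y b =
      if does (x Fin.≟ y) then b else if leq c x then false else if leq c y then b else false

    opaque
      compat : Fin n → Prof → Prof → Bool
      compat c p q = Vector.foldr (λ i → compatAt c (p i) (q i)) true id

    -- The outcome is nothing if the parent of v is the entry preceding the
    -- scanned ones, and just nothing if v does not belong to the tree.
    scan : Fin n → ∀ {m} → (Fin m → Fin n) → Maybe (Maybe (Fin n))
    scan v = Vector.foldr
      (λ w s → if does (w Fin.≟ v) then nothing
               else maybe′ just (just (just w)) s)
      (if X v then nothing else just nothing)

    opaque
      parent : Fin n → Prof → Maybe (Fin n)
      parent v p = if does (v Fin.≟ r) then nothing else maybe′ id (just r) (scan v p)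

    -- The default 0ℚ serves the root and the vertices outside of the tree alike.
    wt : Fin n → Prof → ℚ
    wt v p = maybe′ (dist v) 0ℚ (parent v p)

    decode : Fin N → Prof
    decode = finToFun

    -- Each entry carries its own profile, because a loop over a row sees the entries but not their
    -- indices.
    Tab : Set
    Tab = Fin n → Fin N → Prof × ℚ

    -- For the tables built here the default 0ℚ is never taken: every profile is compatible with
    -- itself, so there is always a candidate.
    childMin : Tab → Fin n → Prof → ℚ
    childMin F c p =
      maybe′ proj₂ 0ℚ (best (λ q → if compat c p (proj₁ (F c q)) then just (F c q) else nothing))

    tableStep : Tab → Tab
    tableStep F v q = decode q ,
      (wt v (decode q) ℚ.+
       Vector.foldr ℚ._+_ 0ℚ (λ c → if cov v c then childMin F c (decode q) else 0ℚ))

    table₀ : Tab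
    table₀ v q = decode q , 0ℚ

    opaque
      table : Tab
      table = iterate n table₀ tableStep

    Choice : Set
    Choice = Fin n → Maybe Prof

    allowedBy : Choice → Fin n → Prof → Fin n → Bool → Bool
    allowedBy A c q p b =
      if cov p c then maybe′ (λ a → if compat c a q then b else false) b (A p) else b

    opaque
      allowed : Choice → Fin n → Prof → Bool
      allowed A c q = Vector.foldr (allowedBy A c q) true id

    -- Choices spread from the root downwards. While nothing is chosen at the parent, every entry is
    -- allowed, so early rounds may choose wrongly and are overwritten later.
    choiceStep : Choice → Choice
    choiceStep A c = maybe′ (λ e → just (proj₁ e)) nothing
      (best (λ q → if allowed A c (proj₁ (table c q)) then just (table c q) else nothing))

    opaque
      choice : Choice
      choice = iterate n (λ _ → nothing) choiceStep

    par : Fin n → Maybe (Fin n)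
    par v = maybe′ (parent v) nothing (choice v)

    member : Fin n → Bool
    member v = if does (v Fin.≟ r) then true else maybe′ (λ _ → true) false (par v)

    isParent : Fin n → Fin n → Bool
    isParent u v = maybe′ (λ w → does (w Fin.≟ v)) false (par u)

    edge : Fin n → Fin n → Bool
    edge u v = if isParent u v then true else isParent v u

    open Semantics n κ

    ρ₀ : MEnv Γ₀
    ρ₀ = decode ∷ id ∷ id ∷ r ∷ X ∷ adj ∷ []

    opaque
      unfolding dist leq lt cov compat parent table allowed choice

      -- The functions above follow the expressions clause by clause, so the two agree by
      -- computation. Correctness is argued about the functions alone.
      eval-mainE : eval mainE ρ₀ ≡ (member , edge)
      eval-mainE = refl

-- Decoding the input, and the running time of the whole program.

module Execution where

  open import Defs
  open Language
  open SteinerAlgorithm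
  open import Data.Bool.Base using (Bool)
  open import Data.Fin.Base using (Fin; zero; suc; toℕ; finToFun; combine; _↑ˡ_; _↑ʳ_)
  import Data.Fin.Properties as Fin
  open import Data.List.Base as List using (List; []; _∷_)
  open import Data.List.Properties using (tabulate-cong)
  open import Data.List.Membership.Propositional using (_∈_)
  open import Data.List.Relation.Unary.All using (All; []; _∷_; lookup)
  open import Data.List.Relation.Unary.Any using (here; there)
  open import Data.Maybe.Base as Maybe using (Maybe)
  open import Data.Nat.Base
  open import Data.Nat.Properties
  open import Data.Product.Base using (∃-syntax; _×_; _,_; proj₁; proj₂)
  import Data.Maybe.Properties as Maybe
  open import Data.Rational.Base using (ℚ)
  open import Data.Vec.Functional as Vector using (Vector)
  open import Function.Base using (_∘_; id)
  open import Relation.Binary.PropositionalEquality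

  rangeBody : ∀ {Δ} → Tm ((nat ⊗ nat) ∷ ((nat ⊗ nat) ⇒ list nat) ∷ Δ) (list nat)
  rangeBody = caseNat (fst (var v0)) nil
    (cons (snd (var v1)) (app (var v2) (pair (var v0) (suc (snd (var v1))))))

  rangeTm : ∀ {Δ} → Tm Δ nat → Tm Δ (list nat)
  rangeTm e = app (fun rangeBody) (pair e zero)

  lengthTm : ∀ {Δ A} → Tm Δ (list A) → Tm Δ nat
  lengthTm e = foldTm e zero (suc (var v0))

  module _ {Δ : Ctx} (vs : Δ ∋ list nat) where

    prependAll : Tm (list (list nat) ∷ nat ∷ list nat ∷ list nat ∷ (list nat ⇒ list (list nat)) ∷
                     list (list nat) ∷ nat ∷ nat ∷ (nat ⇒ list (list nat)) ∷ Δ) (list (list nat))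
    prependAll = foldTm (var (s3 v2)) (var v2) (cons (cons (var (s4 v2)) (var v1)) (var v0))

    -- Every vertex is prepended to every shorter tuple, with the new entry most significant. This
    -- is the order in which `finToFun` enumerates functions.
    tuplesBody : Tm (nat ∷ (nat ⇒ list (list nat)) ∷ Δ) (list (list nat))
    tuplesBody = caseNat (var v0) (cons nil nil)
      (letin (app (var v2) (var v0)) (foldTm (var (s4 vs)) nil prependAll))

    tuplesTm : Tm Δ nat → Tm Δ (list (list nat))
    tuplesTm e = app (fun tuplesBody) e

  -- With a single vertex no level is needed.  Dropping them all keeps the
  -- running time independent of k in that case.
  levelsTm : ∀ {Δ A} → Δ ∋ nat → Δ ∋ list A → Tm Δ nat
  levelsTm k l = caseNat (var k) zero (caseList (var (s1 l)) zero (caseList (var v1) zero (var (s4 v0))))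

  levels : ℕ → ℕ → ℕ
  levels (suc (suc n)) (suc k) = k
  levels _             _       = 0

  Δ₀ : Ctx
  Δ₀ = list (list nat) ∷ list nat ∷ list nat ∷ nat ∷ nat ∷ nat ∷ list bool ∷
       list (list (maybe rat)) ∷ Input ∷ []

  places : All (λ A → ⌊ A ⌋ᵗ ∈ Δ₀) Γ₀
  places = v0 ∷ v1 ∷ v2 ∷ s4 v1 ∷ s4 v2 ∷ s4 (s3 v0) ∷ []

  abstract

    mainTm : Tm Δ₀ Output
    mainTm = compile (lookup places) mainE

    mainDegree : ℕ
    mainDegree = degree mainE

  program : Program Input Output
  program =
    letin (fst (var v0))
    (letin (fst (snd (var v1)))
    (letin (fst (snd (snd (var v2))))
    (letin (snd (snd (snd (var (s3 v0)))))
    (letin (levelsTm v0 (s3 v0))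
    (letin (rangeTm (lengthTm (var (s4 v0))))
    (letin (rangeTm (var v1))
    (letin (tuplesTm v1 (var v2))
    mainTm)))))))

  tabulate-++ : ∀ a {b} {A : Set} (h : Fin (a + b) → A) →
    List.tabulate h ≡ List.tabulate (h ∘ (_↑ˡ b)) List.++ List.tabulate (h ∘ (a ↑ʳ_))
  tabulate-++ zero    h = refl
  tabulate-++ (suc a) h = cong (h zero ∷_) (tabulate-++ a (h ∘ suc))

  foldr-∷ : ∀ {m} {X A : Set} (f : X → A) (out : List A) (xs : Vector X m) →
    Vector.foldr (λ x o → f x ∷ o) out xs ≡ List.tabulate (f ∘ xs) List.++ out
  foldr-∷ {zero}  f out xs = refl
  foldr-∷ {suc m} f out xs = cong (f (xs zero) ∷_) (foldr-∷ f out (xs ∘ suc))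

  -- The fold writes one block of length b for each i, and `combine i` ranges over exactly the i-th
  -- block of indices.
  foldr-combine : ∀ {a b} {X A : Set} (h : Fin (a * b) → A) (g : X → List A → List A)
    (xs : Vector X a) → (∀ i out → g (xs i) out ≡ List.tabulate (h ∘ combine i) List.++ out) →
    Vector.foldr g [] xs ≡ List.tabulate h
  foldr-combine {zero}      h g xs eq = refl
  foldr-combine {suc a} {b} h g xs eq = begin
    g (xs zero) (Vector.foldr g [] (xs ∘ suc))      ≡⟨ cong (g (xs zero)) (foldr-combine (h ∘ (b ↑ʳ_)) g (xs ∘ suc) (eq ∘ suc)) ⟩
    g (xs zero) (List.tabulate (h ∘ (b ↑ʳ_)))       ≡⟨ eq zero _ ⟩
    _                                               ≡⟨ tabulate-++ b h ⟨
    List.tabulate h                                 ∎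
    where open ≡-Reasoning

  rangeDegree lengthDegree : ℕ → ℕ
  rangeDegree c  = 1 + (1 + (1 + (c + 1)) + (14 + 4))
  lengthDegree c = 2 + (c + ((7 + 2) + (2 + 1)))

  prependDegree stepDegree tuplesDegree programDegree : ℕ
  prependDegree = 2 + (1 + ((7 + (1 + (1 + (1 + 1) + 1))) + (2 + 1)))
  stepDegree    = 2 + (1 + ((7 + prependDegree) + (2 + 1)))
  tuplesDegree  = 1 + (1 + 1 + ((7 + stepDegree) + 5))
  programDegree =
    1 + (2 + (1 + (3 + (1 + (4 + (1 + (4 + (1 + (7 + (1 + (rangeDegree (lengthDegree 1) +
    (1 + (rangeDegree 1 + (1 + (tuplesDegree + mainDegree)))))))))))))))

  m<n^m : ∀ {n} → 2 ≤ n → ∀ m → m < n ^ m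
  m<n^m 2≤n zero    = s≤s z≤n
  m<n^m {n} 2≤n (suc m) = begin-strict
    suc m            ≤⟨ m<n^m 2≤n m ⟩
    n ^ m            <⟨ m<m+n (n ^ m) (≤-trans (s≤s z≤n) (≤-trans (m<n^m 2≤n m) (m≤m+n (n ^ m) 0))) ⟩
    2 * n ^ m        ≤⟨ *-monoˡ-≤ (n ^ m) 2≤n ⟩
    n ^ suc m        ∎
    where open ≤-Reasoning

  -- The array of levels must not be longer than M. With a single vertex all powers are 1, and the
  -- bound holds because `levels` is 0 in that case.
  levels≤n^levels : ∀ n k → levels n k ≤ n ^ levels n k
  levels≤n^levels zero          k       = z≤n
  levels≤n^levels (suc zero)    k       = z≤n
  levels≤n^levels (suc (suc n)) zero    = z≤n
  levels≤n^levels (suc (suc n)) (suc k) = <⇒≤ (m<n^m (s≤s (s≤s z≤n)) k)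

  module Evaluation (n κ : ℕ) (M : ℕ) (1≤M : 1 ≤ M) where

    open Semantics n κ
    open Cost M 1≤M
    open Soundness n κ M 1≤M

    module _ {Δ} {δ : Env Δ} where

      rangeBody⇓ : ∀ m j {f : Fin m → ℕ} → (∀ i → f i ≡ j + toℕ i) → ∃[ t ]
        ((m , j) ∷ closure rangeBody δ ∷ δ ⊢ rangeBody ⇓ List.tabulate f ⟨ t ⟩) × t ≤ m * 13 + 4
      rangeBody⇓ zero j eq = _ , ⇓case-zero (⇓fst ⇓var) ⇓nil , ≤-refl
      rangeBody⇓ (suc m) j {f} eq with rangeBody⇓ m (suc j) {f ∘ suc} (λ i → trans (eq (suc i)) (+-suc j (toℕ i)))
      ... | t , d , p = 13 + t ,
        subst (λ x → _ ⊢ _ ⇓ x ∷ _ ⟨ 13 + t ⟩) (sym (trans (eq zero) (+-identityʳ j)))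
          (⇓case-suc (⇓fst ⇓var) (⇓cons (⇓snd ⇓var) (⇓app ⇓var (⇓pair ⇓var (⇓suc (⇓snd ⇓var))) d))) ,
        +-monoʳ-≤ 13 p

      range⇓ : ∀ {e m c} → m ≤ M → δ ⊢ e ⇓ m ≲ c →
               δ ⊢ rangeTm e ⇓ List.tabulate {n = m} toℕ ≲ rangeDegree c
      range⇓ {m = m} m≤M e⇓ with rangeBody⇓ m 0 (λ i → refl)
      ... | t , d , p = ≲app (rule₀ ⇓fun) (rule₂ ⇓pair e⇓ (rule₀ ⇓zero))
        (within t d (≤-trans p (poly-+ 14 4 (poly-* 13 m≤M (poly-const 13)) (poly-const 4))))

      length⇓ : ∀ {A e m c} (f : Fin m → ⟦ A ⟧) → m ≤ M → δ ⊢ e ⇓ List.tabulate f ≲ c →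
                δ ⊢ lengthTm e ⇓ m ≲ lengthDegree c
      length⇓ f m≤M e⇓ = cast (count f)
        (Fold.fold⇓ id id (λ _ → suc) 0 (rule₀ ⇓zero) (λ x y l → rule₁ ⇓suc (≲var v0 refl)) m≤M f e⇓)
        where
        count : ∀ {m} {A : Set} (f : Fin m → A) → Vector.foldr (λ _ → suc) 0 f ≡ m
        count {zero}  f = refl
        count {suc m} f = cong suc (count (f ∘ suc))

      levels⇓ : ∀ {A} {kx : Δ ∋ nat} {lx : Δ ∋ list A} {k} (f : Fin n → ⟦ A ⟧) → 1 ≤ n → 1 ≤ k →
                lookup δ kx ≡ k → lookup δ lx ≡ List.tabulate f →
                δ ⊢ levelsTm kx lx ⇓ levels n k ≲ 7
      levels⇓ {kx = kx} {lx} {suc k} f (s≤s {n = 0} _) _ eqk eql =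
        rule₂ ⇓case-suc (≲var kx eqk)
          (rule₂ ⇓case-cons (≲var (s1 lx) eql) (rule₂ ⇓case-nil (≲var v1 refl) (rule₀ ⇓zero)))
      levels⇓ {kx = kx} {lx} {suc k} f (s≤s {n = suc _} _) _ eqk eql =
        rule₂ ⇓case-suc (≲var kx eqk)
          (rule₂ ⇓case-cons (≲var (s1 lx) eql) (rule₂ ⇓case-cons (≲var v1 refl) (≲var (s4 v0) refl)))

    tuple : ∀ m → Fin (n ^ m) → List ℕ
    tuple m q = List.tabulate (λ i → toℕ (finToFun {n} {m} q i))

    tuple-combine : ∀ m i q → tuple (suc m) (combine i q) ≡ toℕ i ∷ tuple m q
    tuple-combine m i q = cong₂ _∷_ (cong (toℕ ∘ proj₁) (Fin.remQuot-combine i q))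
      (cong (tuple m ∘ proj₂) (Fin.remQuot-combine i q))

    module _ {Δ} (vs : Δ ∋ list nat) {δ : Env Δ} (vs≡ : lookup δ vs ≡ List.tabulate {n = n} toℕ)
      (1≤n : 1 ≤ n) (n≤M : n ≤ M) (κ≤M : κ ≤ M) (N≤M : n ^ κ ≤ M) where

      tuples : ℕ → List (List ℕ)
      tuples m = List.tabulate (tuple m)

      prepend : ∀ m → Fin n → List (List ℕ) → List (List ℕ)
      prepend m i out = Vector.foldr (λ q o → (toℕ i ∷ tuple m q) ∷ o) out id

      module _ (m : ℕ) (m<κ : m < κ) where

        prepend⇓ : ∀ i out l {clo} →
          out ∷ toℕ i ∷ l ∷ (toℕ i ∷ l) ∷ clo ∷ tuples m ∷ m ∷ suc m ∷ closure (tuplesBody vs) δ ∷ δ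
          ⊢ prependAll vs ⇓ prepend m i out ≲ prependDegree
        prepend⇓ i out l = Fold.fold⇓ (tuple m) id (λ q o → (toℕ i ∷ tuple m q) ∷ o) out
          (≲var v2 refl)
          (λ x y l → rule₂ ⇓cons (rule₂ ⇓cons (≲var (s4 v2) refl) (≲var v1 refl)) (≲var v0 refl))
          (≤-trans (^-monoʳ-≤ n {{>-nonZero 1≤n}} (≤-trans (n≤1+n m) m<κ)) N≤M)
          id (≲var (s3 v2) refl)

        extend⇓ : tuples m ∷ m ∷ suc m ∷ closure (tuplesBody vs) δ ∷ δ
          ⊢ foldTm (var (s4 vs)) nil (prependAll vs) ⇓ tuples (suc m) ≲ stepDegree
        extend⇓ = cast
          (foldr-combine (tuple (suc m)) (prepend m) id λ i out → trans
            (foldr-∷ (λ q → toℕ i ∷ tuple m q) out id)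
            (cong (List._++ out) (sym (tabulate-cong (tuple-combine m i)))))
          (Fold.fold⇓ toℕ id (prepend m) [] (rule₀ ⇓nil) (λ i out l → prepend⇓ i out l) n≤M id (≲var (s4 vs) vs≡))

      -- Each of the κ ≤ M rounds is a double loop over the n vertices and the tuples of length m <
      -- κ built so far, of which there are at most n ^ κ.
      tuplesBody⇓ : ∀ m → m ≤ κ → ∃[ t ]
        (m ∷ closure (tuplesBody vs) δ ∷ δ ⊢ tuplesBody vs ⇓ tuples m ⟨ t ⟩)
        × t ≤ m * (6 + poly stepDegree) + 5
      tuplesBody⇓ zero _ = _ , ⇓case-zero ⇓var (⇓cons ⇓nil ⇓nil) , ≤-refl
      tuplesBody⇓ (suc m) m<κ with tuplesBody⇓ m (≤-trans (n≤1+n m) m<κ) | extend⇓ m m<κ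
      ... | t , d , p | within t′ d′ p′ = _ , ⇓case-suc ⇓var (⇓let (⇓app ⇓var ⇓var d) d′) ,
        (begin
          6 + (t + t′)                                            ≡⟨ cong (6 +_) (+-comm t t′) ⟩
          6 + (t′ + t)                                            ≤⟨ +-monoʳ-≤ 6 (+-mono-≤ p′ p) ⟩
          6 + (poly stepDegree + (m * (6 + poly stepDegree) + 5)) ≡⟨ cong (6 +_) (+-assoc (poly stepDegree) _ 5) ⟨
          suc m * (6 + poly stepDegree) + 5                       ∎)
        where open ≤-Reasoning

      tuples⇓ : (x : Δ ∋ nat) → lookup δ x ≡ κ → δ ⊢ tuplesTm vs (var x) ⇓ tuples κ ≲ tuplesDegree
      tuples⇓ x x≡ with tuplesBody⇓ κ ≤-refl
      ... | t , d , p = ≲app (rule₀ ⇓fun) (≲var x x≡) (within t d (≤-trans p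
        (poly-+ (7 + stepDegree) 5
          (poly-* (6 + stepDegree) κ≤M (poly-+ 6 stepDegree (poly-const 6) ≤-refl))
          (poly-const 5))))

  module _ (n k : ℕ) (1≤n : 1 ≤ n) (1≤k : 1 ≤ k) where

    private
      κ = levels n k
      -- One factor n more than the number of profiles, so that M also bounds n when κ is 0.
      M = n ^ suc κ

    1≤M : 1 ≤ M
    1≤M = m^n>0 n {{>-nonZero 1≤n}} (suc κ)

    open Semantics n κ
    open Cost M 1≤M
    open Soundness n κ M 1≤M
    open Evaluation n κ M 1≤M

    n≤M : n ≤ M
    n≤M = m≤m*n n (n ^ κ) {{m^n≢0 n κ {{>-nonZero 1≤n}}}}

    N≤M : n ^ κ ≤ M
    N≤M = m≤n*m (n ^ κ) n {{>-nonZero 1≤n}}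

    levels≤M : κ ≤ M
    levels≤M = ≤-trans (levels≤n^levels n k) N≤M

    size≤M : ∀ s → size s ≤ M
    size≤M V = n≤M
    size≤M K = levels≤M
    size≤M P = N≤M

    abstract

      main⇓ : (adj : Fin n → Fin n → Maybe ℚ) (X : Fin n → Bool) (r : Fin n) → ∀ {x y l} →
        List.tabulate (tuple κ) ∷ List.tabulate {n = κ} toℕ ∷ List.tabulate {n = n} toℕ ∷ x ∷ y ∷ toℕ r
          ∷ List.tabulate X ∷ matrix adj ∷ l
        ⊢ mainTm
        ⇓ (List.tabulate (Algorithm.member {κ = κ} adj X r) , matrix (Algorithm.edge {κ = κ} adj X r)) ≲ mainDegree
      main⇓ adj X r = cast (cong (enc (arr V bool ⊠ arr V (arr V bool))) (Algorithm.eval-mainE {κ = κ} adj X r)) (sound size≤M mainE {σ = lookup places} {ρ = Algorithm.ρ₀ {κ = κ} adj X r} (agree λ where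
        (here refl) → refl
        (there (here refl)) → refl
        (there (there (here refl))) → refl
        (there (there (there (here refl)))) → refl
        (there (there (there (there (here refl))))) → refl
        (there (there (there (there (there (here refl)))))) →
          tabulate-cong λ u → tabulate-cong λ v → sym (Maybe.map-id (adj u v))))

    program⇓ : (adj : Fin n → Fin n → Maybe ℚ) (X : Fin n → Bool) (r : Fin n) →
      (matrix adj , List.tabulate X , toℕ r , k) ∷ [] ⊢ program
      ⇓ (List.tabulate (Algorithm.member {κ = κ} adj X r) , matrix (Algorithm.edge {κ = κ} adj X r)) ≲ programDegree
    program⇓ adj X r =
      rule₂ ⇓let (rule₁ ⇓fst (≲var v0 refl))
      (rule₂ ⇓let (rule₁ ⇓fst (rule₁ ⇓snd (≲var v1 refl)))
      (rule₂ ⇓let (rule₁ ⇓fst (rule₁ ⇓snd (rule₁ ⇓snd (≲var v2 refl))))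
      (rule₂ ⇓let (rule₁ ⇓snd (rule₁ ⇓snd (rule₁ ⇓snd (≲var (s3 v0) refl))))
      (rule₂ ⇓let (levels⇓ {kx = v0} {lx = s3 v0} _ 1≤n 1≤k refl refl)
      (rule₂ ⇓let (range⇓ n≤M (length⇓ _ n≤M (≲var (s4 v0) refl)))
      (rule₂ ⇓let (range⇓ levels≤M (≲var v1 refl))
      (rule₂ ⇓let (tuples⇓ v1 refl 1≤n n≤M levels≤M N≤M v2 refl)
      (main⇓ adj X r))))))))

-- Walks and paths in graphs.

module Walks where

  open import Defs using (Graph)
  open import Data.Empty using (⊥-elim)
  open import Data.Fin.Base using (Fin)
  open import Data.Fin.Properties using (_≟_)
  open import Data.List.Base using ([]; _∷_; _∷ʳ_)
  open import Data.List.Membership.Propositional using (_∈_; _∉_)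
  open import Data.List.Membership.Propositional.Properties using (∈-++⁻)
  import Data.List.Membership.DecPropositional as DecMembership
  open import Data.List.Relation.Unary.All using ([]; _∷_)
  import Data.List.Relation.Unary.All.Properties as All
  open import Data.List.Relation.Unary.Any using (here; there)
  open import Data.List.Relation.Unary.AllPairs using ([]; _∷_)
  open import Data.List.Relation.Unary.Unique.Propositional using (Unique)
  import Data.List.Relation.Unary.Unique.Propositional.Properties as Unique
  open import Data.Nat.Base
  open import Data.Nat.Properties hiding (_≟_)
  open import Data.Product.Base using (Σ-syntax; _,_; proj₁)
  open import Data.Sum.Base using (_⊎_; inj₁; inj₂)
  open import Function.Base using (_∘_)
  open import Relation.Binary.Construct.Closure.ReflexiveTransitive using (ε; _◅_; _◅◅_)
  open import Relation.Binary.PropositionalEquality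
  open import Relation.Nullary.Decidable.Core using (yes; no)
  open import Relation.Nullary.Negation using (contradiction)

  module Walking {n : ℕ} (G : Graph n) where

    open Graph G public
    open DecMembership (_≟_ {n}) using (_∈?_)

    source∈ : ∀ {u v} (w : Walk u v) → u ∈ visited w
    source∈ ε       = here refl
    source∈ (e ◅ w) = here refl

    target∈ : ∀ {u v} (w : Walk u v) → v ∈ visited w
    target∈ ε       = here refl
    target∈ (e ◅ w) = there (target∈ w)

    ∈-◅◅ : ∀ {u v z x} (w : Walk u v) (w′ : Walk v z) →
           x ∈ visited (w ◅◅ w′) → x ∈ visited w ⊎ x ∈ visited w′
    ∈-◅◅ ε       w′ x∈         = inj₂ x∈
    ∈-◅◅ (e ◅ w) w′ (here eq)  = inj₁ (here eq)
    ∈-◅◅ (e ◅ w) w′ (there x∈) with ∈-◅◅ w w′ x∈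
    ... | inj₁ x∈w  = inj₁ (there x∈w)
    ... | inj₂ x∈w′ = inj₂ x∈w′

    visited-∷ʳ : ∀ {u v z} (w : Walk u v) (e : Edge v z) → visited (w ◅◅ (e ◅ ε)) ≡ visited w ∷ʳ z
    visited-∷ʳ ε       e = refl
    visited-∷ʳ (f ◅ w) e = cong (_ ∷_) (visited-∷ʳ w e)

    walkHops-∷ʳ : ∀ {u v z} (w : Walk u v) (e : Edge v z) → walkHops (w ◅◅ (e ◅ ε)) ≡ suc (walkHops w)
    walkHops-∷ʳ ε       e = refl
    walkHops-∷ʳ (f ◅ w) e = cong suc (walkHops-∷ʳ w e)

    reverseWalk : ∀ {u v} → Walk u v → Walk v u
    reverseWalk ε       = ε
    reverseWalk (e ◅ w) = reverseWalk w ◅◅ (edge-sym e ◅ ε)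

    ∈-reverseWalk : ∀ {u v x} (w : Walk u v) → x ∈ visited (reverseWalk w) → x ∈ visited w
    ∈-reverseWalk ε       x∈ = x∈
    ∈-reverseWalk (e ◅ w) x∈ with ∈-++⁻ (visited (reverseWalk w)) (subst (_ ∈_) (visited-∷ʳ (reverseWalk w) (edge-sym e)) x∈)
    ... | inj₁ x∈w         = there (∈-reverseWalk w x∈w)
    ... | inj₂ (here refl) = here refl

    walkHops-reverseWalk : ∀ {u v} (w : Walk u v) → walkHops (reverseWalk w) ≡ walkHops w
    walkHops-reverseWalk ε       = refl
    walkHops-reverseWalk (e ◅ w) = trans (walkHops-∷ʳ (reverseWalk w) (edge-sym e)) (cong suc (walkHops-reverseWalk w))

    simple-reverseWalk : ∀ {u v} (w : Walk u v) → Unique (visited w) → Unique (visited (reverseWalk w))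
    simple-reverseWalk ε       uniq       = uniq
    simple-reverseWalk (e ◅ w) (u∉ ∷ uniq) = subst Unique (sym (visited-∷ʳ (reverseWalk w) (edge-sym e)))
      (Unique.++⁺ (simple-reverseWalk w uniq) ([] ∷ [])
        λ { (x∈ , here refl) → All.All¬⇒¬Any u∉ (∈-reverseWalk w x∈) })

    reversePath : ∀ {u v} → Path u v → Path v u
    reversePath (w , uniq) = reverseWalk w , simple-reverseWalk w uniq

    hops-reversePath : ∀ {u v} (p : Path u v) → hops (reversePath p) ≡ hops p
    hops-reversePath (w , _) = walkHops-reverseWalk w

    consPath : ∀ {u v z} → Edge u v → (p : Path v z) → u ∉ visited (proj₁ p) → Path u z
    consPath e (w , uniq) u∉ = e ◅ w , All.¬Any⇒All¬ _ u∉ ∷ uniq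

    tail-simple : ∀ {u v z} (e : Edge u v) (w : Walk v z) → Unique (visited (e ◅ w)) → Unique (visited w)
    tail-simple e w (_ ∷ uniq) = uniq

    source∉tail : ∀ {u v z} (e : Edge u v) (w : Walk v z) → Unique (visited (e ◅ w)) → u ∉ visited w
    source∉tail e w (u∉ ∷ _) = All.All¬⇒¬Any u∉

    dropUntil : ∀ {u v x} (p : Path u v) → x ∈ visited (proj₁ p) →
                Σ[ q ∈ Path x v ] (∀ {y} → y ∈ visited (proj₁ q) → y ∈ visited (proj₁ p))
    dropUntil (ε , uniq)       (here refl) = (ε , uniq) , λ y∈ → y∈
    dropUntil (e ◅ w , uniq)   (here refl) = (e ◅ w , uniq) , λ y∈ → y∈
    dropUntil (e ◅ w , _ ∷ uniq) (there x∈) with dropUntil (w , uniq) x∈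
    ... | q , q⊆ = q , there ∘ q⊆

    eraseLoops : ∀ {u v} (w : Walk u v) →
                 Σ[ p ∈ Path u v ] (∀ {y} → y ∈ visited (proj₁ p) → y ∈ visited w)
    eraseLoops ε = (ε , [] ∷ []) , λ y∈ → y∈
    eraseLoops {u} (e ◅ w) with eraseLoops w
    ... | p , p⊆ with u ∈? visited (proj₁ p)
    ...   | no u∉ = consPath e p u∉ , λ { (here eq) → here eq ; (there y∈) → there (p⊆ y∈) }
    ...   | yes u∈ with dropUntil p u∈
    ...     | q , q⊆ = q , there ∘ p⊆ ∘ q⊆

    splitAt : ∀ {u v x} (w : Walk u v) → x ∈ visited w →
              Σ[ w₁ ∈ Walk u x ] Σ[ w₂ ∈ Walk x v ] w ≡ w₁ ◅◅ w₂
    splitAt ε       (here refl) = ε , ε , refl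
    splitAt (e ◅ w) (here refl) = ε , e ◅ w , refl
    splitAt (e ◅ w) (there x∈) with splitAt w x∈
    ... | w₁ , w₂ , refl = e ◅ w₁ , w₂ , refl

    module _ (acyclic : Acyclic) where

      -- With its loops erased, a walk from j to some z ≠ j that avoids c would close a simple cycle
      -- through c.
      no-detour : ∀ {c j z} → Edge c j → Edge c z → (w : Walk j z) → c ∉ visited w → j ≡ z
      no-detour {c} {j} {z} cj cz w c∉ with eraseLoops w
      ... | (ε , _) , _ = refl
      ... | p@(_ ◅ _ , _) , p⊆ =
        ⊥-elim (acyclic (edge-sym cz) (consPath cj p (c∉ ∘ p⊆)) (s≤s (s≤s z≤n)))

      -- The rest of one path, followed by the reverse of the rest of the other, avoids the common
      -- source. Hence `no-detour` forces the first steps to agree, and induction does the rest.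
      hops-unique : ∀ {u v} (p q : Path u v) → hops p ≡ hops q
      hops-unique (w , uniq) (w′ , uniq′) = go w w′ uniq uniq′
        where
        go : ∀ {u v} (w w′ : Walk u v) → Unique (visited w) → Unique (visited w′) → walkHops w ≡ walkHops w′
        go ε       ε        _    _     = refl
        go ε       (e′ ◅ w′) _   uniq′ = contradiction (target∈ w′) (source∉tail e′ w′ uniq′)
        go (e ◅ w) ε        uniq _     = contradiction (target∈ w) (source∉tail e w uniq)
        go (e ◅ w) (e′ ◅ w′) uniq uniq′
          with no-detour e e′ (w ◅◅ reverseWalk w′) avoid
          where
          avoid : _ ∉ visited (w ◅◅ reverseWalk w′)
          avoid u∈ with ∈-◅◅ w (reverseWalk w′) u∈
          ... | inj₁ u∈w  = source∉tail e w uniq u∈w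
          ... | inj₂ u∈w′ = source∉tail e′ w′ uniq′ (∈-reverseWalk w′ u∈w′)
        ... | refl = cong suc (go w w′ (tail-simple e w uniq) (tail-simple e′ w′ uniq′))

-- The ancestor order of a rooted tree metric.

module TreeMetrics where

  open import Defs using (WeightedGraph; Induces)
  open Walks
  open import Data.Fin.Base using (Fin)
  open import Data.Fin.Properties using (_≟_; any?)
  import Data.Fin.Induction as Fin
  import Data.List.Membership.DecPropositional as DecMembership
  open import Data.List.Membership.Propositional using (_∉_)
  open import Data.List.Relation.Unary.All using ([]; _∷_)
  open import Data.List.Relation.Unary.AllPairs using ([]; _∷_)
  open import Data.List.Relation.Unary.Any using (here)
  open import Data.Nat.Base using (ℕ)
  open import Data.Product.Base using (∃-syntax; _×_; _,_; proj₁; proj₂)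
  open import Data.Rational.Base using (ℚ; 0ℚ; _+_; -_; _≤_)
  open import Data.Rational.Properties hiding (_≟_)
  open import Data.Rational.Solver using (module +-*-Solver)
  open import Data.Sum.Base using (_⊎_; inj₁; inj₂)
  open import Function.Base using (_∘_)
  open import Function.Metric.Rational using (IsMetric)
  open import Induction.WellFounded using (Acc; acc)
  open import Relation.Binary.Construct.Closure.ReflexiveTransitive using (ε; _◅_; _◅◅_)
  open import Relation.Binary.PropositionalEquality
  open import Relation.Binary.Structures using (IsStrictPartialOrder)
  open import Relation.Nullary.Decidable.Core using (Dec; yes; no; _×-dec_; ¬?)
  open import Relation.Nullary.Negation using (¬_; contradiction)

  open +-*-Solver using (solve; _:+_; _:=_; con)

  -- The second argument expresses y - x = b - a without subtraction.
  linear : ∀ {a b x y} → a ≤ b → x + b ≡ y + a → x ≤ y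
  linear {a} {b} {x} {y} a≤b eq = begin
    x                ≡⟨ solve 2 (λ x b → x := x :+ b :+ :- b) refl x b ⟩
    x + b + (- b)    ≡⟨ cong (_+ (- b)) eq ⟩
    y + a + (- b)    ≤⟨ +-monoˡ-≤ (- b) (+-monoʳ-≤ y a≤b) ⟩
    y + b + (- b)    ≡⟨ solve 2 (λ y b → y :+ b :+ :- b := y) refl y b ⟩
    y                ∎
    where
    open ≤-Reasoning
    open +-*-Solver using (:-_)

  infixl 6 _⊹_

  _⊹_ : ∀ {a b x y} → a ≤ b → x ≤ y → a + x ≤ b + y
  _⊹_ = +-mono-≤

  module RootedMetric {n : ℕ} (d : Fin n → Fin n → ℚ) (isMetric : IsMetric _≡_ d) (r : Fin n) where

    private
      module d = IsMetric isMetric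

    tri : ∀ u v w → d u w ≤ d u v + d v w
    tri = d.triangle

    d-sym : ∀ u v → d u v ≡ d v u
    d-sym = d.sym

    d-refl : ∀ u → d u u ≡ 0ℚ
    d-refl u = d.≈⇒0 refl

    0≤d : ∀ {u v} → 0ℚ ≤ d u v
    0≤d = d.nonNegative

    d≤0⇒≡ : ∀ {u v} → d u v ≤ 0ℚ → u ≡ v
    d≤0⇒≡ d≤0 = d.0⇒≈ (≤-antisym d≤0 0≤d)

    infix 4 _⊑_ _⊏_

    opaque

      -- In a tree metric, this says that u lies on the path from r to v, so that u is an ancestor
      -- of v.
      _⊑_ : Fin n → Fin n → Set
      u ⊑ v = d r u + d u v ≤ d r v

      ⊑⁺ : ∀ {u v} → d r u + d u v ≤ d r v → u ⊑ v
      ⊑⁺ le = le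

      ⊑⁻ : ∀ {u v} → u ⊑ v → d r u + d u v ≤ d r v
      ⊑⁻ le = le

      _⊑?_ : ∀ u v → Dec (u ⊑ v)
      u ⊑? v = d r u + d u v ≤? d r v

    _⊏_ : Fin n → Fin n → Set
    u ⊏ v = u ≢ v × u ⊑ v

    _⊏?_ : ∀ u v → Dec (u ⊏ v)
    u ⊏? v = ¬? (u ≟ v) ×-dec u ⊑? v

    ⊑-refl : ∀ {u} → u ⊑ u
    ⊑-refl {u} = ⊑⁺ (≤-reflexive (trans (cong (d r u +_) (d-refl u)) (+-identityʳ _)))

    r⊑ : ∀ {v} → r ⊑ v
    r⊑ {v} = ⊑⁺ (≤-reflexive (trans (cong (_+ d r v) (d-refl r)) (+-identityˡ _)))

    -- The hypotheses bound d r w from below by d r u + d u v + d v w, while the triangle inequality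
    -- bounds it from above by d r u + d u w.
    ⊑⇒between : ∀ {u v w} → u ⊑ v → v ⊑ w → d u v + d v w ≤ d u w
    ⊑⇒between {u} {v} {w} u⊑v v⊑w = linear (⊑⁻ u⊑v ⊹ ⊑⁻ v⊑w ⊹ tri r u w)
      (solve 6 (λ ru uv rv vw rw uw →
        (uv :+ vw) :+ (rv :+ rw :+ (ru :+ uw)) := uw :+ ((ru :+ uv) :+ (rv :+ vw) :+ rw))
        refl (d r u) (d u v) (d r v) (d v w) (d r w) (d u w))

    ⊑-trans : ∀ {u v w} → u ⊑ v → v ⊑ w → u ⊑ w
    ⊑-trans {u} {v} {w} u⊑v v⊑w = ⊑⁺ (linear (⊑⁻ u⊑v ⊹ ⊑⁻ v⊑w ⊹ tri u v w)
      (solve 6 (λ ru uv rv vw rw uw →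
        (ru :+ uw) :+ (rv :+ rw :+ (uv :+ vw)) := rw :+ ((ru :+ uv) :+ (rv :+ vw) :+ uw))
        refl (d r u) (d u v) (d r v) (d v w) (d r w) (d u w)))

    ⊑-antisym : ∀ {u v} → u ⊑ v → v ⊑ u → u ≡ v
    ⊑-antisym {u} {v} u⊑v v⊑u = d≤0⇒≡ (linear (⊑⁻ u⊑v ⊹ ⊑⁻ v⊑u ⊹ 0≤d {v} {u})
      (solve 4 (λ ru uv rv vu → uv :+ (rv :+ ru :+ vu) := con 0ℚ :+ ((ru :+ uv) :+ (rv :+ vu) :+ con 0ℚ))
        refl (d r u) (d u v) (d r v) (d v u)))

    ⊑r⇒≡ : ∀ {v} → v ⊑ r → v ≡ r
    ⊑r⇒≡ v⊑r = ⊑-antisym v⊑r r⊑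

    ⊏-⊑-trans : ∀ {u v w} → u ⊏ v → v ⊑ w → u ⊏ w
    ⊏-⊑-trans (u≢v , u⊑v) v⊑w = (λ { refl → u≢v (⊑-antisym u⊑v v⊑w) }) , ⊑-trans u⊑v v⊑w

    ⊏-isStrictPartialOrder : IsStrictPartialOrder _≡_ _⊏_
    ⊏-isStrictPartialOrder = record
      { isEquivalence = isEquivalence
      ; irrefl        = λ u≡v (u≢v , _) → u≢v u≡v
      ; trans         = λ u⊏v (_ , v⊑w) → ⊏-⊑-trans u⊏v v⊑w
      ; <-resp-≈      = resp₂ _⊏_
      }

    Cover : Fin n → Fin n → Set
    Cover p c = p ⊏ c × (∀ z → p ⊏ z → ¬ z ⊏ c)

    -- A point strictly between v and w replaces w until none is left. This ends because a strict
    -- order on finitely many points is well-founded.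
    child-towards : ∀ {v w} → v ⊏ w → ∃[ c ] Cover v c × c ⊑ w
    child-towards {v} {w} = go (Fin.spo-wellFounded ⊏-isStrictPartialOrder w)
      where
      go : ∀ {w} → Acc _⊏_ w → v ⊏ w → ∃[ c ] Cover v c × c ⊑ w
      go {w} (acc rec) v⊏w with any? (λ z → v ⊏? z ×-dec z ⊏? w)
      ... | no ∄z = w , (v⊏w , λ z v⊏z z⊏w → ∄z (z , v⊏z , z⊏w)) , ⊑-refl
      ... | yes (z , v⊏z , z⊏w) with go (rec z⊏w) v⊏z
      ...   | c , cover , c⊑z = c , cover , ⊑-trans c⊑z (proj₂ z⊏w)

    -- Dually, starting with r as the lower end, which is replaced by points strictly between it and
    -- v.
    parent-of : ∀ {v} → v ≢ r → ∃[ p ] Cover p v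
    parent-of {v} v≢r = go (Fin.spo-noetherian ⊏-isStrictPartialOrder r) ((v≢r ∘ sym) , r⊑)
      where
      go : ∀ {u} → Acc (λ x y → y ⊏ x) u → u ⊏ v → ∃[ p ] Cover p v
      go {u} (acc rec) u⊏v with any? (λ z → u ⊏? z ×-dec z ⊏? v)
      ... | no ∄z = u , u⊏v , λ z u⊏z z⊏v → ∄z (z , u⊏z , z⊏v)
      ... | yes (z , u⊏z , z⊏v) = go (rec u⊏z) z⊏v

    -- In a tree rooted at r, j is the neighbour of c on the way to r.
    Branching : Set
    Branching = ∀ c → c ≢ r → ∃[ j ] j ≢ c × (∀ y → d c j + d j y ≤ d c y ⊎ c ⊑ y)

    module _ (branching : Branching) where

      module _ {p c : Fin n} (cover : Cover p c) where

        private
          p⊏c = proj₁ cover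

          c≢r : c ≢ r
          c≢r refl = proj₁ p⊏c (⊑r⇒≡ (proj₂ p⊏c))

          j = proj₁ (branching c c≢r)
          j≢c = proj₁ (proj₂ (branching c c≢r))
          split = proj₂ (proj₂ (branching c c≢r))

        -- Splitting at r gives `j ⊑ c`, and splitting at p gives `p ⊑ j`. If p and j were distinct,
        -- j would lie strictly between p and c.
        cover≡branch : p ≡ j
        cover≡branch with p ≟ j
        ... | yes p≡j = p≡j
        ... | no p≢j = contradiction (j≢c , j⊑c) (proj₂ cover j (p≢j , p⊑j))
          where
          j⊑c : j ⊑ c
          j⊑c with split r
          ... | inj₁ le  = ⊑⁺ (subst₂ _≤_ (trans (+-comm (d c j) (d j r)) (cong₂ _+_ (d-sym j r) (d-sym c j))) (d-sym c r) le)
          ... | inj₂ c⊑r = contradiction (⊑r⇒≡ c⊑r) c≢r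

          p⊑j : p ⊑ j
          p⊑j with split p
          ... | inj₂ c⊑p = contradiction (⊑-antisym (proj₂ p⊏c) c⊑p) (proj₁ p⊏c)
          ... | inj₁ le  = ⊑⁺ (linear (le ⊹ ⊑⁻ (proj₂ p⊏c) ⊹ tri r j c ⊹ ≤-reflexive (d-sym j c) ⊹ ≤-reflexive (d-sym c p) ⊹ ≤-reflexive (d-sym p j))
            (solve 9 (λ rp jp cj cp pc rc rj jc pj →
              (rp :+ pj) :+ (cp :+ rc :+ (rj :+ jc) :+ cj :+ pc :+ jp)
              := rj :+ ((cj :+ jp) :+ (rp :+ pc) :+ rc :+ jc :+ cp :+ pj))
              refl (d r p) (d j p) (d c j) (d c p) (d p c) (d r c) (d r j) (d j c) (d p j)))

        through-cover : ∀ {y} → ¬ c ⊑ y → d c p + d p y ≤ d c y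
        through-cover {y} c⋢y rewrite cover≡branch with split y
        ... | inj₁ le  = le
        ... | inj₂ c⊑y = contradiction c⊑y c⋢y

      cover-unique : ∀ {p p′ c} → Cover p c → Cover p′ c → p ≡ p′
      cover-unique cover cover′ = trans (cover≡branch cover) (sym (cover≡branch cover′))

  module _ {n : ℕ} (d : Fin n → Fin n → ℚ) (isMetric : IsMetric _≡_ d)
           (G : WeightedGraph n) (induces : Induces G d) where

    open WeightedGraph G using (weight; walkLength)
    open Walking (WeightedGraph.graph G)

    d≤weight : ∀ {u v} → Edge u v → d u v ≤ weight u v
    d≤weight {u} {v} e with induces u v
    ... | p , shortest , eq = subst₂ _≤_ eq (+-identityʳ (weight u v))
      (shortest (consPath e (ε , [] ∷ []) λ { (here refl) → edge-irrefl refl e }))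

    d≤walkLength : ∀ {u v} (w : Walk u v) → d u v ≤ walkLength w
    d≤walkLength ε = ≤-reflexive (IsMetric.≈⇒0 isMetric refl)
    d≤walkLength (_◅_ {i = u} {j} {v} e w) =
      ≤-trans (IsMetric.triangle isMetric u j v) (d≤weight e ⊹ d≤walkLength w)

    walkLength-◅◅ : ∀ {u v z} (w : Walk u v) (w′ : Walk v z) →
                    walkLength (w ◅◅ w′) ≡ walkLength w + walkLength w′
    walkLength-◅◅ ε w′ = sym (+-identityˡ _)
    walkLength-◅◅ (_◅_ {i = u} {j} e w) w′ =
      trans (cong (weight u j +_) (walkLength-◅◅ w w′)) (sym (+-assoc (weight u j) (walkLength w) (walkLength w′)))

    -- Here j is the second vertex of the path from c to r. If the path from c to y starts with j as
    -- well, it passes through j. Otherwise one can walk from j to r, on to y and back to the second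
    -- vertex of that path; by `no-detour` this meets c, which can only happen between r and y, so
    -- `c ⊑ y`.
    tree-branching : IsTree → (r : Fin n) → RootedMetric.Branching d isMetric r
    tree-branching (_ , acyclic) r c c≢r with induces c r
    ... | (ε , _) , _ = contradiction refl c≢r
    ... | (_◅_ {j = j} e q , simple) , _ = j , (λ { refl → edge-irrefl refl e }) , split
      where
      open RootedMetric d isMetric r
      open DecMembership (_≟_ {n}) using (_∈?_)

      split : ∀ y → d c j + d j y ≤ d c y ⊎ c ⊑ y
      split y with induces c y
      ... | (ε , _) , _ = inj₂ ⊑-refl
      ... | (_◅_ {j = z} f s , simple′) , _ , length≡ with j ≟ z
      ...   | yes refl = inj₁ (subst (d c j + d j y ≤_) length≡ (d≤weight f ⊹ d≤walkLength s))
      ...   | no j≢z with induces r y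
      ...     | (t , _) , _ , length≡′ with c ∈? visited t
      ...       | no c∉t = contradiction (no-detour acyclic e f (q ◅◅ t ◅◅ reverseWalk s) avoid) j≢z
        where
        avoid : c ∉ visited (q ◅◅ t ◅◅ reverseWalk s)
        avoid c∈ with ∈-◅◅ q (t ◅◅ reverseWalk s) c∈
        ... | inj₁ c∈q = source∉tail e q simple c∈q
        ... | inj₂ c∈ts with ∈-◅◅ t (reverseWalk s) c∈ts
        ...   | inj₁ c∈t = c∉t c∈t
        ...   | inj₂ c∈s = source∉tail f s simple′ (∈-reverseWalk s c∈s)
      ...       | yes c∈t with splitAt t c∈t
      ...         | t₁ , t₂ , refl = inj₂ (⊑⁺ (subst (d r c + d c y ≤_) (trans (sym (walkLength-◅◅ t₁ t₂)) length≡′)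
                      (d≤walkLength t₁ ⊹ d≤walkLength t₂)))

-- Correctness of the distance computation.

module ShortestPaths where

  open import Defs using (WeightedGraph; Induces)
  open SteinerAlgorithm using (module Algorithm; best; better; iterate)
  open Walks
  open TreeMetrics
  open import Data.Bool.Base using (Bool; true; false; if_then_else_; T)
  open import Data.Fin.Base using (Fin; zero; suc)
  import Data.Fin.Base as Fin
  open import Data.Fin.Properties using (_≟_; pigeonhole)
  open import Data.List.Base as List using (List)
  open import Data.List.Membership.Propositional.Properties using (∈-lookup)
  open import Data.List.Relation.Unary.All as All using ([]; _∷_)
  open import Data.List.Relation.Unary.AllPairs using ([]; _∷_)
  open import Data.List.Relation.Unary.Unique.Propositional using (Unique)
  open import Data.Maybe.Base using (Maybe; just; nothing)
  open import Data.Maybe.Properties using (just-injective)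
  open import Data.Nat.Base as ℕ using (ℕ)
  import Data.Nat.Properties as ℕ
  open import Data.Product.Base using (∃-syntax; _×_; _,_; proj₂)
  open import Data.Rational.Base using (ℚ; 0ℚ; _+_; _≤_; _≤ᵇ_)
  open import Data.Rational.Properties hiding (_≟_)
  open import Data.Sum.Base using (inj₁; inj₂)
  open import Data.Vec.Functional as Vector using (Vector)
  open import Function.Base using (_∘_; id)
  open import Function.Metric.Rational using (IsMetric)
  open import Relation.Binary.Construct.Closure.ReflexiveTransitive using (ε; _◅_)
  open import Relation.Binary.PropositionalEquality
  open import Relation.Nullary.Decidable.Core using (yes; no)
  open import Relation.Nullary.Negation using (contradiction)

  ≤ᵇ-false : ∀ {p q} → (p ≤ᵇ q) ≡ false → q ≤ p
  ≤ᵇ-false {p} {q} eq with ≤-total p q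
  ... | inj₁ p≤q = contradiction (subst T eq (≤⇒≤ᵇ p≤q)) λ ()
  ... | inj₂ q≤p = q≤p

  ≤ᵇ-true : ∀ {p q} → (p ≤ᵇ q) ≡ true → p ≤ q
  ≤ᵇ-true eq = ≤ᵇ⇒≤ (subst T (sym eq) _)

  unique-length : ∀ {n} {xs : List (Fin n)} → Unique xs → List.length xs ℕ.≤ n
  unique-length {n} {xs} uniq = ℕ.≮⇒≥ λ n<length →
    let (i , j , i<j , eq) = pigeonhole n<length (List.lookup xs) in distinct uniq i j i<j eq
    where
    distinct : ∀ {xs : List (Fin n)} → Unique xs → ∀ i j → i Fin.< j → List.lookup xs i ≢ List.lookup xs j
    distinct (x∉ ∷ _)    zero    (suc j) _   eq = All.lookup x∉ (∈-lookup j) eq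
    distinct (_ ∷ uniq)  (suc i) (suc j) i<j eq = distinct uniq i j (ℕ.s<s⁻¹ i<j) eq

  module _ {A : Set} where

    best-from : ∀ {m} (xs : Vector (Maybe (A × ℚ)) m) {b} → best xs ≡ just b → ∃[ i ] xs i ≡ just b
    best-from {ℕ.suc m} xs eq with xs zero in eq₀ | best (xs ∘ suc) in eq₊
    ... | nothing | just y  = let (i , eq′) = best-from (xs ∘ suc) (trans eq₊ eq) in suc i , eq′
    ... | just x  | nothing = zero , trans eq₀ eq
    ... | just x  | just y with proj₂ x ≤ᵇ proj₂ y
    ...   | true  = zero , trans eq₀ eq
    ...   | false = let (i , eq′) = best-from (xs ∘ suc) (trans eq₊ eq) in suc i , eq′

    best-least : ∀ {m} (xs : Vector (Maybe (A × ℚ)) m) i {c} → xs i ≡ just c →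
                 ∃[ b ] best xs ≡ just b × proj₂ b ≤ proj₂ c
    best-least {ℕ.suc m} xs zero {c} eq rewrite eq with best (xs ∘ suc)
    ... | nothing = c , refl , ≤-refl
    ... | just y with proj₂ c ≤ᵇ proj₂ y in c≤y
    ...   | true  = c , refl , ≤-refl
    ...   | false = y , refl , ≤ᵇ-false c≤y
    best-least {ℕ.suc m} xs (suc i) eq with best-least (xs ∘ suc) i eq
    ... | b , eq′ , b≤c rewrite eq′ with xs zero
    ...   | nothing = b , refl , b≤c
    ...   | just x with proj₂ x ≤ᵇ proj₂ b in x≤b
    ...     | true  = x , refl , ≤-trans (≤ᵇ-true x≤b) b≤c
    ...     | false = b , refl , b≤c

    best-cong : ∀ {m} {xs ys : Vector (Maybe (A × ℚ)) m} → xs ≗ ys → best xs ≡ best ys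
    best-cong {ℕ.zero}  eq = refl
    best-cong {ℕ.suc m} eq = cong₂ better (eq zero) (best-cong (eq ∘ suc))

  iter : ∀ {A : Set} → ℕ → A → (A → A) → A
  iter ℕ.zero    x f = x
  iter (ℕ.suc t) x f = f (iter t x f)

  iterate≡iter : ∀ {A : Set} n (x : A) f → iterate n x f ≡ iter n x f
  iterate≡iter n x f = go n id
    where
    go : ∀ m {N} (h : Fin m → Fin N) → Vector.foldr (λ _ y → f y) x h ≡ iter m x f
    go ℕ.zero    h = refl
    go (ℕ.suc m) h = cong f (go m (h ∘ suc))

  adjacency : ∀ {n} → WeightedGraph n → Fin n → Fin n → Maybe ℚ
  adjacency G u v = if edge? u v then just (weight u v) else nothing
    where open WeightedGraph G

  module _ {n : ℕ} (d : Fin n → Fin n → ℚ) (isMetric : IsMetric _≡_ d)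
           (G : WeightedGraph n) (induces : Induces G d)
           (κ : ℕ) (X : Fin n → Bool) (r : Fin n) where

    open Algorithm {n} {κ} (adjacency G) X r using (walks; D₀; dist; extend)
    open WeightedGraph G using (weight; weight-pos; walkLength; graph)
    open Walking graph

    private
      module d = IsMetric isMetric

    adjacency-edge : ∀ {u v} → Edge u v → adjacency G u v ≡ just (weight u v)
    adjacency-edge {u} {v} e with edge? u v
    ... | true = refl

    edge-adjacency : ∀ {u v a} → adjacency G u v ≡ just a → Edge u v × weight u v ≡ a
    edge-adjacency {u} {v} eq with edge? u v
    ... | true = _ , just-injective eq

    0≤walkLength : ∀ {u v} (w : Walk u v) → 0ℚ ≤ walkLength w
    0≤walkLength ε       = ≤-refl
    0≤walkLength (e ◅ w) = <⇒≤ (weight-pos e) ⊹ 0≤walkLength w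

    private
      D : ℕ → Fin n → Fin n → Maybe (Fin n × ℚ)
      D t = iter t D₀ walks

    extend-just : ∀ D {u v w e} → extend D u v w ≡ just e →
                  ∃[ a ] ∃[ y ] adjacency G u w ≡ just a × D w v ≡ just y × e ≡ (w , a + proj₂ y)
    extend-just D {u} {v} {w} eq with adjacency G u w | D w v | eq
    ... | just a | just y | refl = a , y , refl , refl , refl

    just-extend : ∀ D {u v w a y} → adjacency G u w ≡ just a → D w v ≡ just y →
                  extend D u v w ≡ just (w , a + proj₂ y)
    just-extend D eqa eqD rewrite eqa | eqD = refl

    -- An entry is the length of an actual walk: each round puts an edge in front, and the triangle
    -- inequality accounts for it.
    D-upper : ∀ t {u v e} → D t u v ≡ just e → d u v ≤ proj₂ e
    D-upper ℕ.zero {u} {v} eq with u ≟ v | eq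
    ... | yes refl | refl = ≤-reflexive (d.≈⇒0 refl)
    D-upper (ℕ.suc t) {u} {v} eq with u ≟ v | eq
    ... | yes refl | refl = ≤-reflexive (d.≈⇒0 refl)
    ... | no _     | eq′ with best-from (extend (D t) u v) eq′
    ...   | w , eq″ with extend-just (D t) eq″
    ...     | a , y , eqa , eqD , refl with edge-adjacency eqa
    ...       | e , refl = ≤-trans (d.triangle u w v) (d≤weight d isMetric G induces e ⊹ D-upper t eqD)

    D-lower : ∀ t {u v} (p : Walk u v) → walkHops p ℕ.≤ t → ∃[ e ] D t u v ≡ just e × proj₂ e ≤ walkLength p
    D-lower ℕ.zero {u} ε _ with u ≟ u
    ... | yes _  = _ , refl , ≤-refl
    ... | no u≢u = contradiction refl u≢u
    D-lower (ℕ.suc t) {u} {v} p hops≤ with u ≟ v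
    -- A closed walk cannot beat the entry 0, as weights are positive.
    ... | yes refl = _ , refl , 0≤walkLength p
    ... | no u≢v with p | hops≤
    ...   | ε | _ = contradiction refl u≢v
    ...   | _◅_ {j = w} e p′ | ℕ.s≤s hops≤′ with D-lower t p′ hops≤′
    ...     | y , eqD , y≤ with best-least (extend (D t) u v) w (just-extend (D t) (adjacency-edge e) eqD)
    ...       | b , eq , b≤ = b , eq , ≤-trans b≤ (+-monoʳ-≤ (weight u w) y≤)

    opaque
      unfolding dist

      -- A shortest path is simple, so it visits at most n vertices and has fewer than n edges; n
      -- rounds suffice.
      dist≡d : ∀ u v → dist u v ≡ d u v
      dist≡d u v rewrite iterate≡iter n D₀ walks with induces u v
      ... | (p , simple) , _ , length≡ with D-lower n p (ℕ.≤-trans (ℕ.n≤1+n _) (subst (ℕ._≤ n) (visited-length p) (unique-length simple)))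
        where
        visited-length : ∀ {u v} (w : Walk u v) → List.length (visited w) ≡ ℕ.suc (walkHops w)
        visited-length ε       = refl
        visited-length (e ◅ w) = cong ℕ.suc (visited-length w)
      ...   | e , eq , e≤ rewrite eq = ≤-antisym (subst (_ ≤_) length≡ e≤) (D-upper n eq)

-- Fixpoints of local iterations, and sums over a tree.

module Sums where

  open ShortestPaths using (iter)
  open TreeMetrics using (linear; _⊹_)
  import Algebra.Properties.CommutativeMonoid.Sum as Sum
  open import Data.Bool.Base using (Bool; true; false; if_then_else_)
  open import Data.Fin.Base using (Fin; zero; suc)
  open import Data.Fin.Properties using (_≟_; 0≢1+n; suc-injective)
  open import Data.Fin.Subset using (Subset; _∈_; ∣_∣)
  open import Data.Fin.Subset.Properties using (p⊂q⇒∣p∣<∣q∣; ∣⊤∣≡n; ∈⊤)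
  open import Data.Nat.Base as ℕ using (ℕ)
  import Data.Nat.Properties as ℕ
  open import Data.Product.Base using (∃-syntax; _,_)
  open import Data.Rational.Base using (ℚ; 0ℚ; _+_; _≤_)
  open import Data.Rational.Properties hiding (_≟_)
  open import Data.Vec.Base using (tabulate)
  open import Data.Vec.Functional using (Vector)
  open import Data.Vec.Properties using ([]=⇒lookup; lookup⇒[]=; lookup∘tabulate)
  open import Function.Base using (_∘_)
  open import Relation.Binary.Definitions using (Decidable)
  open import Relation.Binary.PropositionalEquality
  open import Relation.Binary.Structures using (IsStrictPartialOrder)
  open import Relation.Nullary.Decidable using (Dec; yes; no; does; dec-true; dec-false)
  open import Relation.Nullary.Negation using (contradiction)

  open Sum +-0-commutativeMonoid public using (sum; ∑-comm; ∑-distrib-+; sum-cong-≗; sum-replicate-zero)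

  does⇒ : ∀ {A : Set} (a? : Dec A) → does a? ≡ true → A
  does⇒ (yes a) _ = a

  sum-mono : ∀ {n} {f g : Vector ℚ n} → (∀ i → f i ≤ g i) → sum f ≤ sum g
  sum-mono {ℕ.zero}  f≤g = ≤-refl
  sum-mono {ℕ.suc n} f≤g = f≤g zero ⊹ sum-mono (f≤g ∘ suc)

  sum-zero : ∀ {n} {f : Vector ℚ n} → (∀ i → f i ≡ 0ℚ) → sum f ≡ 0ℚ
  sum-zero {n} f≡0 = trans (sum-cong-≗ f≡0) (sum-replicate-zero n)

  sum-single : ∀ {n} {f : Vector ℚ n} j → (∀ i → i ≢ j → f i ≡ 0ℚ) → sum f ≡ f j
  sum-single {f = f} zero    f≡0 = trans (cong (f zero +_) (sum-zero λ i → f≡0 (suc i) (0≢1+n ∘ sym))) (+-identityʳ _)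
  sum-single {f = f} (suc j) f≡0 = trans (cong₂ _+_ (f≡0 zero 0≢1+n) (sum-single j λ i i≢j → f≡0 (suc i) (i≢j ∘ suc-injective))) (+-identityˡ _)

  -- A relation `_~_` takes the place of equality so that values may be functions, compared
  -- pointwise.
  module Stabilise {n : ℕ} {_≺_ : Fin n → Fin n → Set} (isSPO : IsStrictPartialOrder _≡_ _≺_)
    (_≺?_ : Decidable _≺_) {Y : Set} (_~_ : Y → Y → Set)
    (step : (Fin n → Y) → Fin n → Y)
    (step-local : ∀ f g v → (∀ u → u ≺ v → f u ~ g u) → step f v ~ step g v) where

    private
      module ≺ = IsStrictPartialOrder isSPO

      below : Fin n → Subset n
      below v = tabulate (λ u → does (u ≺? v))

      below⁺ : ∀ {u v} → u ≺ v → u ∈ below v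
      below⁺ {u} {v} u≺v = lookup⇒[]= u (below v) (trans (lookup∘tabulate _ u) (dec-true (u ≺? v) u≺v))

      below⁻ : ∀ {u v} → u ∈ below v → u ≺ v
      below⁻ {u} {v} u∈ = does⇒ (u ≺? v) (trans (sym (lookup∘tabulate _ u)) ([]=⇒lookup u∈))

      rank : Fin n → ℕ
      rank v = ∣ below v ∣

      rank-mono : ∀ {u v} → u ≺ v → rank u ℕ.< rank v
      rank-mono u≺v = p⊂q⇒∣p∣<∣q∣
        ((λ w∈ → below⁺ (≺.trans (below⁻ w∈) u≺v)) , _ , below⁺ u≺v , λ u∈ → ≺.irrefl refl (below⁻ u∈))

      rank<n : ∀ v → rank v ℕ.< n
      rank<n v = subst (rank v ℕ.<_) (∣⊤∣≡n n)
        (p⊂q⇒∣p∣<∣q∣ ((λ _ → ∈⊤) , v , ∈⊤ , λ v∈ → ≺.irrefl refl (below⁻ v∈)))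

      -- The rank counts the smaller points. All points that the step reads at v have smaller rank,
      -- so they are settled one round earlier. Ranks are below n, so n rounds settle everything.
      settled : ∀ f t v → rank v ℕ.< t → iter t f step v ~ step (iter t f step) v
      settled f (ℕ.suc t) v rank< = step-local _ _ v λ u u≺v →
        settled f t u (ℕ.<-≤-trans (rank-mono u≺v) (ℕ.s≤s⁻¹ rank<))

    stable : ∀ f v → iter n f step v ~ step (iter n f step) v
    stable f v = settled f n v (rank<n v)

  module TreeSum {n : ℕ} (r : Fin n) {Q : Set} (cov : Fin n → Fin n → Bool)
    (parent : ∀ c → c ≢ r → ∃[ p ] cov p c ≡ true)
    (parent-unique : ∀ {p p′ c} → cov p c ≡ true → cov p′ c ≡ true → p ≡ p′)
    (root : ∀ p → cov p r ≡ false)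
    (w F m : Fin n → Q → ℚ)
    (fixpoint : ∀ v q → F v q ≡ w v q + sum (λ c → if cov v c then m c q else 0ℚ))
    (A : Fin n → Q) where

    private
      inner below : Fin n → ℚ
      inner c = sum (λ v → if cov v c then m c (A v) else 0ℚ)
      below c = if does (c ≟ r) then 0ℚ else F c (A c)

      inner-root : inner r ≡ 0ℚ
      inner-root = sum-zero λ p → cong (λ b → if b then m r (A p) else 0ℚ) (root p)

      inner-cov : ∀ {p c} → cov p c ≡ true → inner c ≡ m c (A p)
      inner-cov {p} {c} pc = trans (sum-single p others) (cong (λ b → if b then m c (A p) else 0ℚ) pc)
        where
        others : ∀ v → v ≢ p → (if cov v c then m c (A v) else 0ℚ) ≡ 0ℚ
        others v v≢p with cov v c in vc
        ... | true  = contradiction (parent-unique vc pc) v≢p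
        ... | false = refl

      -- The fixpoint equation is summed over all vertices and the double sum exchanged. Then
      -- `inner c` is the one term that c contributes at its parent, and `below c` is the value of c
      -- itself, with both set to 0 at the root.
      balance : F r (A r) + sum below ≡ sum (λ v → w v (A v)) + sum inner
      balance = begin
        F r (A r) + sum below                      ≡⟨ cong (λ x → x + sum below) single ⟨
        sum at-root + sum below                    ≡⟨ ∑-distrib-+ at-root below ⟨
        sum (λ c → at-root c + below c)            ≡⟨ sum-cong-≗ split ⟩
        sum (λ v → F v (A v))                      ≡⟨ sum-cong-≗ (λ v → fixpoint v (A v)) ⟩
        sum (λ v → w v (A v) + sum (λ c → if cov v c then m c (A v) else 0ℚ))
                                                   ≡⟨ ∑-distrib-+ (λ v → w v (A v)) _ ⟩
        sum (λ v → w v (A v)) + sum (λ v → sum (λ c → if cov v c then m c (A v) else 0ℚ))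
                                                   ≡⟨ cong (sum (λ v → w v (A v)) +_) (∑-comm (λ v c → if cov v c then m c (A v) else 0ℚ)) ⟩
        sum (λ v → w v (A v)) + sum inner          ∎
        where
        open ≡-Reasoning

        at-root : Fin n → ℚ
        at-root c = if does (c ≟ r) then F c (A c) else 0ℚ

        single : sum at-root ≡ F r (A r)
        single = trans (sum-single r (λ c c≢r → cong (λ b → if b then F c (A c) else 0ℚ) (dec-false (c ≟ r) c≢r)))
          (cong (λ b → if b then F r (A r) else 0ℚ) (dec-true (r ≟ r) refl))

        split : ∀ c → at-root c + below c ≡ F c (A c)
        split c with does (c ≟ r)
        ... | true  = +-identityʳ _
        ... | false = +-identityˡ _

    -- Meant for an arbitrary consistent assignment, where F c (A c) is a candidate of the minimum m
    -- c (A p).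
    root≤total : (∀ p c → cov p c ≡ true → m c (A p) ≤ F c (A c)) → F r (A r) ≤ sum (λ v → w v (A v))
    root≤total m≤F = linear (sum-mono inner≤below) balance
      where
      inner≤below : ∀ c → inner c ≤ below c
      inner≤below c with c ≟ r
      ... | yes refl = ≤-reflexive inner-root
      ... | no c≢r   = let (p , pc) = parent c c≢r in ≤-trans (≤-reflexive (inner-cov pc)) (m≤F p c pc)

    -- Meant for the assignment chosen by the algorithm, which attains every minimum.
    total≤root : (∀ p c → cov p c ≡ true → F c (A c) ≤ m c (A p)) → sum (λ v → w v (A v)) ≤ F r (A r)
    total≤root F≤m = linear (sum-mono below≤inner) (sym balance)
      where
      below≤inner : ∀ c → below c ≤ inner c
      below≤inner c with c ≟ r
      ... | yes refl = ≤-reflexive (sym inner-root)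
      ... | no c≢r   = let (p , pc) = parent c c≢r in ≤-trans (F≤m p c pc) (≤-reflexive (sym (inner-cov pc)))

-- The dynamic program finds the cheapest consistent profiles.

module Optimality where

  open import Defs using (WeightedGraph; Induces)
  open SteinerAlgorithm using (module Algorithm)
  open TreeMetrics
  open ShortestPaths
  open Sums
  open import Data.Bool.Base using (Bool; true; false; if_then_else_; T)
  open import Data.Fin.Base using (Fin; zero; suc; funToFin)
  open import Data.Fin.Properties using (_≟_)
  import Data.Fin.Induction as Fin
  open import Data.Maybe.Base using (Maybe; just; nothing; maybe′)
  open import Data.Maybe.Properties using (just-injective)
  open import Data.Nat.Base as ℕ using (ℕ)
  open import Data.Product.Base using (∃-syntax; _×_; _,_; proj₁; proj₂)
  open import Data.Rational.Base using (ℚ; 0ℚ; _+_; _≤_; _≤ᵇ_)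
  open import Data.Rational.Properties hiding (_≟_)
  open import Data.Sum.Base using (_⊎_; inj₁; inj₂)
  open import Data.Vec.Functional as Vector using (Vector)
  open import Function.Base using (_∘_; id)
  open import Function.Metric.Rational using (IsMetric)
  open import Induction.WellFounded using (Acc; acc)
  import Relation.Binary.Construct.Flip.EqAndOrd as Flip
  open import Relation.Binary.PropositionalEquality
  open import Relation.Nullary.Decidable using (yes; no; dec-true)
  open import Relation.Nullary.Reflects using (Reflects; ofʸ; ofⁿ)
  open import Relation.Nullary.Negation using (¬_; contradiction)

  ≤ᵇ-reflects : ∀ p q → Reflects (p ≤ q) (p ≤ᵇ q)
  ≤ᵇ-reflects p q with p ≤ᵇ q in eq
  ... | true  = ofʸ (≤ᵇ-true eq)
  ... | false = ofⁿ λ p≤q → contradiction (subst T eq (≤⇒≤ᵇ p≤q)) λ ()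

  module _ {X : Set} where

    foldr-cong : ∀ {Y : Set} {g h : X → Y → Y} {y} → (∀ x b → g x b ≡ h x b) →
                 ∀ {m} (xs : Vector X m) → Vector.foldr g y xs ≡ Vector.foldr h y xs
    foldr-cong         eq {ℕ.zero}  xs = refl
    foldr-cong {h = h} eq {ℕ.suc m} xs = trans (eq _ _) (cong (h (xs zero)) (foldr-cong eq (xs ∘ suc)))

    module _ {g : X → Bool → Bool} {P : X → Set} where

      foldr-all⁻ : (∀ x b → g x b ≡ true → P x × b ≡ true) →
                   ∀ {m} (xs : Vector X m) → Vector.foldr g true xs ≡ true → ∀ i → P (xs i)
      foldr-all⁻ sound xs eq zero    = proj₁ (sound _ _ eq)
      foldr-all⁻ sound xs eq (suc i) = foldr-all⁻ sound (xs ∘ suc) (proj₂ (sound (xs zero) _ eq)) i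

      foldr-all⁺ : (∀ x → P x → g x true ≡ true) →
                   ∀ {m} (xs : Vector X m) → (∀ i → P (xs i)) → Vector.foldr g true xs ≡ true
      foldr-all⁺ complete {ℕ.zero}  xs all = refl
      foldr-all⁺ complete {ℕ.suc m} xs all =
        trans (cong (g (xs zero)) (foldr-all⁺ complete (xs ∘ suc) (all ∘ suc))) (complete _ (all zero))

  module DynamicProgram {n : ℕ} (d : Fin n → Fin n → ℚ) (isMetric : IsMetric _≡_ d)
    (G : WeightedGraph n) (induces : Induces G d) (κ : ℕ) (X : Fin n → Bool) (r : Fin n)
    (branching : RootedMetric.Branching d isMetric r) where

    open Algorithm {n} {κ} (adjacency G) X r public hiding (ρ₀; eval-mainE)
    open RootedMetric d isMetric r public

    dist≡ : ∀ u v → dist u v ≡ d u v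
    dist≡ = dist≡d d isMetric G induces κ X r

    wt≡ : ∀ v p → wt v p ≡ maybe′ (d v) 0ℚ (parent v p)
    wt≡ v p with parent v p
    ... | nothing = refl
    ... | just u  = dist≡ v u

    opaque
      unfolding leq _⊑_

      leq-reflects : ∀ u v → Reflects (u ⊑ v) (leq u v)
      leq-reflects u v rewrite dist≡ r u | dist≡ u v | dist≡ r v = ≤ᵇ-reflects _ _

    opaque
      unfolding lt

      lt-reflects : ∀ u v → Reflects (u ⊏ v) (lt u v)
      lt-reflects u v with u ≟ v
      ... | yes u≡v = ofⁿ λ u⊏v → proj₁ u⊏v u≡v
      ... | no u≢v with leq u v | leq-reflects u v
      ...   | true  | ofʸ u⊑v = ofʸ (u≢v , u⊑v)
      ...   | false | ofⁿ u⋢v = ofⁿ (u⋢v ∘ proj₂)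

    Between : Fin n → Fin n → Fin n → Set
    Between p c z = p ⊏ z → ¬ z ⊏ c

    opaque
      unfolding cov

      cov⇒Cover : ∀ {p c} → cov p c ≡ true → Cover p c
      cov⇒Cover {p} {c} eq with lt p c | lt-reflects p c
      ... | true | ofʸ p⊏c = p⊏c , foldr-all⁻ {g = noneBetween p c} {P = Between p c} sound id eq
        where
        sound : ∀ z b → noneBetween p c z b ≡ true → Between p c z × b ≡ true
        sound z b eq with lt p z | lt-reflects p z | lt z c | lt-reflects z c
        ... | false | ofⁿ p⊀z | _     | _       = (λ p⊏z → contradiction p⊏z p⊀z) , eq
        ... | true  | ofʸ _   | false | ofⁿ z⊀c = (λ _ → z⊀c) , eq
        ... | true  | ofʸ _   | true  | _       with () ← eq

    opaque
      unfolding cov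

      Cover⇒cov : ∀ {p c} → Cover p c → cov p c ≡ true
      Cover⇒cov {p} {c} (p⊏c , gap) with lt p c | lt-reflects p c
      ... | false | ofⁿ p⊀c = contradiction p⊏c p⊀c
      ... | true  | ofʸ _   = foldr-all⁺ {g = noneBetween p c} {P = Between p c} complete id gap
        where
        complete : ∀ z → Between p c z → noneBetween p c z true ≡ true
        complete z gap with lt p z | lt-reflects p z | lt z c | lt-reflects z c
        ... | false | _       | _     | _       = refl
        ... | true  | _       | false | _       = refl
        ... | true  | ofʸ p⊏z | true  | ofʸ z⊏c = contradiction z⊏c (gap p⊏z)

    -- The entry at p is either shared with its child c, or lies outside the
    -- subtree of c, while that at c lies inside.
    Compatible : Fin n → Fin n → Fin n → Set
    Compatible c x y = x ≡ y ⊎ (¬ c ⊑ x × c ⊑ y)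

    Compat : Fin n → Prof → Prof → Set
    Compat c p q = ∀ i → Compatible c (p i) (q i)

    opaque
      unfolding compat

      compat⇒Compat : ∀ {c p q} → compat c p q ≡ true → Compat c p q
      compat⇒Compat {c} {p} {q} eq = foldr-all⁻ {g = λ i → compatAt c (p i) (q i)} {P = λ i → Compatible c (p i) (q i)} sound id eq
        where
        sound : ∀ i b → compatAt c (p i) (q i) b ≡ true →
                Compatible c (p i) (q i) × b ≡ true
        sound i b eq with p i ≟ q i | leq c (p i) | leq-reflects c (p i) | leq c (q i) | leq-reflects c (q i)
        ... | yes p≡q | _     | _       | _    | _       = inj₁ p≡q , eq
        ... | no _    | false | ofⁿ c⋢p | true | ofʸ c⊑q = inj₂ (c⋢p , c⊑q) , eq
        ... | no _    | true  | _       | _     | _      with () ← eq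
        ... | no _    | false | _       | false | _      with () ← eq

    opaque
      unfolding compat

      Compat⇒compat : ∀ {c p q} → Compat c p q → compat c p q ≡ true
      Compat⇒compat {c} {p} {q} = foldr-all⁺ {g = λ i → compatAt c (p i) (q i)} {P = λ i → Compatible c (p i) (q i)} complete id
        where
        complete : ∀ i → Compatible c (p i) (q i) →
          compatAt c (p i) (q i) true ≡ true
        complete i (inj₁ p≡q) rewrite dec-true (p i ≟ q i) p≡q = refl
        complete i (inj₂ (c⋢p , c⊑q))
          with p i ≟ q i | leq c (p i) | leq-reflects c (p i) | leq c (q i) | leq-reflects c (q i)
        ... | yes _ | _     | _       | _     | _       = refl
        ... | no _  | true  | ofʸ c⊑p | _     | _       = contradiction c⊑p c⋢p
        ... | no _  | false | _       | false | ofⁿ c⋢q = contradiction c⊑q c⋢q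
        ... | no _  | false | _       | true  | _       = refl

    Allowed : Choice → Fin n → Prof → Set
    Allowed A c q = ∀ p → Cover p c → ∀ {a} → A p ≡ just a → Compat c a q

    opaque
      unfolding allowed

      allowed⇒Allowed : ∀ {A c q} → allowed A c q ≡ true → Allowed A c q
      allowed⇒Allowed {A} {c} {q} eq = foldr-all⁻ {g = allowedBy A c q} {P = λ p → Cover p c → ∀ {a} → A p ≡ just a → Compat c a q} sound id eq
        where
        sound : ∀ p b → allowedBy A c q p b ≡ true →
                (Cover p c → ∀ {a} → A p ≡ just a → Compat c a q) × b ≡ true
        sound p b eq with cov p c in pc | A p
        ... | false | _       = (λ cover → contradiction (trans (sym pc) (Cover⇒cov cover)) λ ()) , eq
        ... | true  | nothing = (λ _ ()) , eq
        ... | true  | just a with compat c a q in ok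
        ...   | true  = (λ { _ refl → compat⇒Compat ok }) , eq
        ...   | false with () ← eq

    opaque
      unfolding allowed

      Allowed⇒allowed : ∀ {A c q} → Allowed A c q → allowed A c q ≡ true
      Allowed⇒allowed {A} {c} {q} = foldr-all⁺ {g = allowedBy A c q} {P = λ p → Cover p c → ∀ {a} → A p ≡ just a → Compat c a q} complete id
        where
        complete : ∀ p → (Cover p c → ∀ {a} → A p ≡ just a → Compat c a q) →
          allowedBy A c q p true ≡ true
        complete p ok with cov p c in pc | A p
        ... | false | _       = refl
        ... | true  | nothing = refl
        ... | true  | just a rewrite Compat⇒compat {c} {a} {q} (ok (cov⇒Cover pc) refl) = refl

    candidate : Tab → Fin n → Prof → Fin N → Maybe (Prof × ℚ)
    candidate F c p q = if compat c p (proj₁ (F c q)) then just (F c q) else nothing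

    opaque
      unfolding table

      -- A row depends only on the rows of the children, which are larger in the ancestor order. The
      -- table therefore settles along the reversed order.
      table-fixed : ∀ v q → table v q ≡ tableStep table v q
      table-fixed v q rewrite iterate≡iter n table₀ tableStep =
        Stabilise.stable (Flip.isStrictPartialOrder ⊏-isStrictPartialOrder) (λ u v → v ⊏? u)
          (λ f g → ∀ q → f q ≡ g q) tableStep local table₀ v q
        where
        local : ∀ F F′ v → (∀ u → v ⊏ u → ∀ q → F u q ≡ F′ u q) → ∀ q → tableStep F v q ≡ tableStep F′ v q
        local F F′ v agree q = cong (λ x → decode q , wt v (decode q) + x) (sum-cong-≗ children)
          where
          children : ∀ c → (if cov v c then childMin F c (decode q) else 0ℚ) ≡ (if cov v c then childMin F′ c (decode q) else 0ℚ)
          children c with cov v c in vc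
          ... | false = refl
          ... | true  = cong (maybe′ proj₂ 0ℚ) (best-cong λ q′ →
            cong (λ e → if compat c (decode q) (proj₁ e) then just e else nothing)
              (agree c (proj₁ (cov⇒Cover vc)) q′))

    value : Fin n → Fin N → ℚ
    value v q = proj₂ (table v q)

    table-profile : ∀ v q → proj₁ (table v q) ≡ decode q
    table-profile v q = cong proj₁ (table-fixed v q)

    candidate-just : ∀ {c p q} → Compat c p (decode q) → candidate table c p q ≡ just (table c q)
    candidate-just {c} {p} {q} ok rewrite table-profile c q | Compat⇒compat {c} {p} ok = refl

    just-candidate : ∀ {c p q e} → candidate table c p q ≡ just e → Compat c p (decode q) × e ≡ table c q
    just-candidate {c} {p} {q} eq with compat c p (proj₁ (table c q)) in ok | eq
    ... | true | refl = subst (Compat c p) (table-profile c q) (compat⇒Compat ok) , refl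

    childMin-least : ∀ {c p q} → Compat c p (decode q) → childMin table c p ≤ value c q
    childMin-least {c} {p} {q} ok with best-least (candidate table c p) q (candidate-just ok)
    ... | b , eq , b≤ rewrite eq = b≤

    -- The given q guarantees that there is a candidate at all, so that the minimum is not the
    -- default 0ℚ.
    childMin-attained : ∀ {c p q} → Compat c p (decode q) →
                        ∃[ q′ ] Compat c p (decode q′) × childMin table c p ≡ value c q′
    childMin-attained {c} {p} {q} ok with best-least (candidate table c p) q (candidate-just ok)
    ... | b , eq , _ with best-from (candidate table c p) eq
    ...   | q′ , eq′ with just-candidate {c} {p} {q′} eq′
    ...     | ok′ , refl rewrite eq = q′ , ok′ , refl

    option : Choice → Fin n → Fin N → Maybe (Prof × ℚ)
    option A c q = if allowed A c (proj₁ (table c q)) then just (table c q) else nothing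

    opaque
      unfolding choice allowed

      -- A choice depends only on that of the parent, which is smaller, so choices settle from the
      -- root downwards.
      choice-fixed : ∀ c → choice c ≡ choiceStep choice c
      choice-fixed c rewrite iterate≡iter n (λ _ → nothing) choiceStep =
        Stabilise.stable ⊏-isStrictPartialOrder _⊏?_ _≡_ choiceStep local (λ _ → nothing) c
        where
        local : ∀ A B c → (∀ p → p ⊏ c → A p ≡ B p) → choiceStep A c ≡ choiceStep B c
        local A B c agree = cong (maybe′ (λ e → just (proj₁ e)) nothing) (best-cong {xs = option A c} {option B c} λ q →
          cong (λ b → if b then just (table c q) else nothing) (foldr-cong (same (proj₁ (table c q))) id))
          where
          same : ∀ q p b → allowedBy A c q p b
                         ≡ allowedBy B c q p b
          same q p b with cov p c in pc
          ... | false = refl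
          ... | true  = cong (maybe′ (λ a → if compat c a q then b else false) b) (agree p (proj₁ (cov⇒Cover pc)))

    Consistent : (Fin n → Prof) → Set
    Consistent B = ∀ {p c} → Cover p c → Compat c (B p) (B c)

    Chosen : Fin n → Fin N → Set
    Chosen c q = choice c ≡ just (decode q) × Allowed choice c (decode q) ×
                 (∀ q′ → Allowed choice c (decode q′) → value c q ≤ value c q′)

    option-just : ∀ {c q} → Allowed choice c (decode q) → option choice c q ≡ just (table c q)
    option-just {c} {q} ok rewrite table-profile c q | Allowed⇒allowed {choice} {c} ok = refl

    choose : ∀ c q → Allowed choice c (decode q) → ∃[ q ] Chosen c q
    choose c q ok with best-least (option choice c) q (option-just ok)
    ... | b , eq , _ with best-from (option choice c) eq
    ...   | q₁ , eq₁ with allowed choice c (proj₁ (table c q₁)) in ok₁ | eq₁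
    ...     | true | refl = q₁ ,
      trans (choice-fixed c) (trans (cong (maybe′ (λ e → just (proj₁ e)) nothing) eq) (cong just (table-profile c q₁))) ,
      subst (Allowed choice c) (table-profile c q₁) (allowed⇒Allowed ok₁) ,
      λ q′ ok′ → let (b′ , eq′ , le) = best-least (option choice c) q′ (option-just ok′) in
        subst (λ e → proj₂ e ≤ value c q′) (just-injective (trans (sym eq′) eq)) le

    root-uncovered : ∀ {p} → ¬ Cover p r
    root-uncovered ((p≢r , p⊑r) , _) = p≢r (⊑r⇒≡ p⊑r)

    -- A child may always copy the profile of its parent, so it never runs out of allowed profiles.
    inherit : ∀ {p c q} → Cover p c → choice p ≡ just (decode q) → Allowed choice c (decode q)
    inherit {p} {c} {q} cover eq p′ cover′ {a} eq′ i = inj₁ (cong (λ x → x i) a≡q)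
      where
      a≡q : a ≡ decode q
      a≡q = just-injective (trans (sym eq′) (trans (cong choice (cover-unique branching cover′ cover)) eq))

    opaque
      chosen : ∀ c → ∃[ q ] Chosen c q
      chosen c = go (Fin.spo-wellFounded ⊏-isStrictPartialOrder c)
        where
        -- The root is unconstrained; any profile shows that it has something to choose from.
        constant : Fin N
        constant = funToFin {κ} {n} (λ _ → r)

        go : ∀ {c} → Acc _⊏_ c → ∃[ q ] Chosen c q
        go {c} (acc rec) with c ≟ r
        ... | yes refl = choose r constant λ p cover → contradiction cover root-uncovered
        ... | no c≢r = let (p , cover) = parent-of c≢r
                           (q , eq , _) = go (rec (proj₁ cover))
                       in choose c q (inherit {q = q} cover eq)

    optimum : Fin n → Fin N
    optimum c = proj₁ (chosen c)

    choice≡optimum : ∀ c → choice c ≡ just (decode (optimum c))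
    choice≡optimum c = proj₁ (proj₂ (chosen c))

    optimum-consistent : Consistent (decode ∘ optimum)
    optimum-consistent {p} {c} cover = proj₁ (proj₂ (proj₂ (chosen c))) p cover (choice≡optimum p)

    -- Table values at the root separate the two sums. The chosen profiles cost no more than the
    -- value of the root's choice, that choice is minimal in its row, and each entry of the row is a
    -- lower bound for consistent assignments that begin with it.
    optimum-least : (B : Fin n → Fin N) → Consistent (decode ∘ B) →
      sum (λ v → wt v (decode (optimum v))) ≤ sum (λ v → wt v (decode (B v)))
    optimum-least B consistent = begin
      sum (λ v → wt v (decode (optimum v)))   ≤⟨ Opt.total≤root below ⟩
      value r (optimum r)                     ≤⟨ proj₂ (proj₂ (proj₂ (chosen r))) (B r) (λ p cover → contradiction cover root-uncovered) ⟩
      value r (B r)                           ≤⟨ Any.root≤total (λ p c pc → childMin-least (consistent (cov⇒Cover pc))) ⟩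
      sum (λ v → wt v (decode (B v)))         ∎
      where
      open ≤-Reasoning

      has-parent : ∀ c → c ≢ r → ∃[ p ] cov p c ≡ true
      has-parent c c≢r = let (p , cover) = parent-of c≢r in p , Cover⇒cov cover

      unique : ∀ {p p′ c} → cov p c ≡ true → cov p′ c ≡ true → p ≡ p′
      unique pc p′c = cover-unique branching (cov⇒Cover pc) (cov⇒Cover p′c)

      root : ∀ p → cov p r ≡ false
      root p with cov p r in pr
      ... | false = refl
      ... | true  = contradiction (cov⇒Cover pr) root-uncovered

      module Total = TreeSum r cov has-parent unique root (λ v q → wt v (decode q)) value
        (λ c q → childMin table c (decode q)) (λ v q → cong proj₂ (table-fixed v q))
      module Opt = Total optimum
      module Any = Total B

      -- The minimum is attained by some profile compatible with that of the parent, and the choice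
      -- at c is cheapest among those.
      below : ∀ p c → cov p c ≡ true → value c (optimum c) ≤ childMin table c (decode (optimum p))
      below p c pc with childMin-attained {c} {decode (optimum p)} {optimum c} (optimum-consistent (cov⇒Cover pc))
      ... | q , ok , eq = subst (value c (optimum c) ≤_) (sym eq)
        (proj₂ (proj₂ (proj₂ (chosen c))) q λ p′ cover′ eq′ →
          subst (λ a → Compat c a (decode q))
            (just-injective (trans (sym (choice≡optimum p)) (trans (cong choice (unique pc (Cover⇒cov cover′))) eq′))) ok)

-- Trees given by parent pointers, and their costs.

module Forests where

  open import Defs using (Graph; cost)
  open Walks
  open TreeMetrics using (_⊹_)
  open Sums
  open import Data.Bool.Base using (Bool; true; false; if_then_else_; T)
  open import Data.Bool.Properties using (T?)
  open import Data.Fin.Base using (Fin; zero; suc)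
  open import Data.Fin.Properties using (_≟_; _<?_; <-cmp)
  open import Data.Fin.Subset using () renaming (_∈_ to _∈ˢ_)
  open import Data.List.Base as List using (List; []; _∷_; _++_; map; filter; foldr; cartesianProduct; allFin)
  open import Data.List.Membership.Propositional using (_∉_)
  open import Data.List.Relation.Unary.Any using (there)
  open import Data.List.Relation.Unary.Unique.Propositional using (Unique)
  open import Data.Maybe.Base using (Maybe; just; nothing; maybe′)
  open import Data.Maybe.Properties using (just-injective)
  open import Data.Nat.Base as ℕ using (ℕ)
  open import Data.Nat.Induction using (<-wellFounded)
  import Data.Nat.Properties as ℕ
  open import Data.Product.Base using (∃-syntax; _×_; _,_; proj₁; proj₂; uncurry)
  open import Data.Rational.Base using (ℚ; 0ℚ; _+_; _≤_)
  open import Data.Rational.Properties hiding (_≟_; _<?_; <-cmp)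
  open import Data.Sum.Base using (_⊎_; inj₁; inj₂)
  open import Data.Vec.Base using (tabulate)
  open import Data.Vec.Properties using ([]=⇒lookup; lookup⇒[]=; lookup∘tabulate)
  open import Function.Base using (_∘_; id)
  open import Induction.WellFounded using (Acc; acc)
  open import Relation.Binary.Construct.Closure.ReflexiveTransitive using (ε; _◅_; _◅◅_)
  open import Relation.Binary.Definitions using (tri<; tri≈; tri>)
  open import Relation.Binary.PropositionalEquality
  open import Relation.Nullary.Decidable using (yes; no; does; dec-true; dec-false; _×-dec_)
  open import Relation.Nullary.Negation using (¬_; contradiction)
  open import Relation.Unary using (Decidable)

  module ParentPointers {n : ℕ} (r : Fin n) (par : Fin n → Maybe (Fin n)) (level : Fin n → ℕ)
    (root : par r ≡ nothing)
    (level-decreasing : ∀ {v p} → par v ≡ just p → level p ℕ.< level v)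
    (closed : ∀ {v p} → par v ≡ just p → p ≢ r → ∃[ q ] par p ≡ just q) where

    -- These definitions repeat those of the algorithm, so that `forest` has by computation the
    -- vertices and edges that the program returns.
    member : Fin n → Bool
    member v = if does (v ≟ r) then true else maybe′ (λ _ → true) false (par v)

    isParent : Fin n → Fin n → Bool
    isParent u v = maybe′ (λ w → does (w ≟ v)) false (par u)

    edge : Fin n → Fin n → Bool
    edge u v = if isParent u v then true else isParent v u

    isParent⁻ : ∀ {u v} → isParent u v ≡ true → par u ≡ just v
    isParent⁻ {u} {v} eq with par u | eq
    ... | just w | eq′ with w ≟ v | eq′
    ...   | yes refl | _ = refl

    isParent⁺ : ∀ {u v} → par u ≡ just v → isParent u v ≡ true
    isParent⁺ {u} {v} eq rewrite eq = dec-true (v ≟ v) refl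

    edge⁻ : ∀ {u v} → T (edge u v) → par u ≡ just v ⊎ par v ≡ just u
    edge⁻ {u} {v} e with isParent u v in uv | isParent v u in vu | e
    ... | true  | _    | _ = inj₁ (isParent⁻ uv)
    ... | false | true | _ = inj₂ (isParent⁻ vu)

    edge⁺ : ∀ {u v} → par u ≡ just v ⊎ par v ≡ just u → T (edge u v)
    edge⁺ (inj₁ uv) rewrite isParent⁺ uv = _
    edge⁺ {u} {v} (inj₂ vu) rewrite isParent⁺ vu with isParent u v
    ... | true  = _
    ... | false = _

    child-member : ∀ {v p} → par v ≡ just p → member v ≡ true
    child-member {v} eq rewrite eq with does (v ≟ r)
    ... | true  = refl
    ... | false = refl

    parent-member : ∀ {v p} → par v ≡ just p → member p ≡ true
    parent-member {p = p} eq with p ≟ r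
    ... | yes _  = refl
    ... | no p≢r rewrite proj₂ (closed eq p≢r) = refl

    ∈-verts : ∀ {v} → member v ≡ true → v ∈ˢ tabulate member
    ∈-verts {v} eq = lookup⇒[]= v _ (trans (lookup∘tabulate member v) eq)

    verts-∈ : ∀ {v} → v ∈ˢ tabulate member → member v ≡ true
    verts-∈ {v} v∈ = trans (sym (lookup∘tabulate member v)) ([]=⇒lookup v∈)

    forest : Graph n
    forest = record
      { verts         = tabulate member
      ; edge?         = edge
      ; edge-sym      = λ {u} {v} e → edge⁺ {v} {u} (swap (edge⁻ {u} {v} e))
      ; edge-irrefl   = λ { {u} refl e → loop (edge⁻ {u} {u} e) }
      ; edge-incident = λ {u} {v} e → ∈-verts (incident (edge⁻ {u} {v} e))
      }
      where
      swap : ∀ {A B : Set} → A ⊎ B → B ⊎ A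
      swap (inj₁ a) = inj₂ a
      swap (inj₂ b) = inj₁ b

      loop : ∀ {u} → ¬ (par u ≡ just u ⊎ par u ≡ just u)
      loop (inj₁ eq) = ℕ.<-irrefl refl (level-decreasing eq)
      loop (inj₂ eq) = ℕ.<-irrefl refl (level-decreasing eq)

      incident : ∀ {u v} → par u ≡ just v ⊎ par v ≡ just u → member u ≡ true
      incident (inj₁ uv) = child-member uv
      incident (inj₂ vu) = parent-member vu

    open Walking forest

    -- Pointers lower the level, so following them ends. By `closed` each pointer leads to a member
    -- again, and the only member without a pointer is r.
    walk-to-root : ∀ {v} → member v ≡ true → Walk v r
    walk-to-root {v} = go (<-wellFounded (level v))
      where
      go : ∀ {v} → Acc ℕ._<_ (level v) → member v ≡ true → Walk v r
      go {v} (acc rec) eq with v ≟ r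
      ... | yes refl = ε
      ... | no _ with par v in vp | eq
      ...   | just p | _ = edge⁺ {v} {p} (inj₁ vp) ◅ go (rec (level-decreasing vp)) (parent-member vp)

    connected : Connected
    connected u∈ v∈ = proj₁ (eraseLoops (walk-to-root (verts-∈ u∈) ◅◅ reverseWalk (walk-to-root (verts-∈ v∈))))

    -- A simple walk that does not begin by going up never goes up.
    descends : ∀ {x y} (w : Walk x y) → Unique (visited w) → (∀ {a} → par x ≡ just a → a ∉ visited w) →
               level x ℕ.+ walkHops w ℕ.≤ level y
    descends {x} ε _ _ = ℕ.≤-reflexive (ℕ.+-identityʳ (level x))
    descends {x} (_◅_ {j = z} e w) simple up∉ with edge⁻ {x} {z} e
    ... | inj₁ xz = contradiction (there (source∈ w)) (up∉ xz)
    ... | inj₂ zx = ℕ.≤-trans (ℕ.≤-reflexive (ℕ.+-suc (level x) (walkHops w)))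
      (ℕ.≤-trans (ℕ.+-monoˡ-≤ (walkHops w) (level-decreasing zx))
        (descends w (tail-simple e w simple) λ za →
          subst (_∉ visited w) (just-injective (trans (sym zx) za)) (source∉tail e w simple)))

    -- A path that starts with a child of v only descends from there, but the level of u is below
    -- that of v. A path that starts with the parent of v is at u already and would have to visit it
    -- twice.
    no-long-way-up : ∀ {u v} → par v ≡ just u → (p : Path v u) → ¬ 2 ℕ.≤ hops p
    no-long-way-up vu (ε , _) ()
    no-long-way-up {u} {v} vu (_◅_ {j = z} e w , simple) 2≤ with edge⁻ {v} {z} e
    ... | inj₂ zv = ℕ.<-irrefl refl (ℕ.<-≤-trans (ℕ.<-trans (level-decreasing vu) (level-decreasing zv))
        (ℕ.≤-trans (ℕ.m≤m+n (level z) (walkHops w)) (descends w (tail-simple e w simple) λ za →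
          subst (_∉ visited w) (just-injective (trans (sym zv) za)) (source∉tail e w simple))))
    ... | inj₁ vz with just-injective (trans (sym vz) vu)
    ...   | refl with w | 2≤
    ...     | ε | ℕ.s≤s ()
    ...     | e′ ◅ w′ | _ = source∉tail e′ w′ (tail-simple e (e′ ◅ w′) simple) (target∈ w′)

    acyclic : Acyclic
    acyclic {u} {v} e p 2≤hops with edge⁻ {u} {v} e
    ... | inj₂ vu = no-long-way-up vu p 2≤hops
    ... | inj₁ uv = no-long-way-up uv (reversePath p) (subst (2 ℕ.≤_) (sym (hops-reversePath p)) 2≤hops)

    -- The root has no pointer, so a simple path from it descends all the way and gains at least one
    -- level per edge.
    hops≤level : ∀ {v} (p : Path r v) → hops p ℕ.≤ level v
    hops≤level (w , simple) = ℕ.≤-trans (ℕ.m≤n+m (walkHops w) (level r))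
      (descends w simple λ eq → contradiction (trans (sym root) eq) λ ())

  module _ {n : ℕ} (d : Fin n → Fin n → ℚ) where

    private
      listSum : ∀ {A : Set} → (A → ℚ) → List A → ℚ
      listSum f xs = foldr _+_ 0ℚ (map f xs)

      listSum-filter : ∀ {A : Set} {P : A → Set} (P? : Decidable P) (f : A → ℚ) xs →
        listSum f (filter P? xs) ≡ listSum (λ x → if does (P? x) then f x else 0ℚ) xs
      listSum-filter P? f []       = refl
      listSum-filter P? f (x ∷ xs) with does (P? x)
      ... | true  = cong (f x +_) (listSum-filter P? f xs)
      ... | false = trans (listSum-filter P? f xs) (sym (+-identityˡ _))

      listSum-++ : ∀ {A : Set} (f : A → ℚ) xs ys → listSum f (xs ++ ys) ≡ listSum f xs + listSum f ys
      listSum-++ f []       ys = sym (+-identityˡ _)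
      listSum-++ f (x ∷ xs) ys = trans (cong (f x +_) (listSum-++ f xs ys)) (sym (+-assoc (f x) (listSum f xs) (listSum f ys)))

      listSum-map : ∀ {A B : Set} (f : B → ℚ) (g : A → B) xs → listSum f (map g xs) ≡ listSum (f ∘ g) xs
      listSum-map f g []       = refl
      listSum-map f g (x ∷ xs) = cong (f (g x) +_) (listSum-map f g xs)

      listSum-× : ∀ {A B : Set} (f : A × B → ℚ) xs ys →
        listSum f (cartesianProduct xs ys) ≡ listSum (λ x → listSum (λ y → f (x , y)) ys) xs
      listSum-× f []       ys = refl
      listSum-× f (x ∷ xs) ys = trans (listSum-++ f (map (x ,_) ys) (cartesianProduct xs ys))
        (cong₂ _+_ (listSum-map f (x ,_) ys) (listSum-× f xs ys))

      listSum-tabulate : ∀ {A : Set} (f : A → ℚ) {m} (g : Fin m → A) → listSum f (List.tabulate g) ≡ sum (f ∘ g)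
      listSum-tabulate f {ℕ.zero}  g = refl
      listSum-tabulate f {ℕ.suc m} g = cong (f (g zero) +_) (listSum-tabulate f (g ∘ suc))

    edgeCost : (Fin n → Fin n → Bool) → Fin n → Fin n → ℚ
    edgeCost edge u v = if does (u <? v) then (if edge u v then d u v else 0ℚ) else 0ℚ

    -- As a double sum over ordered pairs, the cost can be compared term by term with sums over
    -- pointers.
    cost≡sum : ∀ S → cost d S ≡ sum (λ u → sum (edgeCost (Graph.edge? S) u))
    cost≡sum S = begin
      cost d S
        ≡⟨ listSum-filter (λ (u , v) → (u <? v) ×-dec T? (edge? u v)) (uncurry d) (cartesianProduct (allFin n) (allFin n)) ⟩
      listSum contribution (cartesianProduct (allFin n) (allFin n))
        ≡⟨ listSum-× contribution (allFin n) (allFin n) ⟩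
      listSum (λ u → listSum (λ v → contribution (u , v)) (allFin n)) (allFin n)
        ≡⟨ listSum-tabulate (λ u → listSum (λ v → contribution (u , v)) (allFin n)) id ⟩
      sum (λ u → listSum (λ v → contribution (u , v)) (allFin n))
        ≡⟨ sum-cong-≗ (λ u → trans (listSum-tabulate (λ v → contribution (u , v)) id) (sum-cong-≗ (nested u))) ⟩
      sum (λ u → sum (edgeCost edge? u)) ∎
      where
      open ≡-Reasoning
      open Graph S using (edge?)

      contribution : Fin n × Fin n → ℚ
      contribution (u , v) = if does ((u <? v) ×-dec T? (edge? u v)) then d u v else 0ℚ

      nested : ∀ u v → contribution (u , v) ≡ edgeCost edge? u v
      nested u v with does (u <? v)
      ... | false = refl
      ... | true with edge? u v
      ...   | true  = refl
      ...   | false = refl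

    pointerCost : (Fin n → Maybe (Fin n)) → Fin n → Fin n → ℚ
    pointerCost par u v = if maybe′ (λ w → does (w ≟ v)) false (par u) then d u v else 0ℚ

    pointerCost-just : ∀ par {u v} → par u ≡ just v → pointerCost par u v ≡ d u v
    pointerCost-just par {u} {v} eq rewrite eq | dec-true (v ≟ v) refl = refl

    pointerCost-other : ∀ par {u v} → par u ≢ just v → pointerCost par u v ≡ 0ℚ
    pointerCost-other par {u} {v} neq with par u
    ... | nothing = refl
    ... | just w with w ≟ v
    ...   | yes refl = contradiction refl neq
    ...   | no _     = refl

    -- Each pointer is charged to its unordered pair of endpoints, listed with the smaller one
    -- first. Pointers to smaller vertices get there by exchanging the sums, and the diagonal
    -- vanishes by irreflexivity.
    sum-pointerCost : ∀ par → (∀ {u} → par u ≢ just u) →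
      sum (λ u → maybe′ (d u) 0ℚ (par u)) ≡
      sum (λ u → sum (λ v → if does (u <? v) then pointerCost par u v + pointerCost par v u else 0ℚ))
    sum-pointerCost par irreflexive = begin
      sum (λ u → maybe′ (d u) 0ℚ (par u))
        ≡⟨ sum-cong-≗ row ⟩
      sum (λ u → sum (λ v → g u v))
        ≡⟨ sum-cong-≗ (λ u → sum-cong-≗ (trichotomy u)) ⟩
      sum (λ u → sum (λ v → up u v + down u v))
        ≡⟨ sum-cong-≗ (λ u → ∑-distrib-+ (up u) (down u)) ⟩
      sum (λ u → sum (up u) + sum (down u))
        ≡⟨ ∑-distrib-+ (λ u → sum (up u)) (λ u → sum (down u)) ⟩
      sum (λ u → sum (up u)) + sum (λ u → sum (down u))
        ≡⟨ cong (sum (λ u → sum (up u)) +_) (∑-comm down) ⟩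
      sum (λ u → sum (up u)) + sum (λ u → sum (λ v → down v u))
        ≡⟨ ∑-distrib-+ (λ u → sum (up u)) (λ u → sum (λ v → down v u)) ⟨
      sum (λ u → sum (up u) + sum (λ v → down v u))
        ≡⟨ sum-cong-≗ (λ u → trans (sym (∑-distrib-+ (up u) (λ v → down v u))) (sum-cong-≗ (merge u))) ⟩
      sum (λ u → sum (λ v → if does (u <? v) then g u v + g v u else 0ℚ)) ∎
      where
      open ≡-Reasoning

      g up down : Fin n → Fin n → ℚ
      g = pointerCost par
      up u v   = if does (u <? v) then g u v else 0ℚ
      down u v = if does (v <? u) then g u v else 0ℚ

      row : ∀ u → maybe′ (d u) 0ℚ (par u) ≡ sum (λ v → g u v)
      row u with par u in eq
      ... | nothing = sym (sum-zero {n} λ v → refl)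
      ... | just p  = sym (trans (sum-single p λ v v≢p → cong (λ b → if b then d u v else 0ℚ) (dec-false (p ≟ v) (v≢p ∘ sym)))
        (cong (λ b → if b then d u p else 0ℚ) (dec-true (p ≟ p) refl)))

      trichotomy : ∀ u v → g u v ≡ up u v + down u v
      trichotomy u v with <-cmp u v
      ... | tri< u<v _ v≮u rewrite dec-true (u <? v) u<v | dec-false (v <? u) v≮u = sym (+-identityʳ _)
      ... | tri> u≮v _ v<u rewrite dec-false (u <? v) u≮v | dec-true (v <? u) v<u = sym (+-identityˡ _)
      ... | tri≈ u≮v refl _ rewrite dec-false (u <? u) u≮v = trans (pointerCost-other par irreflexive) (sym (+-identityˡ _))

      merge : ∀ u v → up u v + down v u ≡ (if does (u <? v) then g u v + g v u else 0ℚ)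
      merge u v with does (u <? v)
      ... | true  = refl
      ... | false = +-identityˡ _

    module _ (d-sym : ∀ u v → d u v ≡ d v u) (0≤d : ∀ {u v} → 0ℚ ≤ d u v)
      (S : Graph n) (par : Fin n → Maybe (Fin n)) (irreflexive : ∀ {u} → par u ≢ just u) where

      open Graph S using (edge?; Edge; edge-sym)

      0≤pointerCost : ∀ u v → 0ℚ ≤ pointerCost par u v
      0≤pointerCost u v with maybe′ (λ w → does (w ≟ v)) false (par u)
      ... | true  = 0≤d
      ... | false = ≤-refl

      cost≤pointers : (∀ {u v} → Edge u v → par u ≡ just v ⊎ par v ≡ just u) →
                      cost d S ≤ sum (λ u → maybe′ (d u) 0ℚ (par u))
      cost≤pointers covered rewrite cost≡sum S | sum-pointerCost par irreflexive = sum-mono λ u → sum-mono (bound u)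
        where
        bound : ∀ u v → edgeCost edge? u v ≤ (if does (u <? v) then pointerCost par u v + pointerCost par v u else 0ℚ)
        bound u v with does (u <? v)
        ... | false = ≤-refl
        ... | true with edge? u v in e
        ...   | false = 0≤pointerCost u v ⊹ 0≤pointerCost v u
        ...   | true with covered (subst T (sym e) _)
        ...     | inj₁ uv rewrite pointerCost-just par uv = ≤-trans (≤-reflexive (sym (+-identityʳ _))) (+-monoʳ-≤ (d u v) (0≤pointerCost v u))
        ...     | inj₂ vu rewrite pointerCost-just par vu | d-sym v u = ≤-trans (≤-reflexive (sym (+-identityˡ _))) (+-monoˡ-≤ (d u v) (0≤pointerCost u v))

      -- Antisymmetry ensures that no edge has to pay for two pointers.
      pointers≤cost : (∀ {u v} → par u ≡ just v → Edge u v) → (∀ {u v} → par u ≡ just v → par v ≢ just u) →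
                      sum (λ u → maybe′ (d u) 0ℚ (par u)) ≤ cost d S
      pointers≤cost edges antisymmetric rewrite cost≡sum S | sum-pointerCost par irreflexive = sum-mono λ u → sum-mono (bound u)
        where
        pays : ∀ {u v} → Edge u v → d u v ≤ (if edge? u v then d u v else 0ℚ)
        pays {u} {v} e with edge? u v
        ... | true = ≤-refl

        0≤edge : ∀ u v → 0ℚ ≤ (if edge? u v then d u v else 0ℚ)
        0≤edge u v with edge? u v
        ... | true  = 0≤d
        ... | false = ≤-refl

        none : ∀ {u v} → pointerCost par u v ≡ 0ℚ ⊎ par u ≡ just v
        none {u} {v} with maybe′ (λ w → does (w ≟ v)) false (par u) in eq
        ... | false = inj₁ refl
        ... | true with par u | eq
        ...   | just w | eq′ with w ≟ v
        ...     | yes refl = inj₂ refl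

        bound : ∀ u v → (if does (u <? v) then pointerCost par u v + pointerCost par v u else 0ℚ) ≤ edgeCost edge? u v
        bound u v with does (u <? v)
        ... | false = ≤-refl
        ... | true with none {u} {v} | none {v} {u}
        ...   | inj₁ uv₀ | inj₁ vu₀ rewrite uv₀ | vu₀ = 0≤edge u v
        ...   | inj₂ uv  | _ rewrite pointerCost-just par uv | pointerCost-other par (antisymmetric uv) =
          ≤-trans (≤-reflexive (+-identityʳ _)) (pays (edges uv))
        ...   | inj₁ uv₀ | inj₂ vu rewrite uv₀ | pointerCost-just par vu | d-sym v u =
          ≤-trans (≤-reflexive (+-identityˡ _)) (pays (edge-sym (edges vu)))

-- From consistent profiles to a hop-constrained Steiner tree.

module Solutions where

  open import Defs using (Graph; WeightedGraph; Induces; IsHopSteinerTree; cost)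
  open SteinerAlgorithm using (module Algorithm)
  open TreeMetrics
  open ShortestPaths using (adjacency)
  open Sums
  open Optimality
  open Forests
  open import Data.Bool.Base using (Bool; true; false; if_then_else_)
  open import Data.Fin.Base using (Fin; zero; suc; toℕ)
  open import Data.Fin.Properties using (_≟_)
  import Data.Fin.Induction as Fin
  open import Data.Fin.Subset using (Subset) renaming (_∈_ to _∈ˢ_)
  open import Data.Maybe.Base using (Maybe; just; nothing; maybe′)
  open import Data.Nat.Base as ℕ using (ℕ; z≤n; s≤s)
  import Data.Nat.Properties as ℕ
  open import Data.Product.Base using (∃-syntax; _×_; _,_; proj₁; proj₂)
  open import Data.Rational.Base using (ℚ; 0ℚ; _≤_)
  open import Data.Sum.Base using (_⊎_; inj₁; inj₂; [_,_]′)
  open import Data.Vec.Functional as Vector using (Vector)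
  open import Function.Base using (_∘_; id)
  open import Function.Metric.Rational using (IsMetric)
  open import Induction.WellFounded using (Acc; acc)
  open import Relation.Binary.PropositionalEquality
  open import Relation.Nullary.Decidable using (Dec; yes; no; does; dec-true; dec-false)
  open import Relation.Nullary.Negation using (¬_; contradiction)

  -- Without an occurrence the position is m, one past the last index. The preceding entry is then
  -- the last one, as it should be for the parent.
  position : ∀ {n m} → Fin n → Vector (Fin n) m → ℕ
  position {m = ℕ.zero}  v q = 0
  position {m = ℕ.suc m} v q = if does (q zero ≟ v) then 0 else ℕ.suc (position v (q ∘ suc))

  position≤ : ∀ {n m v} (q : Vector (Fin n) m) i → q i ≡ v → position v q ℕ.≤ toℕ i
  position≤ {v = v} q zero    eq rewrite dec-true (q zero ≟ v) eq = z≤n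
  position≤ {v = v} q (suc i) eq with does (q zero ≟ v)
  ... | true  = z≤n
  ... | false = s≤s (position≤ (q ∘ suc) i eq)

  position-max : ∀ {n m} v (q : Vector (Fin n) m) → position v q ℕ.≤ m
  position-max {m = ℕ.zero}  v q = z≤n
  position-max {m = ℕ.suc m} v q with does (q zero ≟ v)
  ... | true  = z≤n
  ... | false = s≤s (position-max v (q ∘ suc))

  override≢nothing : ∀ {A : Set} (x : A) s → maybe′ just (just x) s ≢ nothing
  override≢nothing x nothing  ()
  override≢nothing x (just _) ()

  module _ {n κ : ℕ} (adj : Fin n → Fin n → Maybe ℚ) (X : Fin n → Bool) (r : Fin n) where

    open Algorithm {n} {κ} adj X r using (scan; parent)

    opaque
      unfolding parent

      -- Putting r in front of the profile makes level 0 an ordinary entry, which absorbs both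
      -- special cases of `parent`.
      parent-scan : ∀ v p → parent v p ≡ maybe′ id nothing (scan v (r Vector.∷ p))
      parent-scan v p with v ≟ r
      ... | yes v≡r rewrite dec-true (r ≟ v) (sym v≡r) = refl
      ... | no v≢r rewrite dec-false (r ≟ v) (v≢r ∘ sym) with scan v p
      ...   | nothing = refl
      ...   | just s  = refl

    -- These are the two reasons why the entry at j becomes the parent of v. In the tree from which
    -- profiles are read off later, either one bounds the depth of v by j + 1.
    Follows : ∀ {m} → Fin n → Vector (Fin n) m → Fin m → Set
    Follows {m} v q j = (ℕ.suc (toℕ j) ≡ m × X v ≡ true) ⊎ ∃[ i ] toℕ i ≡ ℕ.suc (toℕ j) × q i ≡ v

    scan-just : ∀ {m v p} (q : Vector (Fin n) (ℕ.suc m)) → scan v q ≡ just (just p) →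
                ∃[ j ] p ≡ q j × q zero ≢ v × ℕ.suc (toℕ j) ≡ position v q × Follows v q j
    scan-just {m} {v} q eq with q zero ≟ v
    scan-just {ℕ.zero} {v} q eq | no q₀≢v with X v | eq
    ... | true | refl = zero , refl , q₀≢v , refl , inj₁ (refl , refl)
    scan-just {ℕ.suc m} {v} q eq | no q₀≢v with scan v (q ∘ suc) in eq′
    -- The outcome `nothing` means that the next entry is v, since any other entry would have
    -- overridden it.
    scan-just {ℕ.suc m} {v} q refl | no q₀≢v | nothing with q (suc zero) ≟ v
    ... | yes q₁≡v = zero , refl , q₀≢v , refl , inj₂ (suc zero , refl , q₁≡v)
    ... | no _ = contradiction eq′ (override≢nothing (just (q (suc zero))) (scan v (λ i → q (suc (suc i)))))
    scan-just {ℕ.suc m} {v} q refl | no q₀≢v | just (just p) with scan-just (q ∘ suc) eq′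
    ... | j , p≡ , _ , pos , inj₁ (last , x) = suc j , p≡ , q₀≢v , cong ℕ.suc pos , inj₁ (cong ℕ.suc last , x)
    ... | j , p≡ , _ , pos , inj₂ (i , i≡ , qi≡v) = suc j , p≡ , q₀≢v , cong ℕ.suc pos , inj₂ (suc i , cong ℕ.suc i≡ , qi≡v)

    Reaches : ∀ {m} → Fin n → Vector (Fin n) m → Set
    Reaches v q = X v ≡ true ⊎ ∃[ i ] q i ≡ v

    scan-reaches : ∀ {m v} (q : Vector (Fin n) m) → Reaches v q → scan v q ≢ just nothing
    scan-reaches {ℕ.zero}  {v} q (inj₁ x) eq rewrite x with () ← eq
    scan-reaches {ℕ.suc m} {v} q reach eq with q zero ≟ v
    scan-reaches {ℕ.suc m} {v} q reach () | yes _
    ... | no q₀≢v with scan v (q ∘ suc) in eq′ | eq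
    ...   | just nothing | _ = scan-reaches (q ∘ suc) (later reach) eq′
      where
      later : Reaches v q → Reaches v (q ∘ suc)
      later (inj₁ x)            = inj₁ x
      later (inj₂ (zero , q≡))  = contradiction q≡ q₀≢v
      later (inj₂ (suc i , q≡)) = inj₂ (i , q≡)

    parent-just : ∀ {v p} (q : Vector (Fin n) κ) → parent v q ≡ just p →
      ∃[ j ] p ≡ (r Vector.∷ q) j × r ≢ v × ℕ.suc (toℕ j) ≡ position v (r Vector.∷ q) × Follows v (r Vector.∷ q) j
    parent-just {v} q eq with scan v (r Vector.∷ q) in eq′ | trans (sym (parent-scan v q)) eq
    ... | just (just p) | refl = scan-just (r Vector.∷ q) eq′

    parent-reaches : ∀ {v} (q : Vector (Fin n) κ) → v ≢ r → Reaches v (r Vector.∷ q) → ∃[ p ] parent v q ≡ just p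
    parent-reaches {v} q v≢r reach with scan v (r Vector.∷ q) in eq
    ... | just nothing  = contradiction eq (scan-reaches (r Vector.∷ q) reach)
    ... | just (just p) = p , trans (parent-scan v q) (cong (maybe′ id nothing) eq)
    ... | nothing rewrite dec-false (r ≟ v) (v≢r ∘ sym) with scan v q | eq
    ...   | nothing | ()
    ...   | just _  | ()

  module Solution {n : ℕ} (d : Fin n → Fin n → ℚ) (isMetric : IsMetric _≡_ d)
    (G : WeightedGraph n) (induces : Induces G d) (κ : ℕ) (X : Fin n → Bool) (r : Fin n)
    (branching : RootedMetric.Branching d isMetric r) where

    open DynamicProgram d isMetric G induces κ X r branching public

    private
      adj = adjacency G

    module _ (B : Fin n → Prof) (consistent : Consistent B) where

      private
        q : Fin n → Fin (ℕ.suc κ) → Fin n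
        q v = r Vector.∷ B v

        q-consistent : ∀ {p c} → Cover p c → ∀ i → Compatible c (q p i) (q c i)
        q-consistent cover zero    = inj₁ refl
        q-consistent cover (suc i) = consistent cover i

      -- An entry w of v's profile is propagated unchanged along the tree path
      -- from v to w.
      genuine : ∀ i {v w} → q v i ≡ w → q w i ≡ w
      genuine i {v} {w} = upwards {v} {w} (Fin.spo-wellFounded ⊏-isStrictPartialOrder v) (v ⊑? w)
        where
        downwards : ∀ {v w} → Acc (λ x y → y ⊏ x) v → v ⊑ w → Dec (v ≡ w) → q v i ≡ w → q w i ≡ w
        downwards {v} {w} _         v⊑w (yes refl) eq = eq
        downwards {v} {w} (acc rec) v⊑w (no v≢w)   eq = [ shared , outside ]′ (q-consistent {v} {c} cover i)
          where
          child = child-towards (v≢w , v⊑w)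
          c     = proj₁ child
          cover = proj₁ (proj₂ child)
          c⊑w   = proj₂ (proj₂ child)

          shared : q v i ≡ q c i → q w i ≡ w
          shared same = downwards {c} {w} (rec (proj₁ cover)) c⊑w (c ≟ w) (trans (sym same) eq)

          outside : ¬ c ⊑ q v i × c ⊑ q c i → q w i ≡ w
          outside (c⋢ , _) = contradiction (subst (c ⊑_) (sym eq) c⊑w) c⋢

        upwards : ∀ {v w} → Acc _⊏_ v → Dec (v ⊑ w) → q v i ≡ w → q w i ≡ w
        upwards {v} {w} _         (yes v⊑w) eq =
          downwards {v} {w} (Fin.spo-noetherian ⊏-isStrictPartialOrder v) v⊑w (v ≟ w) eq
        upwards {v} {w} (acc rec) (no v⋢w)  eq = [ shared , inside ]′ (q-consistent {p} {v} cover i)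
          where
          v≢r : v ≢ r
          v≢r v≡r = v⋢w (subst (_⊑ w) (sym v≡r) r⊑)

          p     = proj₁ (parent-of v≢r)
          cover = proj₂ (parent-of v≢r)

          shared : q p i ≡ q v i → q w i ≡ w
          shared same = upwards {p} {w} (rec (proj₁ cover)) (p ⊑? w) (trans same eq)

          inside : ¬ v ⊑ q p i × v ⊑ q v i → q w i ≡ w
          inside (_ , v⊑) = contradiction (subst (v ⊑_) eq v⊑) v⋢w

      level : Fin n → ℕ
      level v = position v (q v)

      pointer : Fin n → Maybe (Fin n)
      pointer v = parent v (B v)

      pointer-root : pointer r ≡ nothing
      pointer-root = trans (parent-scan adj X r r (B r))
        (cong (λ b → maybe′ id nothing (if b then nothing else maybe′ just (just (just r)) (scan r (B r)))) (dec-true (r ≟ r) refl))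

      -- The parent is the entry at some index j with j + 1 equal to the level of v. By `genuine` it
      -- occurs at the same index j of its own profile, so its level is at most j.
      level-decreasing : ∀ {v p} → pointer v ≡ just p → level p ℕ.< level v
      level-decreasing {v} eq with parent-just adj X r (B v) eq
      ... | j , refl , _ , pos , _ = subst (level (q v j) ℕ.<_) pos (s≤s (position≤ (q (q v j)) j (genuine j {v} refl)))

      -- By `genuine` a parent occurs in its own profile, and this makes it a member of the tree.
      pointer-closed : ∀ {v p} → pointer v ≡ just p → p ≢ r → ∃[ p′ ] pointer p ≡ just p′
      pointer-closed {v} eq p≢r with parent-just adj X r (B v) eq
      ... | j , refl , _ = parent-reaches adj X r (B (q v j)) p≢r (inj₂ (j , genuine j {v} refl))

      level≤ : ∀ v → level v ℕ.≤ ℕ.suc κ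
      level≤ v = position-max v (q v)

      terminal-pointer : ∀ {v} → X v ≡ true → v ≢ r → ∃[ p ] pointer v ≡ just p
      terminal-pointer {v} x v≢r = parent-reaches adj X r (B v) v≢r (inj₁ x)

    par-optimum : ∀ v → par v ≡ parent v (decode (optimum v))
    par-optimum v rewrite choice≡optimum v = refl

    private
      module P where
        B = decode ∘ optimum
        root : par r ≡ nothing
        root = trans (par-optimum r) (pointer-root B optimum-consistent)
        decreasing : ∀ {v p} → par v ≡ just p → level B optimum-consistent p ℕ.< level B optimum-consistent v
        decreasing {v} eq = level-decreasing B optimum-consistent (trans (sym (par-optimum v)) eq)
        closed : ∀ {v p} → par v ≡ just p → p ≢ r → ∃[ p′ ] par p ≡ just p′
        closed {v} {p} eq p≢r = let (p′ , eq′) = pointer-closed B optimum-consistent (trans (sym (par-optimum v)) eq) p≢r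
          in p′ , trans (par-optimum p) eq′

    open ParentPointers r par (level P.B optimum-consistent) P.root P.decreasing P.closed
      hiding (member; edge; isParent)

    solution : Graph n
    solution = forest

    solution-feasible : ∀ {Xs : Subset n} → (∀ {v} → v ∈ˢ Xs → X v ≡ true) →
                        IsHopSteinerTree Xs r (ℕ.suc κ) solution
    solution-feasible X-spec = record
      { isTree    = connected , acyclic
      ; terminals = λ {v} v∈ → ∈-verts (terminal v (X-spec v∈))
      ; hop-bound = λ {v} _ p → ℕ.≤-trans (hops≤level p) (level≤ P.B optimum-consistent v)
      }
      where
      terminal : ∀ v → X v ≡ true → member v ≡ true
      terminal v x with v ≟ r
      ... | yes _  = refl
      ... | no v≢r rewrite trans (par-optimum v) (proj₂ (terminal-pointer P.B optimum-consistent x v≢r)) = refl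

    solution-cost : cost d solution ≤ sum (λ v → wt v (decode (optimum v)))
    solution-cost = subst (cost d solution ≤_)
      (sum-cong-≗ λ v → trans (cong (maybe′ (d v) 0ℚ) (par-optimum v)) (sym (wt≡ v (decode (optimum v)))))
      (cost≤pointers d d-sym 0≤d solution par (λ eq → ℕ.<-irrefl refl (P.decreasing eq)) (λ {u} {v} → edge⁻ {u} {v}))

-- From a hop-constrained Steiner tree to consistent profiles.

module LowerBounds where

  open import Defs using (Graph; WeightedGraph; Induces; IsHopSteinerTree; cost)
  open Walks
  open TreeMetrics
  open ShortestPaths using (adjacency)
  open Sums
  open Optimality
  open Forests
  open Solutions
  open import Data.Bool.Base using (Bool; true)
  open import Data.Fin.Base using (Fin; zero; suc; toℕ; funToFin)
  open import Data.Fin.Properties using (any?; toℕ-injective; finToFun-funToFin)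
  open import Data.Fin.Subset using (Subset) renaming (_∈_ to _∈ˢ_)
  open import Data.Fin.Subset.Properties using () renaming (_∈?_ to _∈ˢ?_)
  open import Data.List.Relation.Unary.All using ([])
  open import Data.List.Relation.Unary.AllPairs using ([]; _∷_)
  open import Data.Maybe.Base using (Maybe; just; nothing; maybe′)
  open import Data.Nat.Base as ℕ using (ℕ; z≤n; s≤s)
  import Data.Nat.Properties as ℕ
  open import Data.Product.Base using (∃-syntax; _×_; _,_; proj₁; proj₂)
  open import Data.Rational.Base using (ℚ; 0ℚ; _≤_)
  open import Data.Rational.Properties using (≤-refl; ≤-trans; ≤-reflexive; ≤-total; _≤?_; module ≤-Reasoning)
  open import Data.Rational.Solver using (module +-*-Solver)
  open import Data.Sum.Base using (_⊎_; inj₁; inj₂; [_,_]′)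
  open import Data.Vec.Functional as Vector using (Vector)
  open import Function.Base using (_∘_; id)
  open import Function.Metric.Rational using (IsMetric)
  open import Relation.Binary.Construct.Closure.ReflexiveTransitive using (ε; _◅_)
  open import Relation.Binary.PropositionalEquality
  open import Relation.Nullary.Decidable using (Dec; yes; no; _×-dec_)
  open import Relation.Nullary.Negation using (¬_; contradiction)
  open import Relation.Unary using (Decidable)

  -- The implication picks the smallest index among the minimisers, which makes w unique.
  Least : ∀ {n} → (Fin n → Set) → (Fin n → ℚ) → Fin n → Set
  Least P f w = P w × (∀ u → P u → f w ≤ f u × (f u ≤ f w → toℕ w ℕ.≤ toℕ u))

  least : ∀ {n} {P : Fin n → Set} → Decidable P → (f : Fin n → ℚ) → ∃[ w ] P w → ∃[ w ] Least P f w
  least {ℕ.suc n} {P} P? f (x , Px) with any? (P? ∘ suc)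
  ... | no ∄P = zero , P0 x Px , λ
    { zero    _  → ≤-refl , λ _ → z≤n
    ; (suc u) Pu → contradiction (u , Pu) ∄P }
    where
    P0 : ∀ x → P x → P zero
    P0 zero    Px = Px
    P0 (suc x) Px = contradiction (x , Px) ∄P
  ... | yes ∃P = choose (P? zero) (f zero ≤? f (suc w))
    where
    tail = least (P? ∘ suc) (f ∘ suc) ∃P
    w = proj₁ tail
    Pw = proj₁ (proj₂ tail)
    w-least = proj₂ (proj₂ tail)

    later : (∀ u → P u → u ≡ zero → f (suc w) ≤ f u × ¬ f u ≤ f (suc w)) → Least P f (suc w)
    later first = Pw , λ
      { zero    P0 → proj₁ (first zero P0 refl) , λ f0≤ → contradiction f0≤ (proj₂ (first zero P0 refl))
      ; (suc u) Pu → proj₁ (w-least u Pu) , λ fu≤ → s≤s (proj₂ (w-least u Pu) fu≤) }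

    choose : Dec (P zero) → Dec (f zero ≤ f (suc w)) → ∃[ w ] Least P f w
    choose (yes P0) (yes f0≤) = zero , P0 , λ
      { zero    _  → ≤-refl , λ _ → z≤n
      ; (suc u) Pu → ≤-trans f0≤ (proj₁ (w-least u Pu)) , λ _ → z≤n }
    choose (no ¬P0) _ = suc w , later λ { zero P0 refl → contradiction P0 ¬P0 }
    choose (yes P0) (no f0≰) = suc w , later λ { zero _ refl → [ (λ f0≤ → contradiction f0≤ f0≰) , id ]′ (≤-total _ _) , f0≰ }

  module HopTree {n : ℕ} {Xs : Subset n} {r : Fin n} (r∈Xs : r ∈ˢ Xs) {k : ℕ} (S : Graph n)
    (hopTree : IsHopSteinerTree Xs r k S) where

    open Walking S
    open IsHopSteinerTree hopTree

    private
      connected = proj₁ isTree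
      acyclic   = proj₂ isTree

      r∈ : r ∈ˢ verts
      r∈ = terminals r∈Xs

      trivial : ∀ {u} → Path u u
      trivial = ε , [] ∷ []

      first : ∀ {v} → Path v r → Maybe (Fin n)
      first (ε , _)             = nothing
      first (_◅_ {j = j} e w , _) = just j

    pointer′ : ∀ {v} → Dec (v ∈ˢ verts) → Maybe (Fin n)
    pointer′ (yes v∈) = first (connected v∈ r∈)
    pointer′ (no _)   = nothing

    -- The depth of a vertex outside of the tree is a junk value.
    depth′ : ∀ {v} → Dec (v ∈ˢ verts) → ℕ
    depth′ (yes v∈) = hops (connected v∈ r∈)
    depth′ (no _)   = 0

    pointer : Fin n → Maybe (Fin n)
    pointer v = pointer′ (v ∈ˢ? verts)

    depth : Fin n → ℕ
    depth v = depth′ (v ∈ˢ? verts)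

    -- In a tree the number of hops is independent of the path, so the path chosen by `connected`
    -- does not matter.
    depth-path : ∀ {v} → v ∈ˢ verts → (p : Path v r) → depth v ≡ hops p
    depth-path {v} v∈ p with v ∈ˢ? verts
    ... | yes v∈′ = hops-unique acyclic (connected v∈′ r∈) p
    ... | no v∉   = contradiction v∈ v∉

    depth-root : depth r ≡ 0
    depth-root = depth-path r∈ trivial

    depth≤k : ∀ {v} → v ∈ˢ verts → depth v ℕ.≤ k
    depth≤k v∈ = subst (ℕ._≤ k) (trans (hops-reversePath p) (sym (depth-path v∈ p))) (hop-bound v∈ (reversePath p))
      where p = connected v∈ r∈

    depth≡0 : ∀ {v} → v ∈ˢ verts → depth v ℕ.≤ 0 → v ≡ r
    depth≡0 v∈ depth≤0 = go (connected v∈ r∈) (subst (ℕ._≤ 0) (depth-path v∈ (connected v∈ r∈)) depth≤0)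
      where
      go : ∀ {v} (p : Path v r) → hops p ℕ.≤ 0 → v ≡ r
      go (ε , _) _ = refl

    pointer-step : ∀ v {j} → pointer v ≡ just j → Edge v j × j ∈ˢ verts × depth v ≡ ℕ.suc (depth j)
    pointer-step v eq with v ∈ˢ? verts
    ... | yes v∈ with connected v∈ r∈ | eq
    ...   | (e ◅ w , simple) | refl = e , j∈ , cong ℕ.suc (sym (depth-path j∈ (w , tail-simple e w simple)))
      where j∈ = edge-incident (edge-sym e)

    pointer-exists : ∀ {v} → v ∈ˢ verts → v ≢ r → ∃[ j ] pointer v ≡ just j
    pointer-exists {v} v∈ v≢r with v ∈ˢ? verts
    ... | no v∉  = contradiction v∈ v∉
    ... | yes v∈′ with connected v∈′ r∈
    ...   | (ε , _)     = contradiction refl v≢r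
    ...   | (e ◅ w , _) = _ , refl

    Shallow : ℕ → Fin n → Set
    Shallow i w = w ∈ˢ verts × depth w ℕ.≤ i

    shallow? : ∀ i → Decidable (Shallow i)
    shallow? i w = w ∈ˢ? verts ×-dec depth w ℕ.≤? i

    root-shallow : ∀ i → Shallow i r
    root-shallow i = r∈ , subst (ℕ._≤ i) (sym depth-root) z≤n

  module LowerBound {n : ℕ} (d : Fin n → Fin n → ℚ) (isMetric : IsMetric _≡_ d)
    (G : WeightedGraph n) (induces : Induces G d) (κ : ℕ) (X : Fin n → Bool) (r : Fin n)
    (branching : RootedMetric.Branching d isMetric r)
    {Xs : Subset n} (X-spec : ∀ {v} → X v ≡ true → v ∈ˢ Xs) (r∈Xs : r ∈ˢ Xs)
    (S : Graph n) (hopTree : IsHopSteinerTree Xs r (ℕ.suc κ) S) where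

    open Solution d isMetric G induces κ X r branching hiding (pointer)
    open HopTree r∈Xs S hopTree
    open IsHopSteinerTree hopTree using (terminals)
    open Graph S using (verts; Edge; edge-irrefl)
    open +-*-Solver using (solve; _:+_; _:=_)

    Nearest : ℕ → Fin n → Fin n → Set
    Nearest i v = Least (Shallow i) (d v)

    nearest : ∀ i v → ∃[ w ] Nearest i v w
    nearest i v = least (shallow? i) (d v) (r , root-shallow i)

    -- Entry i of a profile belongs to level i + 1, as level 0 is always r.
    index : Fin n → Fin N
    index v = funToFin {κ} {n} (λ i → proj₁ (nearest (ℕ.suc (toℕ i)) v))

    private
      q : Fin n → Fin (ℕ.suc κ) → Fin n
      q v = r Vector.∷ decode (index v)

    q-nearest : ∀ v i → Nearest (toℕ i) v (q v i)
    -- The root is the only vertex of depth 0, so there is nothing to compare with.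
    q-nearest v zero = root-shallow 0 , λ u (u∈ , depth≤) →
      ≤-reflexive (cong (d v) (sym (depth≡0 u∈ depth≤))) , λ _ → ℕ.≤-reflexive (cong toℕ (sym (depth≡0 u∈ depth≤)))
    q-nearest v (suc i) = subst (Nearest (ℕ.suc (toℕ i)) v)
      (sym (finToFun-funToFin {κ} {n} (λ i → proj₁ (nearest (ℕ.suc (toℕ i)) v)) i)) (proj₂ (nearest (ℕ.suc (toℕ i)) v))

    -- Ties are broken by index, so that equally near vertices coincide.
    nearest-tie : ∀ {i p c x y} → Nearest i p x → Nearest i c y → d p y ≤ d p x → d c x ≤ d c y → x ≡ y
    nearest-tie {x = x} {y} (x∈ , x-least) (y∈ , y-least) py≤px cx≤cy =
      toℕ-injective (ℕ.≤-antisym (proj₂ (x-least y y∈) py≤px) (proj₂ (y-least x x∈) cx≤cy))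

    -- If x lies in the subtree of c, the way from p to x leads through c, so x and y are equally
    -- near to both p and c. If y lies outside, the way from c to y leads through p, with the same
    -- effect. In the remaining case x is outside and y inside.
    nearest-compatible : ∀ {i p c x y} → Cover p c → Nearest i p x → Nearest i c y →
                         Dec (c ⊑ x) → Dec (c ⊑ y) → Compatible c x y
    nearest-compatible {p = p} {c} {x} {y} cover near-x near-y (yes c⊑x) _ =
      inj₁ (nearest-tie near-x near-y
        (linear (tri p c y ⊹ cy≤cx ⊹ pcx)
          (solve 5 (λ py px pc cy cx → py :+ ((pc :+ cy) :+ cx :+ px) := px :+ (py :+ cy :+ (pc :+ cx)))
            refl (d p y) (d p x) (d p c) (d c y) (d c x)))
        (linear (pcx ⊹ px≤py ⊹ tri p c y)
          (solve 5 (λ py px pc cy cx → cx :+ (px :+ py :+ (pc :+ cy)) := cy :+ ((pc :+ cx) :+ px :+ py))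
            refl (d p y) (d p x) (d p c) (d c y) (d c x))))
      where
      cy≤cx = proj₁ (proj₂ near-y x (proj₁ near-x))
      px≤py = proj₁ (proj₂ near-x y (proj₁ near-y))
      pcx   = ⊑⇒between (proj₂ (proj₁ cover)) c⊑x
    nearest-compatible {p = p} {c} {x} {y} cover near-x near-y (no _) (no c⋢y) =
      inj₁ (nearest-tie near-x near-y
        (linear (cpy ⊹ cy≤cx ⊹ tri c p x)
          (solve 5 (λ py px cp cy cx → py :+ (cy :+ cx :+ (cp :+ px)) := px :+ ((cp :+ py) :+ cy :+ cx))
            refl (d p y) (d p x) (d c p) (d c y) (d c x)))
        (linear (tri c p x ⊹ px≤py ⊹ cpy)
          (solve 5 (λ py px cp cy cx → cx :+ ((cp :+ px) :+ py :+ cy) := cy :+ (cx :+ px :+ (cp :+ py)))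
            refl (d p y) (d p x) (d c p) (d c y) (d c x))))
      where
      cy≤cx = proj₁ (proj₂ near-y x (proj₁ near-x))
      px≤py = proj₁ (proj₂ near-x y (proj₁ near-y))
      cpy   = through-cover branching cover c⋢y
    nearest-compatible cover near-x near-y (no c⋢x) (yes c⊑y) = inj₂ (c⋢x , c⊑y)

    index-consistent : Consistent (decode ∘ index)
    index-consistent {p} {c} cover i = nearest-compatible cover (q-nearest p (suc i)) (q-nearest c (suc i)) (c ⊑? _) (c ⊑? _)

    -- If the profile names `q v j` as the parent, then v has depth at most j + 1 in S. Its pointer
    -- in S therefore leads to a vertex of depth at most j, among which `q v j` is nearest to v.
    weight≤ : ∀ v → wt v (decode (index v)) ≤ maybe′ (d v) 0ℚ (pointer v)
    weight≤ v = subst (_≤ maybe′ (d v) 0ℚ (pointer v)) (sym (wt≡ v (decode (index v)))) (go (parent v (decode (index v))) refl)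
      where
      0≤ : ∀ m → 0ℚ ≤ maybe′ (d v) 0ℚ m
      0≤ nothing  = ≤-refl
      0≤ (just u) = 0≤d

      shallow : ∀ {j} → Follows {κ = κ} (adjacency G) X r v (q v) j → Shallow (ℕ.suc (toℕ j)) v
      shallow {j} (inj₁ (last , x)) = v∈ , subst (depth v ℕ.≤_) (sym last) (depth≤k v∈)
        where v∈ = terminals (X-spec x)
      shallow {j} (inj₂ (i , i≡ , qi≡v)) = subst₂ Shallow i≡ qi≡v (proj₁ (q-nearest v i))

      near : ∀ j → r ≢ v → Shallow (ℕ.suc (toℕ j)) v → d v (q v j) ≤ maybe′ (d v) 0ℚ (pointer v)
      near j r≢v (v∈ , depth≤) = subst (λ m → d v (q v j) ≤ maybe′ (d v) 0ℚ m) (sym eq)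
        (proj₁ (proj₂ (q-nearest v j) u (u∈ , ℕ.s≤s⁻¹ (subst (ℕ._≤ ℕ.suc (toℕ j)) depth≡ depth≤))))
        where
        found = pointer-exists v∈ (r≢v ∘ sym)
        u     = proj₁ found
        eq    = proj₂ found
        u∈    = proj₁ (proj₂ (pointer-step v eq))
        depth≡ = proj₂ (proj₂ (pointer-step v eq))

      go : ∀ m → parent v (decode (index v)) ≡ m → maybe′ (d v) 0ℚ m ≤ maybe′ (d v) 0ℚ (pointer v)
      go nothing  _  = 0≤ (pointer v)
      go (just p) eq =
        let (j , p≡ , r≢v , _ , follows) = parent-just (adjacency G) X r (decode (index v)) eq in
        subst (λ p → d v p ≤ maybe′ (d v) 0ℚ (pointer v)) (sym p≡) (near j r≢v (shallow {j} follows))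

    optimum≤cost : sum (λ v → wt v (decode (optimum v))) ≤ cost d S
    optimum≤cost = begin
      sum (λ v → wt v (decode (optimum v)))      ≤⟨ optimum-least index (λ {p} {c} → index-consistent {p} {c}) ⟩
      sum (λ v → wt v (decode (index v)))        ≤⟨ sum-mono weight≤ ⟩
      sum (λ v → maybe′ (d v) 0ℚ (pointer v))    ≤⟨ pointers≤cost d d-sym 0≤d S pointer (λ {u} → irreflexive {u}) (λ {u} eq → proj₁ (pointer-step u eq)) (λ {u} {v} → antisymmetric {u} {v}) ⟩
      cost d S                                   ∎
      where
      open ≤-Reasoning

      irreflexive : ∀ {u} → pointer u ≢ just u
      irreflexive {u} eq = edge-irrefl refl (proj₁ (pointer-step u eq))

      antisymmetric : ∀ {u v} → pointer u ≡ just v → pointer v ≢ just u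
      antisymmetric {u} {v} uv vu = ℕ.<-asym
        (ℕ.≤-reflexive (sym (proj₂ (proj₂ (pointer-step u uv)))))
        (ℕ.≤-reflexive (sym (proj₂ (proj₂ (pointer-step v vu)))))

-- Feasibility, optimality and running time combined.

open import Defs
open Language
open Execution
open TreeMetrics
open ShortestPaths using (adjacency)
open Solutions
open LowerBounds
open import Data.Bool.Base using (Bool)
open import Data.Fin.Base using (Fin; zero; suc; toℕ)
open import Data.Fin.Subset using (Subset; _∈_)
open import Data.List.Base as List using (List)
open import Data.List.Relation.Unary.All using ([]; _∷_)
open import Data.Nat.Base using (ℕ; zero; suc; _≤_; _*_; _^_; z≤n; s≤s; >-nonZero)
open import Data.Nat.Properties using (≤-trans; ≤-refl; *-monoʳ-≤; ^-monoʳ-≤; ^-*-assoc; *-comm; *-monoˡ-≤; module ≤-Reasoning)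
open import Data.Product.Base using (Σ-syntax; _×_; _,_)
open import Data.Rational.Base as ℚ using (ℚ)
import Data.Rational.Properties as ℚ
open import Data.Vec.Base as Vec using (toList; lookup; tabulate)
open import Data.Vec.Properties using ([]=⇒lookup; lookup⇒[]=)
open import Function.Metric.Rational using (IsMetric)
open import Relation.Binary.Construct.Closure.ReflexiveTransitive using (ε; _◅_)
open import Relation.Binary.PropositionalEquality
open import Relation.Nullary.Negation using (¬_; contradiction)

toList-lookup : ∀ {A : Set} {n} (v : Vec.Vec A n) → toList v ≡ List.tabulate (lookup v)
toList-lookup Vec.[]       = refl
toList-lookup (x Vec.∷ xs) = cong (x List.∷_) (toList-lookup xs)

toList-tabulate : ∀ {A : Set} {n} (f : Fin n → A) → toList (tabulate f) ≡ List.tabulate f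
toList-tabulate {n = zero}  f = refl
toList-tabulate {n = suc n} f = cong (f zero List.∷_) (toList-tabulate (λ i → f (suc i)))

levels<k : ∀ n {k} → 1 ≤ k → suc (levels n k) ≤ k
levels<k zero          1≤k            = 1≤k
levels<k (suc zero)    1≤k            = 1≤k
levels<k (suc (suc n)) {suc k} 1≤k    = ≤-refl

weaken-hops : ∀ {n Xs r k l S} → k ≤ l → IsHopSteinerTree {n} Xs r k S → IsHopSteinerTree Xs r l S
weaken-hops k≤l tree = record
  { isTree    = isTree
  ; terminals = terminals
  ; hop-bound = λ v∈ p → ≤-trans (hop-bound v∈ p) k≤l
  }
  where open IsHopSteinerTree tree

-- With at least two vertices the bound is k itself. A graph on a single vertex has no edges, so
-- dropping all levels loses no tree.
fewer-hops : ∀ {n Xs r k S} → 1 ≤ k → IsHopSteinerTree {n} Xs r k S →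
             IsHopSteinerTree Xs r (suc (levels n k)) S
fewer-hops {suc zero} {S = S} 1≤k tree = record
  { isTree    = isTree
  ; terminals = terminals
  ; hop-bound = λ { _ (ε , _) → z≤n ; _ (e ◅ _ , _) → contradiction e (no-edge _ _) }
  }
  where
  open IsHopSteinerTree tree
  no-edge : ∀ u v → ¬ Graph.Edge S u v
  no-edge zero zero e = Graph.edge-irrefl S refl e
fewer-hops {suc (suc n)} {k = suc k} 1≤k tree = tree

theorem4p1 :
  Σ[ alg ∈ Program Input Output ] Σ[ c ∈ ℕ ]
    (∀ (n : ℕ) (d : Fin n → Fin n → ℚ) → IsMetric _≡_ d → IsTreeMetric d →
      (G : WeightedGraph n) → Induces G d →
      (X : Subset n) (r : Fin n) → r ∈ X →
      (k : ℕ) → 1 ≤ k →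
      Σ[ S ∈ Graph n ]
        IsMinimumHopSteinerTree d X r k S ×
        (alg on encodeInput G X r k computes encodeGraph S within (c * n ^ (c * k))))
theorem4p1 = program , programDegree , solve
  where
  solve : ∀ (n : ℕ) (d : Fin n → Fin n → ℚ) → IsMetric _≡_ d → IsTreeMetric d →
    (G : WeightedGraph n) → Induces G d →
    (X : Subset n) (r : Fin n) → r ∈ X →
    (k : ℕ) → 1 ≤ k →
    Σ[ S ∈ Graph n ]
      IsMinimumHopSteinerTree d X r k S ×
      (program on encodeInput G X r k computes encodeGraph S within (programDegree * n ^ (programDegree * k)))
  solve n d isMetric (T , isTree , T-induces) G G-induces X r r∈X k 1≤k =
    solution , (feasible , minimum) , runs
    where
    κ = levels n k
    X? : Fin n → Bool
    X? = lookup X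

    -- `Branching` speaks of the metric only. It is derived from the tree T, although the program
    -- reads G, which may be a different graph inducing d.
    branching = tree-branching d isMetric T T-induces isTree r

    open Solution d isMetric G G-induces κ X? r branching

    feasible : IsHopSteinerTree X r k solution
    feasible = weaken-hops (levels<k n 1≤k) (solution-feasible []=⇒lookup)

    minimum : ∀ S → IsHopSteinerTree X r k S → cost d solution ℚ.≤ cost d S
    minimum S tree = ℚ.≤-trans solution-cost
      (LowerBound.optimum≤cost d isMetric G G-induces κ X? r branching (lookup⇒[]= _ X) r∈X S (fewer-hops 1≤k tree))

    1≤n : 1 ≤ n
    1≤n = positive r
      where
      positive : ∀ {n} → Fin n → 1 ≤ n
      positive zero    = s≤s z≤n
      positive (suc _) = s≤s z≤n

    open Cost (n ^ suc κ) (1≤M n k 1≤n 1≤k) using (within; poly≡)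

    runs : program on encodeInput G X r k computes encodeGraph solution within (programDegree * n ^ (programDegree * k))
    runs with program⇓ n k 1≤n 1≤k (adjacency G) X? r
    ... | within t evaluates t≤ = t , subst₂ (λ x y → x ∷ [] ⊢ program ⇓ y ⟨ t ⟩) input output evaluates , (begin
      -- With M = n ^ (κ + 1) and κ + 1 ≤ k, the bound c * M ^ c is at most c * n ^ (c * k).
      t                                                ≤⟨ t≤ ⟩
      _                                                ≡⟨ poly≡ programDegree ⟩
      programDegree * (n ^ suc κ) ^ programDegree      ≡⟨ cong (programDegree *_) (^-*-assoc n (suc κ) programDegree) ⟩
      programDegree * n ^ (suc κ * programDegree)      ≤⟨ *-monoʳ-≤ programDegree (^-monoʳ-≤ n {{>-nonZero 1≤n}} (*-monoˡ-≤ programDegree (levels<k n 1≤k))) ⟩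
      programDegree * n ^ (k * programDegree)          ≡⟨ cong (λ e → programDegree * n ^ e) (*-comm k programDegree) ⟩
      programDegree * n ^ (programDegree * k)          ∎)
      where
      open ≤-Reasoning

      input : (matrix (adjacency G) , List.tabulate X? , toℕ r , k) ≡ encodeInput G X r k
      input = cong (λ x → matrix (adjacency G) , x , toℕ r , k) (sym (toList-lookup X))

      output : (List.tabulate member , matrix edge) ≡ encodeGraph solution
      output = cong (_, matrix edge) (sym (toList-tabulate member))
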